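{- Optimal Linear Arrangement parameterized by vertex cover is fixed parameter tractable: there is an algorithm that, given an $n$-vertex graph $G$ and an integer $k$ such that $G$ has a vertex cover of size at most $k$, computes a bijection $\sigma: V(G)\to\{1,\dots,n\}$ minimizing $\sum_{uv\in E(G)}|\sigma(u)-\sigma(v)|$, in time $f(k)\,n^{O(1)}$ for some computable function $f$.
   Context: A vertex cover of a graph $G$ is a set $C\subseteq V(G)$ such that every edge of $G$ has at least one endpoint in $C$. In Optimal Linear Arrangement, given an undirected graph $G$ on $n$ vertices, the task is to find a permutation $\sigma:V(G)\to\{1,\dots,n\}$ minimizing the cost $val(\sigma,G)=\sum_{uv\in E(G)}|\sigma(u)-\sigma(v)|$. -}

module Defs where

open import Data.Bool.Base using (Bool; false; T; if_then_else_)
open import Data.Bool.Properties using (T?)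
open import Data.Fin.Base using (Fin; toℕ; fromℕ<; remQuot)
import Data.Fin.Properties as Fin
open import Data.Fin.Permutation using (Permutation′; _⟨$⟩ʳ_)
open import Data.Fin.Subset using (Subset; _∈_; ∣_∣)
open import Data.List.Base using (List; map; filter; allFin; cartesianProduct)
open import Data.Nat.Base using (ℕ; suc; _+_; _*_; _∸_; _≤_; ∣_-_∣)
open import Data.Nat.ListAction using (sum)
open import Data.Nat.Properties using (_≟_; _<?_)
open import Data.Product.Base using (Σ; ∃₂; _×_; _,_; uncurry)
open import Data.Sum.Base using (_⊎_)
open import Relation.Binary.PropositionalEquality.Core using (_≡_; _≢_)
open import Relation.Nullary.Decidable.Core using (does; yes; no; _×-dec_)

------------------------------------------------------------------------
-- Graphs, vertex covers and linear arrangements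

record Graph (n : ℕ) : Set where
  field
    adj    : Fin n → Fin n → Bool
    symm   : ∀ u v → adj u v ≡ adj v u
    irrefl : ∀ v → adj v v ≡ false

open Graph public

-- Each undirected edge is listed exactly once, as the pair (u , v) with u < v.
edges : ∀ {n} → Graph n → List (Fin n × Fin n)
edges {n} G =
  filter (λ (u , v) → (u Fin.<? v) ×-dec T? (adj G u v))
         (cartesianProduct (allFin n) (allFin n))

IsVertexCover : ∀ {n} → Graph n → Subset n → Set
IsVertexCover G C = ∀ u v → T (adj G u v) → u ∈ C ⊎ v ∈ C

HasVertexCover≤ : ∀ {n} → Graph n → ℕ → Set
HasVertexCover≤ {n} G k = Σ (Subset n) λ C → IsVertexCover G C × ∣ C ∣ ≤ k

-- Fin n is identified with the set of positions {1,…,n}.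
position : ∀ {n} → Permutation′ n → Fin n → ℕ
position σ v = suc (toℕ (σ ⟨$⟩ʳ v))

val : ∀ {n} → Permutation′ n → Graph n → ℕ
val σ G = sum (map (λ (u , v) → ∣ position σ u - position σ v ∣) (edges G))

IsOptimal : ∀ {n} → Graph n → Permutation′ n → Set
IsOptimal G σ = ∀ τ → val σ G ≤ val τ G

------------------------------------------------------------------------
-- Random access machines
--
-- The machine of Cook and Reckhow at unit cost, with structured control flow.
-- A program mentions finitely many registers; the memory is addressed
-- indirectly.  The arithmetic is addition and truncated subtraction only:
-- without multiplication t steps lengthen the numbers by at most O(t) bits, so
-- running time is polynomially related to that of Turing machines.

record State : Set where
  constructor ⟨_,_⟩
  field
    reg : ℕ → ℕ
    mem : ℕ → ℕ

open State public

data Exp : Set where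
  lit     : ℕ → Exp
  var     : ℕ → Exp
  load    : Exp → Exp
  _⊕_ _⊖_ : Exp → Exp → Exp

data Cmd : Set where
  skip    : Cmd
  _≔_     : ℕ → Exp → Cmd
  store   : (address value : Exp) → Cmd
  _⨟_     : Cmd → Cmd → Cmd
  ifnz    : Exp → Cmd → Cmd → Cmd
  whilenz : Exp → Cmd → Cmd

infixl 7 _⊕_ _⊖_
infix  6 _≔_
infixr 5 _⨟_

⟦_⟧ : Exp → State → ℕ
⟦ lit c ⟧  s = c
⟦ var r ⟧  s = reg s r
⟦ load e ⟧ s = mem s (⟦ e ⟧ s)
⟦ d ⊕ e ⟧  s = ⟦ d ⟧ s + ⟦ e ⟧ s
⟦ d ⊖ e ⟧  s = ⟦ d ⟧ s ∸ ⟦ e ⟧ s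

cost : Exp → ℕ
cost (lit c)  = 1
cost (var r)  = 1
cost (load e) = 1 + cost e
cost (d ⊕ e)  = 1 + cost d + cost e
cost (d ⊖ e)  = 1 + cost d + cost e

_[_↦_] : (ℕ → ℕ) → ℕ → ℕ → (ℕ → ℕ)
(f [ a ↦ x ]) b = if does (b ≟ a) then x else f b

-- p ⊢ s ⇓ s′ [ t ]: started in state s, the program p halts in state s′ after
-- exactly t steps.
data _⊢_⇓_[_] : Cmd → State → State → ℕ → Set where
  skip : ∀ {s} → skip ⊢ s ⇓ s [ 1 ]
  assign : ∀ {r e s} →
    (r ≔ e) ⊢ s ⇓ ⟨ reg s [ r ↦ ⟦ e ⟧ s ] , mem s ⟩ [ 1 + cost e ]
  store : ∀ {d e s} →
    store d e ⊢ s ⇓ ⟨ reg s , mem s [ ⟦ d ⟧ s ↦ ⟦ e ⟧ s ] ⟩ [ 1 + cost d + cost e ]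
  seq : ∀ {p q s s′ s″ t u} →
    p ⊢ s ⇓ s′ [ t ] → q ⊢ s′ ⇓ s″ [ u ] → (p ⨟ q) ⊢ s ⇓ s″ [ t + u ]
  if-nonzero : ∀ {e p q s s′ t} → ⟦ e ⟧ s ≢ 0 →
    p ⊢ s ⇓ s′ [ t ] → ifnz e p q ⊢ s ⇓ s′ [ 1 + cost e + t ]
  if-zero : ∀ {e p q s s′ t} → ⟦ e ⟧ s ≡ 0 →
    q ⊢ s ⇓ s′ [ t ] → ifnz e p q ⊢ s ⇓ s′ [ 1 + cost e + t ]
  while-zero : ∀ {e p s} → ⟦ e ⟧ s ≡ 0 →
    whilenz e p ⊢ s ⇓ s [ 1 + cost e ]
  while-nonzero : ∀ {e p s s′ s″ t u} → ⟦ e ⟧ s ≢ 0 →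
    p ⊢ s ⇓ s′ [ t ] → whilenz e p ⊢ s′ ⇓ s″ [ u ] →
    whilenz e p ⊢ s ⇓ s″ [ 1 + cost e + t + u ]

zeros : ℕ → ℕ
zeros _ = 0

-- The argument is passed in register 0 and the result returned there.
Computable : (ℕ → ℕ) → Set
Computable f = Σ Cmd λ p → ∀ x →
  ∃₂ λ s t → p ⊢ ⟨ zeros [ 0 ↦ x ] , zeros ⟩ ⇓ s [ t ] × reg s 0 ≡ f x

------------------------------------------------------------------------
-- Input and output of programs for Optimal Linear Arrangement

-- The n × n adjacency matrix in row-major order: cell n * u + v holds the bit
-- adj G u v, and all cells from n * n on hold 0.
adjacencyMatrix : ∀ {n} → Graph n → ℕ → ℕ
adjacencyMatrix {n} G a with a <? n * n
... | yes a<n² = if uncurry (adj G) (remQuot n (fromℕ< a<n²)) then 1 else 0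
... | no  _    = 0

-- Register 0 holds n, register 1 holds k, and all other registers hold 0.
input : ∀ {n} → Graph n → ℕ → State
input {n} G k = ⟨ (zeros [ 0 ↦ n ]) [ 1 ↦ k ] , adjacencyMatrix G ⟩

Outputs : ∀ {n} → State → Permutation′ n → Set
Outputs s σ = ∀ v → mem s (toℕ v) ≡ position σ v

SolvesWithin : ∀ {n} → Cmd → Graph n → ℕ → ℕ → Set
SolvesWithin {n} p G k bound =
  ∃₂ λ s t → p ⊢ input G k ⇓ s [ t ] × t ≤ bound ×
  Σ (Permutation′ n) λ σ → Outputs s σ × IsOptimal G σ

{-# OPTIONS --safe #-}

-- Let C be a vertex cover with at most k elements.  Vertices with the same
-- neighbours (twins) are interchangeable, and there are at most 3^k classes of
-- twins.  Between two consecutive vertices of C an adjacent swap changes the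
-- cost by a difference of slopes (neighbours to the left minus neighbours to
-- the right), so each gap may be sorted by slope, and some optimal arrangement
-- is a word of boundedly many blocks of twins.  For a fixed sequence of blocks
-- twice the cost is a quadratic form in the multiplicities z of the blocks.
--
-- Such a form is minimised by elimination.  Suppose that D z = M z expresses
-- the first variables through the others, and let y be the column of M for the
-- next variable, so that z + y and z - y satisfy the same equations.  Moving
-- along y as long as the form does not increase, one stops either where some
-- coordinate of z is smaller than that of y, or where both neighbours of z are
-- worse, which bounds the linear function grad(y)·z.  Both give one more linear
-- equation with bounded coefficients.  In the end each multiplicity is a linear
-- form in 1 and the class sizes, divided by a constant, with all coefficients
-- bounded in terms of k.
--
-- Hence it suffices to try all sequences of blocks and all such coefficients.
-- This search is a term with primitive recursion over loop bounds that are
-- polynomial in n for fixed k, and terms are compiled to the machine.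

module Submission where

open import Defs
open import Data.Bool.Base using (Bool; true; false; T; if_then_else_; _∧_)
import Data.Bool.Properties as Bool
open import Data.Empty using (⊥; ⊥-elim)
open import Data.Fin.Base using (Fin; zero; suc; toℕ; fromℕ<; combine; remQuot; punchOut; funToFin; finToFun)
open import Data.Fin.Permutation
  using (Permutation′; permutation; _⟨$⟩ʳ_; _⟨$⟩ˡ_; inverseˡ; inverseʳ) renaming (id to idₚ)
import Data.Fin.Properties as Fin
open import Data.Fin.Subset using (Subset) renaming (∣_∣ to ∣_∣ˢ)
open import Data.Integer.Base using (ℤ; -[1+_]; ∣_∣; 0ℤ; 1ℤ; -1ℤ; -_; +≤+; +<+)
  renaming (+_ to ⁺_; _+_ to _+ᶻ_; _*_ to _*ᶻ_; _-_ to _-ᶻ_; _≤_ to _≤ᶻ_; _<_ to _<ᶻ_)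
import Data.Integer.Properties as ℤₚ
open import Data.Integer.Tactic.RingSolver using () renaming (solve-∀ to solveᶻ-∀)
open import Data.List.Base
  using (List; []; _∷_; _++_; [_]; map; filter; tabulate; allFin; cartesianProduct; replicate; length)
  renaming (lookup to lookupₗ)
open import Data.List.Membership.Propositional using () renaming (_∈_ to _∈ₗ_)
open import Data.List.Properties
  using (++-assoc; ++-identityʳ; ∷-injective; map-++; map-∘; map-tabulate;
         length-++; length-map; length-replicate; length-tabulate)
open import Data.List.Relation.Binary.Permutation.Propositional using (_↭_; ↭-sym)
open import Data.List.Relation.Binary.Permutation.Propositional.Properties
  using (↭-length; Any-resp-↭; All-resp-↭)
open import Data.List.Relation.Unary.All using (All; []; _∷_) renaming (map to All-map)
open import Data.List.Relation.Unary.All.Properties using ()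
  renaming (++⁺ to All-++⁺; replicate⁺ to All-replicate)
open import Data.List.Relation.Unary.AllPairs using (AllPairs; []; _∷_) renaming (map to AllPairs-map)
open import Data.List.Relation.Unary.Any using (Any; here; there) renaming (index to indexₐ; map to Any-map)
open import Data.List.Relation.Unary.Any.Properties using (lookup-index) renaming (map⁺ to Any-map⁺)
open import Data.List.Relation.Unary.Linked.Properties using (Linked⇒AllPairs)
import Data.List.Sort as Sort
open import Data.Nat.Base
open import Data.Nat.DivMod
open import Data.Nat.ListAction using (sum)
open import Data.Nat.ListAction.Properties using (sum-++)
open import Data.Nat.Properties
open import Data.Nat.Tactic.RingSolver using (solve-∀)
open import Data.Product.Base using (Σ; ∃; ∃₂; _×_; _,_; proj₁; proj₂)
open import Data.Sum.Base using (_⊎_; inj₁; inj₂)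
open import Data.Unit.Base using (⊤; tt)
open import Data.Vec.Base using (Vec; []; _∷_; lookup; tail) renaming (tabulate to tabulateᵥ)
open import Data.Vec.Properties using ([]=⇒lookup; tabulate∘lookup)
open import Function.Base using (_∘_; id)
import Relation.Binary.Construct.On as On
open import Relation.Binary.Definitions using (tri<; tri≈; tri>)
open import Relation.Binary.PropositionalEquality hiding ([_])
open import Relation.Nullary using (¬_; Dec; yes; no; does; contradiction; ¬?; _×-dec_)
open import Relation.Nullary.Decidable using (decidable-stable)
open import Relation.Unary using (Decidable)
open import Algebra.Properties.CommutativeMonoid.Sum +-0-commutativeMonoid
  using (∑-distrib-+; ∑-comm; sum-cong-≗; sum-permute) renaming (sum to ∑ᶠ)

-- Bounded sums and searches

-- Multiplicities of blocks may be as large as n, so guessing them directly would cost n to a power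
-- growing with k. Elimination removes this obstacle, but only inside the correctness proof: it
-- shows that optimal multiplicities are described by one of a number of tables that depends on k
-- alone. The program solves no quadratic program and finds no vertex cover. It gets the twin
-- classes by comparing rows of the adjacency matrix, decodes every number below `codeCount k` as a
-- table, discards the tables that fail to place some vertex, and keeps a cheapest arrangement.
--
-- The machine has no product: multiplication is iterated addition, division is bounded search, and
-- signed coefficients are stored with an offset. Costs are doubled to avoid halves.
--
-- For the time bound, every loop of the search has a global (n, `base k` or `codeCount k`) as its
-- bound. Hence its steps are polynomial in the largest global whatever the arguments, and that is
-- at most `codeCount k` times the square of `1 ⊔ n`. The terms that compute the parameters need not
-- be polynomial; their step count is itself a term in k, so f is computable.

natrec : ℕ → ℕ → (ℕ → ℕ → ℕ) → ℕ
natrec zero    z s = z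
natrec (suc i) z s = s i (natrec i z s)

∑ : ℕ → (ℕ → ℕ) → ℕ
∑ zero    f = 0
∑ (suc n) f = f n + ∑ n f

natrec-∑ : ∀ n f → natrec n 0 (λ i a → f i + a) ≡ ∑ n f
natrec-∑ zero    f = refl
natrec-∑ (suc n) f = cong (f n +_) (natrec-∑ n f)

∑-cong : ∀ n {f g : ℕ → ℕ} → (∀ i → i < n → f i ≡ g i) → ∑ n f ≡ ∑ n g
∑-cong zero    h = refl
∑-cong (suc n) h = cong₂ _+_ (h n ≤-refl) (∑-cong n (λ i i<n → h i (m<n⇒m<1+n i<n)))

∑-mono-≤ : ∀ n {f g : ℕ → ℕ} → (∀ i → i < n → f i ≤ g i) → ∑ n f ≤ ∑ n g
∑-mono-≤ zero    h = z≤n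
∑-mono-≤ (suc n) h = +-mono-≤ (h n ≤-refl) (∑-mono-≤ n (λ i i<n → h i (m<n⇒m<1+n i<n)))

∑-const : ∀ n c → ∑ n (λ _ → c) ≡ n * c
∑-const zero    c = refl
∑-const (suc n) c = cong (c +_) (∑-const n c)

∑-bound : ∀ n {f : ℕ → ℕ} {c} → (∀ i → i < n → f i ≤ c) → ∑ n f ≤ n * c
∑-bound n {c = c} h = ≤-trans (∑-mono-≤ n h) (≤-reflexive (∑-const n c))

∑-zero : ∀ n → ∑ n (λ _ → 0) ≡ 0
∑-zero n = trans (∑-const n 0) (*-zeroʳ n)

∑-head : ∀ n f → ∑ (suc n) f ≡ f 0 + ∑ n (λ i → f (suc i))
∑-head zero    f = refl
∑-head (suc n) f = begin
  f (suc n) + ∑ (suc n) f                        ≡⟨ cong (f (suc n) +_) (∑-head n f) ⟩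
  f (suc n) + (f 0 + ∑ n (λ i → f (suc i)))      ≡⟨ +-assoc-swap (f (suc n)) (f 0) _ ⟩
  f 0 + (f (suc n) + ∑ n (λ i → f (suc i)))      ∎
  where
  open ≡-Reasoning
  +-assoc-swap : ∀ a b c → a + (b + c) ≡ b + (a + c)
  +-assoc-swap = solve-∀

∑-+ : ∀ n f g → ∑ n (λ i → f i + g i) ≡ ∑ n f + ∑ n g
∑-+ zero    f g = refl
∑-+ (suc n) f g rewrite ∑-+ n f g = swap (f n) (g n) (∑ n f) (∑ n g)
  where
  swap : ∀ a b c d → a + b + (c + d) ≡ a + c + (b + d)
  swap = solve-∀

∑-*ʳ : ∀ n f c → ∑ n (λ i → f i * c) ≡ ∑ n f * c
∑-*ʳ zero    f c = refl
∑-*ʳ (suc n) f c rewrite ∑-*ʳ n f c = sym (*-distribʳ-+ c (f n) (∑ n f))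

∑-swap : ∀ m n (f : ℕ → ℕ → ℕ) → ∑ m (λ i → ∑ n (f i)) ≡ ∑ n (λ j → ∑ m (λ i → f i j))
∑-swap zero    n f = sym (∑-zero n)
∑-swap (suc m) n f = trans (cong (∑ n (f m) +_) (∑-swap m n f))
                           (sym (∑-+ n (f m) (λ j → ∑ m (λ i → f i j))))

∑-monoˡ-≤ : ∀ f {m n} → m ≤ n → ∑ m f ≤ ∑ n f
∑-monoˡ-≤ f {n = zero}  z≤n = z≤n
∑-monoˡ-≤ f {m} {suc n} m≤1+n with m≤n⇒m<n∨m≡n m≤1+n
... | inj₁ (s≤s m≤n) = ≤-trans (∑-monoˡ-≤ f m≤n) (m≤n+m (∑ n f) (f n))
... | inj₂ refl      = ≤-refl

∑≡0⇒≡0 : ∀ n f → ∑ n f ≡ 0 → ∀ i → i < n → f i ≡ 0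
∑≡0⇒≡0 (suc n) f eq i i<1+n with m≤n⇒m<n∨m≡n (≤-pred i<1+n)
... | inj₁ i<n  = ∑≡0⇒≡0 n f (m+n≡0⇒n≡0 (f n) eq) i i<n
... | inj₂ refl = m+n≡0⇒m≡0 (f n) eq

≡0⇒∑≡0 : ∀ n f → (∀ i → i < n → f i ≡ 0) → ∑ n f ≡ 0
≡0⇒∑≡0 n f h = trans (∑-cong n h) (∑-zero n)

ifz : ℕ → ℕ → ℕ → ℕ
ifz zero    a b = a
ifz (suc _) a b = b

-- The value 0 stands for truth, so that conjunction is addition and m ∸ n
-- expresses m ≤ n.

gap : ℕ → ℕ → ℕ
gap a b = (a ∸ b) + (b ∸ a)

ind : ℕ → ℕ
ind c = 1 ∸ c

gap-refl : ∀ a → gap a a ≡ 0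
gap-refl a rewrite n∸n≡0 a = refl

gap≡0⇒≡ : ∀ a b → gap a b ≡ 0 → a ≡ b
gap≡0⇒≡ a b eq = ≤-antisym (m∸n≡0⇒m≤n (m+n≡0⇒m≡0 (a ∸ b) eq)) (m∸n≡0⇒m≤n (m+n≡0⇒n≡0 (a ∸ b) eq))

gap≡∣-∣ : ∀ a b → gap a b ≡ ∣ a - b ∣
gap≡∣-∣ zero    zero    = refl
gap≡∣-∣ zero    (suc b) = refl
gap≡∣-∣ (suc a) zero    = +-identityʳ (suc a)
gap≡∣-∣ (suc a) (suc b) = gap≡∣-∣ a b

ind-gap-≡ : ∀ {a b} → a ≡ b → ind (gap a b) ≡ 1
ind-gap-≡ {a} refl rewrite gap-refl a = refl

ind-gap-≢ : ∀ {a b} → a ≢ b → ind (gap a b) ≡ 0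
ind-gap-≢ {a} {b} a≢b with gap a b in eq
... | zero  = contradiction (gap≡0⇒≡ a b eq) a≢b
... | suc k = 0∸n≡0 k

ind≤1 : ∀ c → ind c ≤ 1
ind≤1 c = m∸n≤m 1 c

-- Loops of fast terms run only over globals, so a variable upper limit `x` becomes a test inside a
-- loop of fixed length `l`.
psum : ℕ → ℕ → (ℕ → ℕ) → ℕ
psum l x f = ∑ l (λ i → ifz (suc i ∸ x) (f i) 0)

psum≡∑ : ∀ l x f → x ≤ l → psum l x f ≡ ∑ x f
psum≡∑ zero    zero f z≤n = refl
psum≡∑ (suc l) x f x≤1+l with m≤n⇒m<n∨m≡n x≤1+l
... | inj₁ (s≤s x≤l) with suc l ∸ x | m<n⇒0<n∸m (s≤s x≤l)
...   | suc _ | _ = psum≡∑ l x f x≤l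
psum≡∑ (suc l) .(suc l) f x≤1+l | inj₂ refl rewrite n∸n≡0 l =
  cong (f l +_) (∑-cong l λ i i<l → cong (λ c → ifz c (f i) 0) (m≤n⇒m∸n≡0 (<⇒≤ i<l)))

-- Bounded minimisation as a fold: the candidate moves up by one until it meets a zero of `P` and
-- then stays there, so the result is `n` exactly when there is no zero below `n`.
μ : ℕ → (ℕ → ℕ) → ℕ
μ zero    P = 0
μ (suc n) P = ifz (P (μ n P)) (μ n P) (suc (μ n P))

natrec-μ : ∀ n P → natrec n 0 (λ _ r → ifz (P r) r (suc r)) ≡ μ n P
natrec-μ zero    P = refl
natrec-μ (suc n) P rewrite natrec-μ n P = refl

μ≤ : ∀ n P → μ n P ≤ n
μ≤ zero    P = z≤n
μ≤ (suc n) P with P (μ n P)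
... | zero  = m≤n⇒m≤1+n (μ≤ n P)
... | suc _ = s≤s (μ≤ n P)

μ-hit : ∀ n P → μ n P < n → P (μ n P) ≡ 0
μ-hit (suc n) P lt with P (μ n P) in eq
... | zero  = eq
... | suc _ = contradiction (trans (sym eq) (μ-hit n P (≤-pred lt))) λ ()

μ-least : ∀ n P i → i < μ n P → P i ≢ 0
μ-least (suc n) P i i<μ with P (μ n P) in eq
... | zero  = μ-least n P i i<μ
... | suc _ with m≤n⇒m<n∨m≡n (≤-pred i<μ)
...   | inj₁ i<  = μ-least n P i i<
...   | inj₂ refl = λ Pi≡0 → contradiction (trans (sym eq) Pi≡0) λ ()

μ-found : ∀ n P i → i < n → P i ≡ 0 → μ n P < n
μ-found n P i i<n Pi≡0 with m≤n⇒m<n∨m≡n (μ≤ n P)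
... | inj₁ lt = lt
... | inj₂ eq = contradiction Pi≡0 (μ-least n P i (subst (i <_) (sym eq) i<n))

-- Covers the failing search as well: for `i` equal to `n` the second hypothesis is vacuous.
μ-unique : ∀ n P i → i ≤ n → (i < n → P i ≡ 0) → (∀ j → j < i → P j ≢ 0) → μ n P ≡ i
μ-unique n P i i≤n hit least with <-cmp (μ n P) i
... | tri≈ _ eq _ = eq
... | tri< lt _ _ = contradiction (μ-hit n P (<-≤-trans lt i≤n)) (least _ lt)
... | tri> _ _ gt = contradiction (hit (<-≤-trans gt (μ≤ n P))) (μ-least n P i gt)

-- Terms with primitive recursion and their compilation

record Globals : Set where
  field
    glob : Fin 4 → ℕ
    cell : ℕ → ℕ

open Globals public

-- The minimum, by truncated subtraction. Reading the input only at clamped addresses makes the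
-- value of a term independent of the memory further up, where results are being stored.
clamp : ℕ → ℕ → ℕ
clamp l a = a ∸ (a ∸ l)

-- The flag `g` says whether globals and input may be read. Terms with flag `false` compute the
-- parameters from k before the globals exist; for these the step count is again expressed by a
-- term.
data Tm (g : Bool) : ℕ → Set where
  lit  : ∀ {m} → ℕ → Tm g m
  var  : ∀ {m} → Fin m → Tm g m
  gbl  : ∀ {m} → T g → Fin 4 → Tm g m
  inp  : ∀ {m} → T g → Tm g m → Tm g m
  _+′_ : ∀ {m} → Tm g m → Tm g m → Tm g m
  _∸′_ : ∀ {m} → Tm g m → Tm g m → Tm g m
  ifz′ : ∀ {m} → Tm g m → Tm g m → Tm g m → Tm g m
  app  : ∀ {m j} → Tm g j → Vec (Tm g m) j → Tm g m
  rec  : ∀ {m} → Tm g m → Tm g m → Tm g (2 + m) → Tm g m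

Env : Bool → Set
Env true  = Globals
Env false = ⊤

globOf : ∀ {g} → T g → Env g → Fin 4 → ℕ
globOf {true} _ G = glob G

cellOf : ∀ {g} → T g → Env g → ℕ → ℕ
cellOf {true} _ G a = cell G (clamp (glob G (suc (suc (suc zero)))) a)

eval  : ∀ {g m} → Env g → Tm g m → Vec ℕ m → ℕ
evals : ∀ {g m j} → Env g → Vec (Tm g m) j → Vec ℕ m → Vec ℕ j
eval G (lit c)      e = c
eval G (var i)      e = lookup e i
eval G (gbl p i)    e = globOf p G i
eval G (inp p a)    e = cellOf p G (eval G a e)
eval G (a +′ b)     e = eval G a e + eval G b e
eval G (a ∸′ b)     e = eval G a e ∸ eval G b e
eval G (ifz′ c a b) e = ifz (eval G c e) (eval G a e) (eval G b e)
eval G (app f ts)   e = eval G f (evals G ts e)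
eval G (rec q z s)  e = natrec (eval G q e) (eval G z e) (λ i a → eval G s (i ∷ a ∷ e))
evals G []       e = []
evals G (t ∷ ts) e = eval G t e ∷ evals G ts e

-- An upper bound rather than the exact time: a conditional is charged for both branches, so that
-- the bound follows the structure of the term.
steps  : ∀ {g m} → Env g → Tm g m → Vec ℕ m → ℕ
stepss : ∀ {g m j} → Env g → Vec (Tm g m) j → Vec ℕ m → ℕ
steps G (lit c)      e = 2
steps G (var i)      e = 2
steps G (gbl p i)    e = 2
steps G (inp p a)    e = 7 + steps G a e
steps G (a +′ b)     e = 4 + (steps G a e + steps G b e)
steps G (a ∸′ b)     e = 4 + (steps G a e + steps G b e)
steps G (ifz′ c a b) e = 2 + (steps G c e + (steps G a e + steps G b e))
steps G (app f ts)   e = 2 + (stepss G ts e + steps G f (evals G ts e))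
steps G (rec q z s)  e =
  -- The 6 pays for resetting the index, the last loop test and copying the result; the 12 pays for
  -- a loop test and the three assignments that close a round.
  6 + (steps G q e + (steps G z e + ∑ (eval G q e) (λ i →
    12 + steps G s (i ∷ natrec i (eval G z e) (λ i a → eval G s (i ∷ a ∷ e)) ∷ e))))
stepss G []       e = 1
stepss G (t ∷ ts) e = steps G t e + stepss G ts e

-- Code for t leaves its value in register d and uses no register below d;
-- ρ tells in which registers the variables of t are kept.

extend : ∀ {m} → (Fin m → ℕ) → ℕ → Fin (2 + m) → ℕ
extend ρ d zero          = 2 + d
extend ρ d (suc zero)    = 1 + d
extend ρ d (suc (suc i)) = ρ i

code  : ∀ {g m} → Tm g m → (Fin m → ℕ) → ℕ → Cmd
codes : ∀ {g m j} → Vec (Tm g m) j → (Fin m → ℕ) → ℕ → Cmd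
code (lit c)      ρ d = d ≔ lit c
code (var i)      ρ d = d ≔ var (ρ i)
code (gbl _ i)    ρ d = d ≔ var (toℕ i)
code (inp _ a)    ρ d = code a ρ d ⨟ d ≔ load (var d ⊖ (var d ⊖ var 3))
code (a +′ b)     ρ d = code a ρ d ⨟ code b ρ (1 + d) ⨟ d ≔ var d ⊕ var (1 + d)
code (a ∸′ b)     ρ d = code a ρ d ⨟ code b ρ (1 + d) ⨟ d ≔ var d ⊖ var (1 + d)
code (ifz′ c a b) ρ d = code c ρ d ⨟ ifnz (var d) (code b ρ d) (code a ρ d)
code (app {j = j} f ts) ρ d =
  codes ts ρ d ⨟ code f (λ i → d + toℕ i) (d + j) ⨟ d ≔ var (d + j)
-- Register `d` counts the remaining rounds down, `1 + d` holds the accumulator and `2 + d` counts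
-- the index up; the body works from `3 + d` on.
code (rec q z s)  ρ d =
  code q ρ d ⨟ code z ρ (1 + d) ⨟ (2 + d) ≔ lit 0 ⨟
  whilenz (var d)
    (code s (extend ρ d) (3 + d) ⨟ (1 + d) ≔ var (3 + d) ⨟
     (2 + d) ≔ var (2 + d) ⊕ lit 1 ⨟ d ≔ var d ⊖ lit 1) ⨟
  d ≔ var (1 + d)
codes []       ρ d = skip
codes (t ∷ ts) ρ d = code t ρ d ⨟ codes ts ρ (suc d)

upd-same : ∀ f a x → (f [ a ↦ x ]) a ≡ x
upd-same f a x with a ≡ᵇ a | ≡⇒≡ᵇ a a refl
... | true | _ = refl

upd-other : ∀ f {a} x {b} → b ≢ a → (f [ a ↦ x ]) b ≡ f b
upd-other f {a} x {b} b≢a with b ≡ᵇ a | ≡ᵇ⇒≡ b a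
... | true  | eq = contradiction (eq tt) b≢a
... | false | _  = refl

-- Registers 0 to 3 hold the globals, and `4 ≤ d` protects them from the code. Memory has to agree
-- with the input only at the addresses that clamping can produce.
Agrees : (g : Bool) → Env g → ℕ → State → Set
Agrees true  G d s = 4 ≤ d × (∀ i → reg s (toℕ i) ≡ glob G i) ×
                     (∀ a → a ≤ glob G (suc (suc (suc zero))) → mem s a ≡ cell G a)
Agrees false _ d s = ⊤

Holds : ∀ {m} → (Fin m → ℕ) → ℕ → Vec ℕ m → State → Set
Holds ρ d e s = ∀ i → ρ i < d × reg s (ρ i) ≡ lookup e i

record Unchanged (d : ℕ) (s s′ : State) : Set where
  constructor unchanged
  field
    regs : ∀ r → r < d → reg s′ r ≡ reg s r
    cells : mem s′ ≡ mem s

open Unchanged public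

record Runs (p : Cmd) (d : ℕ) (s : State) (bound : ℕ) (s′ : State) : Set where
  constructor runs
  field
    {time} : ℕ
    exec   : p ⊢ s ⇓ s′ [ time ]
    time≤  : time ≤ bound
    frame  : Unchanged d s s′

open Runs public

unchanged-refl : ∀ {d s} → Unchanged d s s
unchanged-refl = unchanged (λ _ _ → refl) refl

unchanged-trans : ∀ {d d′ s s′ s″} → d ≤ d′ → Unchanged d s s′ → Unchanged d′ s′ s″ → Unchanged d s s″
unchanged-trans d≤d′ u v = unchanged
  (λ r r<d → trans (regs v r (<-≤-trans r<d d≤d′)) (regs u r r<d))
  (trans (cells v) (cells u))

agrees-step : ∀ g {G : Env g} {d d′ s s′} → d ≤ d′ → Agrees g G d s → Unchanged d s s′ → Agrees g G d′ s′
agrees-step false d≤d′ a u = tt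
agrees-step true d≤d′ (4≤d , rs , ms) u =
  ≤-trans 4≤d d≤d′ ,
  (λ i → trans (regs u (toℕ i) (<-≤-trans (Fin.toℕ<n i) 4≤d)) (rs i)) ,
  (λ a a≤ → trans (cong (λ f → f a) (cells u)) (ms a a≤))

holds-step : ∀ {m} {ρ : Fin m → ℕ} e {d d′ s s′} → d ≤ d′ → Holds ρ d e s → Unchanged d s s′ → Holds ρ d′ e s′
holds-step e d≤d′ h u i = <-≤-trans (proj₁ (h i)) d≤d′ ,
  trans (regs u _ (proj₁ (h i))) (proj₂ (h i))

set : State → ℕ → ℕ → State
set s r x = ⟨ reg s [ r ↦ x ] , mem s ⟩

set-unchanged : ∀ {d s r x} → d ≤ r → Unchanged d s (set s r x)
set-unchanged {s = s} {x = x} d≤r =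
  unchanged (λ b b<d → upd-other (reg s) x (<⇒≢ (<-≤-trans b<d d≤r))) refl

runs-assign : ∀ {d s r e} → d ≤ r → Runs (r ≔ e) d s (1 + cost e) (set s r (⟦ e ⟧ s))
runs-assign d≤r = runs assign ≤-refl (set-unchanged d≤r)

runs-seq : ∀ {d s s′ s″ p q t u} → Runs p d s t s′ → Runs q d s′ u s″ → Runs (p ⨟ q) d s (t + u) s″
runs-seq p q = runs (seq (exec p) (exec q)) (+-mono-≤ (time≤ p) (time≤ q))
                    (unchanged-trans ≤-refl (frame p) (frame q))

runs-weaken : ∀ {d d′ s s′ p t} → d ≤ d′ → Runs p d′ s t s′ → Runs p d s t s′
runs-weaken d≤d′ p = runs (exec p) (time≤ p)
  (unchanged (λ r r<d → regs (frame p) r (<-≤-trans r<d d≤d′)) (cells (frame p)))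

runs-≤ : ∀ {d s s′ p t u} → t ≤ u → Runs p d s t s′ → Runs p d s u s′
runs-≤ t≤u p = runs (exec p) (≤-trans (time≤ p) t≤u) (frame p)

Result : Cmd → ℕ → State → ℕ → ℕ → Set
Result p d s bound x = Σ State λ s′ → Runs p d s bound s′ × reg s′ d ≡ x

Results : ∀ {j} → Cmd → ℕ → State → ℕ → Vec ℕ j → Set
Results p d s bound xs = Σ State λ s′ → Runs p d s bound s′ × (∀ i → reg s′ (d + toℕ i) ≡ lookup xs i)

-- Adds the times in the order in which the loop spends them, from index `i` upwards, whereas `∑`
-- splits off the last index.
upSum : (ℕ → ℕ) → ℕ → ℕ → ℕ
upSum φ zero    i = 0
upSum φ (suc r) i = φ i + upSum φ r (suc i)

upSum-∑ : ∀ φ r i → upSum φ r i + ∑ i φ ≡ ∑ (i + r) φ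
upSum-∑ φ zero    i = cong (λ k → ∑ k φ) (sym (+-identityʳ i))
upSum-∑ φ (suc r) i = begin
  φ i + upSum φ r (suc i) + ∑ i φ    ≡⟨ shuffle (φ i) (upSum φ r (suc i)) (∑ i φ) ⟩
  upSum φ r (suc i) + ∑ (suc i) φ    ≡⟨ upSum-∑ φ r (suc i) ⟩
  ∑ (suc i + r) φ                   ≡⟨ cong (λ k → ∑ k φ) (sym (+-suc i r)) ⟩
  ∑ (i + suc r) φ                   ∎
  where
  open ≡-Reasoning
  shuffle : ∀ a b c → a + b + c ≡ b + (a + c)
  shuffle = solve-∀

module Loop (d : ℕ) (z : ℕ) (S : ℕ → ℕ → ℕ) (φ : ℕ → ℕ) (body : Cmd) (P : State → Set) where

  record Before (r i : ℕ) (s : State) : Set where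
    constructor before
    field
      count : reg s d ≡ r
      acc   : reg s (1 + d) ≡ natrec i z S
      index : reg s (2 + d) ≡ i
      inv   : P s

  open Before public

  loop : (∀ {s} r i → Before (suc r) i s → Σ State λ s′ → Runs body d s (φ i) s′ × Before r (suc i) s′) →
         ∀ {s} r i → Before r i s →
         Σ State λ s′ → Runs (whilenz (var d) body) d s (2 + upSum (λ i → 2 + φ i) r i) s′ ×
                        reg s′ (1 + d) ≡ natrec (i + r) z S
  loop step {s} zero i b =
    s , runs (while-zero (count b)) ≤-refl unchanged-refl ,
    trans (acc b) (cong (λ k → natrec k z S) (sym (+-identityʳ i)))
  loop step {s} (suc r) i b with step r i b
  ... | s₁ , R₁ , b₁ with loop step r (suc i) b₁
  ... | s₂ , R₂ , eq =
    s₂ ,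
    runs (while-nonzero (λ c → contradiction (trans (sym (count b)) c) λ ()) (exec R₁) (exec R₂))
      (≤-trans (+-mono-≤ (s≤s (s≤s (time≤ R₁))) (time≤ R₂)) (≤-reflexive (arrange (φ i) _)))
      (unchanged-trans ≤-refl (frame R₁) (frame R₂)) ,
    trans eq (cong (λ k → natrec k z S) (sym (+-suc i r)))
    where
    arrange : ∀ a b → 2 + a + (2 + b) ≡ 2 + (2 + a + b)
    arrange = solve-∀

code-correct : ∀ {g m d s} (t : Tm g m) {G : Env g} {ρ : Fin m → ℕ} {e : Vec ℕ m} → Agrees g G d s →
    Holds ρ d e s →
               Result (code t ρ d) d s (steps G t e) (eval G t e)
codes-correct : ∀ {g m d s j} (ts : Vec (Tm g m) j) {G : Env g} {ρ : Fin m → ℕ} {e : Vec ℕ m} →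
                Agrees g G d s → Holds ρ d e s →
                Results (codes ts ρ d) d s (stepss G ts e) (evals G ts e)

codes-correct {d = d} [] A H = _ , runs skip ≤-refl unchanged-refl , λ ()
codes-correct {g = g} {d = d} (t ∷ ts) {e = e} A H with code-correct t A H
... | s₁ , R₁ , v₁
  with codes-correct ts (agrees-step g (n≤1+n d) A (frame R₁)) (holds-step e (n≤1+n d) H (frame R₁))
... | s₂ , R₂ , v₂ = s₂ , runs-seq R₁ (runs-weaken (n≤1+n d) R₂) , λ
  { zero    → trans (cong (reg s₂) (+-identityʳ d)) (trans (regs (frame R₂) d ≤-refl) v₁)
  ; (suc i) → trans (cong (reg s₂) (+-suc d (toℕ i))) (v₂ i) }

binary : ∀ {d s x y p q t u} (f : ℕ → ℕ → ℕ) (E : Exp → Exp → Exp) →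
         (∀ {a b s} → ⟦ E a b ⟧ s ≡ f (⟦ a ⟧ s) (⟦ b ⟧ s)) → (∀ {a b} → cost (E a b) ≡ 1 + cost a + cost b) →
         (R₁ : Result p d s t x) → Result q (1 + d) (proj₁ R₁) u y →
         Result (p ⨟ q ⨟ d ≔ E (var d) (var (1 + d))) d s (4 + (t + u)) (f x y)
binary {d = d} {t = t} {u = u} f E sem cst (s₁ , R₁ , v₁) (s₂ , R₂ , v₂) =
  _ , runs-≤ (≤-reflexive (trans (cong (λ c → t + (u + (1 + c))) cst) (arrange t u)))
        (runs-seq R₁ (runs-seq (runs-weaken (n≤1+n d) R₂) (runs-assign ≤-refl))) ,
  trans (upd-same (reg s₂) d _) (trans sem (cong₂ f (trans (regs (frame R₂) d ≤-refl) v₁) v₂))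
  where
  arrange : ∀ t u → t + (u + 4) ≡ 4 + (t + u)
  arrange = solve-∀

branch : ∀ {d s x y z p q r t u v} (R : Result p d s t x) →
         Result q d (proj₁ R) u y → Result r d (proj₁ R) v z →
         Result (p ⨟ ifnz (var d) r q) d s (2 + (t + (u + v))) (ifz x y z)
branch {x = zero} {t = t} {u} {v} (s₁ , R , vx) (s₂ , Q , vy) _ =
  s₂ , runs (seq (exec R) (if-zero vx (exec Q)))
         (≤-trans (+-mono-≤ (time≤ R) (s≤s (s≤s (time≤ Q))))
           (≤-trans (m≤m+n _ v) (≤-reflexive (arrange t u v))))
         (unchanged-trans ≤-refl (frame R) (frame Q)) , vy
  where
  arrange : ∀ t u v → t + (2 + u) + v ≡ 2 + (t + (u + v))
  arrange = solve-∀
branch {x = suc _} {t = t} {u} {v} (s₁ , R , vx) _ (s₂ , Q , vy) =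
  s₂ , runs (seq (exec R) (if-nonzero (λ c → contradiction (trans (sym vx) c) λ ()) (exec Q)))
         (≤-trans (+-mono-≤ (time≤ R) (s≤s (s≤s (time≤ Q))))
           (≤-trans (m≤m+n _ u) (≤-reflexive (arrange t u v))))
         (unchanged-trans ≤-refl (frame R) (frame Q)) , vy
  where
  arrange : ∀ t u v → t + (2 + v) + u ≡ 2 + (t + (u + v))
  arrange = solve-∀

code-correct {d = d} {s = s} (lit c) A H = _ , runs-assign ≤-refl , upd-same (reg s) d _
code-correct {d = d} {s = s} (var i) A H = _ , runs-assign ≤-refl , trans (upd-same (reg s) d _) (proj₂ (H i))
code-correct {g = true} {d = d} {s = s} (gbl p i) (_ , rs , _) H =
  _ , runs-assign ≤-refl , trans (upd-same (reg s) d _) (rs i)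
code-correct {g = true} {d = d} (inp p a) {G} {e = e} A H with code-correct a A H
... | s₁ , R , v with agrees-step true ≤-refl A (frame R)
... | _ , rs , ms = _ , runs-≤ (≤-reflexive (+-comm _ 7)) (runs-seq R (runs-assign ≤-refl)) ,
  trans (upd-same (reg s₁) d _)
    (trans (cong (mem s₁) (cong₂ clamp (rs (suc (suc (suc zero)))) v))
           (ms _ (clamp≤ (eval G a e) _)))
  where
  clamp≤ : ∀ a l → clamp l a ≤ l
  clamp≤ a l with ≤-total a l
  ... | inj₁ a≤l rewrite m≤n⇒m∸n≡0 a≤l = a≤l
  ... | inj₂ l≤a rewrite m∸[m∸n]≡n l≤a = ≤-refl
code-correct {g = g} {d = d} (a +′ b) {e = e} A H =
  let R₁ = code-correct a A H in
  binary _+_ _⊕_ refl refl R₁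
    (code-correct b (agrees-step g (n≤1+n d) A (frame (proj₁ (proj₂ R₁))))
                    (holds-step e (n≤1+n d) H (frame (proj₁ (proj₂ R₁)))))
code-correct {g = g} {d = d} (a ∸′ b) {e = e} A H =
  let R₁ = code-correct a A H in
  binary _∸_ _⊖_ refl refl R₁
    (code-correct b (agrees-step g (n≤1+n d) A (frame (proj₁ (proj₂ R₁))))
                    (holds-step e (n≤1+n d) H (frame (proj₁ (proj₂ R₁)))))
code-correct {g = g} {d = d} (ifz′ c a b) {e = e} A H =
  let R₁ = code-correct c A H
      A′ = agrees-step g ≤-refl A (frame (proj₁ (proj₂ R₁)))
      H′ = holds-step e ≤-refl H (frame (proj₁ (proj₂ R₁)))
  in branch R₁ (code-correct a A′ H′) (code-correct b A′ H′)
code-correct {g = g} {d = d} (app {j = j} f ts) {G} {e = e} A H with codes-correct ts A H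
... | s₁ , R₁ , v₁
  with code-correct f {ρ = λ i → d + toℕ i} {e = evals G ts e}
         (agrees-step g (m≤m+n d j) A (frame R₁)) (λ i → +-monoʳ-< d (Fin.toℕ<n i) , v₁ i)
... | s₂ , R₂ , v₂ =
  _ , runs-≤ (≤-reflexive (arrange (stepss G ts e) (steps G f (evals G ts e))))
        (runs-seq R₁ (runs-seq (runs-weaken (m≤m+n d j) R₂) (runs-assign ≤-refl))) ,
  trans (upd-same (reg s₂) d _) v₂
  where
  arrange : ∀ t u → t + (u + 2) ≡ 2 + (t + u)
  arrange = solve-∀
code-correct {g = g} {d = d} (rec q z s) {G} {ρ} {e} A H with code-correct q A H
... | s₁ , R₁ , v₁
  with code-correct z (agrees-step g (n≤1+n d) A (frame R₁)) (holds-step e (n≤1+n d) H (frame R₁))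
... | s₂ , R₂ , v₂ = _ ,
  runs-≤ (≤-reflexive (trans
      (cong (λ x → steps G q e + (steps G z e + (2 + (2 + x + 2))))
            (trans (sym (+-identityʳ _)) (upSum-∑ φ′ (eval G q e) 0)))
      (arrange (steps G q e) (steps G z e) (∑ (eval G q e) φ′))))
    (runs-seq R₁ (runs-seq (runs-weaken (n≤1+n d) R₂) (runs-seq (runs-assign (m≤n+m d 2))
      (runs-seq (proj₁ (proj₂ final)) (runs-assign ≤-refl))))) ,
  trans (upd-same (reg (proj₁ final)) d _) (proj₂ (proj₂ final))
  where
  S : ℕ → ℕ → ℕ
  S i a = eval G s (i ∷ a ∷ e)

  φ φ′ : ℕ → ℕ
  φ i = 10 + steps G s (i ∷ natrec i (eval G z e) S ∷ e)
  φ′ i = 2 + φ i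

  Inv : State → Set
  Inv σ = Agrees g G d σ × Holds ρ d e σ

  body : Cmd
  body = code s (extend ρ d) (3 + d) ⨟ (1 + d) ≔ var (3 + d) ⨟
         (2 + d) ≔ var (2 + d) ⊕ lit 1 ⨟ d ≔ var d ⊖ lit 1

  open Loop d (eval G z e) S φ body Inv

  start : Before (eval G q e) 0 (set s₂ (2 + d) 0)
  start = before
    (trans (upd-other (reg s₂) 0 (<⇒≢ (m<n⇒m<1+n (n<1+n d)))) (trans (regs (frame R₂) d ≤-refl) v₁))
    (trans (upd-other (reg s₂) 0 (<⇒≢ ≤-refl)) v₂)
    (upd-same (reg s₂) (2 + d) 0)
    (agrees-step g ≤-refl A fr , holds-step e ≤-refl H fr)
    where
    fr : Unchanged d _ (set s₂ (2 + d) 0)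
    fr = unchanged-trans ≤-refl (frame R₁)
           (unchanged-trans ≤-refl (frame (runs-weaken (n≤1+n d) R₂)) (set-unchanged (m≤n+m d 2)))

  step : ∀ {σ} r i → Before (suc r) i σ → Σ State λ σ′ → Runs body d σ (φ i) σ′ × Before r (suc i) σ′
  step {σ} r i b
    with code-correct s {ρ = extend ρ d} {e = i ∷ natrec i (eval G z e) S ∷ e}
           (agrees-step g (m≤n+m d 3) (proj₁ (inv b)) unchanged-refl)
           (λ { zero          → ≤-refl , index b
             ; (suc zero)    → m<n⇒m<1+n ≤-refl , acc b
             ; (suc (suc j)) → <-≤-trans (proj₁ (proj₂ (inv b) j)) (m≤n+m d 3) , proj₂ (proj₂ (inv b) j) })
  ... | σ₁ , R , v = σ₄ , run ,
    before
      (trans (upd-same (reg σ₃) d _) (cong pred (trans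
        (upd-other (reg σ₂) _ (<⇒≢ (m<n⇒m<1+n (n<1+n d))))
        (trans (upd-other (reg σ₁) _ (<⇒≢ (n<1+n d)))
            (trans (regs (frame R) d (m≤n+m (suc d) 2)) (count b))))))
      (trans (upd-other (reg σ₃) _ (≢-sym (<⇒≢ (n<1+n d))))
        (trans (upd-other (reg σ₂) _ (<⇒≢ (n<1+n (suc d)))) (trans (upd-same (reg σ₁) (1 + d) _) v)))
      (trans (upd-other (reg σ₃) _ (≢-sym (<⇒≢ (m<n⇒m<1+n (n<1+n d)))))
        (trans (upd-same (reg σ₂) (2 + d) _) (trans (+-comm (reg σ₂ (2 + d)) 1) (cong suc
          (trans (upd-other (reg σ₁) _ (≢-sym (<⇒≢ (n<1+n (suc d)))))
            (trans (regs (frame R) (2 + d) ≤-refl) (index b)))))))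
      (agrees-step g ≤-refl (proj₁ (inv b)) (frame run) , holds-step e ≤-refl (proj₂ (inv b)) (frame run))
    where
    σ₂ σ₃ σ₄ : State
    σ₂ = set σ₁ (1 + d) (reg σ₁ (3 + d))
    σ₃ = set σ₂ (2 + d) (reg σ₂ (2 + d) + 1)
    σ₄ = set σ₃ d (reg σ₃ d ∸ 1)
    run : Runs body d σ (φ i) σ₄
    run = runs-≤ (≤-reflexive (+-comm _ 10))
            (runs-seq (runs-weaken (m≤n+m d 3) R)
              (runs-seq (runs-assign (n≤1+n d)) (runs-seq (runs-assign (m≤n+m d 2)) (runs-assign ≤-refl))))

  final = loop step (eval G q e) 0 start

  arrange : ∀ a b c → a + (b + (2 + (2 + c + 2))) ≡ 6 + (a + (b + c))
  arrange = solve-∀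

natrec-cong : ∀ n {z z′ s s′} → z ≡ z′ → (∀ i a → s i a ≡ s′ i a) → natrec n z s ≡ natrec n z′ s′
natrec-cong zero    eq h = eq
natrec-cong (suc n) {s = s} eq h = trans (cong (s n) (natrec-cong n eq h)) (h n _)

module _ {g : Bool} (G : Env g) where

  evals-var : ∀ {m k} (f : Fin m → Fin k) e →
      evals G (tabulateᵥ (λ i → var (f i))) e ≡ tabulateᵥ (lookup e ∘ f)
  evals-var {zero}  f e = refl
  evals-var {suc m} f e = cong (lookup e (f zero) ∷_) (evals-var (f ∘ suc) e)

  stepss-var : ∀ {m k} (f : Fin m → Fin k) e → stepss G (tabulateᵥ (λ i → var (f i))) e ≡ m * 2 + 1
  stepss-var {zero}  f e = refl
  stepss-var {suc m} f e = cong (2 +_) (stepss-var (f ∘ suc) e)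

weaken₁ : ∀ {g m} → Vec (Tm g (1 + m)) m
weaken₁ = tabulateᵥ (λ i → var (suc i))

weaken₂ : ∀ {g m} → Vec (Tm g (2 + m)) m
weaken₂ = tabulateᵥ (λ i → var (suc (suc i)))

weaken₄ : ∀ {g m} → Vec (Tm g (4 + m)) m
weaken₄ = tabulateᵥ (λ i → var (suc (suc (suc (suc i)))))

evals-weaken₁ : ∀ {g m} (G : Env g) {a} (e : Vec ℕ m) → evals G weaken₁ (a ∷ e) ≡ e
evals-weaken₁ G e = trans (evals-var G suc (_ ∷ e)) (tabulate∘lookup e)

evals-weaken₂ : ∀ {g m} (G : Env g) {a b} (e : Vec ℕ m) → evals G weaken₂ (a ∷ b ∷ e) ≡ e
evals-weaken₂ G e = trans (evals-var G (λ i → suc (suc i)) (_ ∷ _ ∷ e)) (tabulate∘lookup e)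

evals-weaken₄ : ∀ {g m} (G : Env g) {a b c d} (e : Vec ℕ m) → evals G weaken₄ (a ∷ b ∷ c ∷ d ∷ e) ≡ e
evals-weaken₄ G e = trans (evals-var G (λ i → suc (suc (suc (suc i)))) (_ ∷ _ ∷ _ ∷ _ ∷ e))
    (tabulate∘lookup e)

-- This is what makes the time spent on computing the parameters a computable
-- function of k.

stepsTm  : ∀ {m} → Tm false m → Tm false m
stepssTm : ∀ {m j} → Vec (Tm false m) j → Tm false m
stepsTm (lit c)      = lit 2
stepsTm (var i)      = lit 2
stepsTm (a +′ b)     = lit 4 +′ (stepsTm a +′ stepsTm b)
stepsTm (a ∸′ b)     = lit 4 +′ (stepsTm a +′ stepsTm b)
stepsTm (ifz′ c a b) = lit 2 +′ (stepsTm c +′ (stepsTm a +′ stepsTm b))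
stepsTm (app f ts)   = lit 2 +′ (stepssTm ts +′ app (stepsTm f) ts)
stepsTm (rec q z s)  =
  lit 6 +′ (stepsTm q +′ (stepsTm z +′
    rec q (lit 0)
      ((lit 12 +′ app (stepsTm s)
         -- The accumulator of this recursion holds the time spent so far, so the value that the
         -- original recursion has reached after `i` rounds is recomputed by an inner recursion.
         (var zero ∷ rec (var zero) (app z weaken₂) (app s (var zero ∷ var (suc zero) ∷ weaken₄)) ∷ weaken₂))
       +′ var (suc zero))))
stepssTm []       = lit 1
stepssTm (t ∷ ts) = stepsTm t +′ stepssTm ts

eval-stepsTm  : ∀ {m} (t : Tm false m) e → eval tt (stepsTm t) e ≡ steps tt t e
eval-stepssTm : ∀ {m j} (ts : Vec (Tm false m) j) e → eval tt (stepssTm ts) e ≡ stepss tt ts e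
eval-stepsTm (lit c)      e = refl
eval-stepsTm (var i)      e = refl
eval-stepsTm (a +′ b)     e = cong (4 +_) (cong₂ _+_ (eval-stepsTm a e) (eval-stepsTm b e))
eval-stepsTm (a ∸′ b)     e = cong (4 +_) (cong₂ _+_ (eval-stepsTm a e) (eval-stepsTm b e))
eval-stepsTm (ifz′ c a b) e =
  cong (2 +_) (cong₂ _+_ (eval-stepsTm c e) (cong₂ _+_ (eval-stepsTm a e) (eval-stepsTm b e)))
eval-stepsTm (app f ts)   e =
  cong (2 +_) (cong₂ _+_ (eval-stepssTm ts e) (eval-stepsTm f (evals tt ts e)))
eval-stepsTm (rec q z s)  e =
  cong (6 +_) (cong₂ _+_ (eval-stepsTm q e) (cong₂ _+_ (eval-stepsTm z e)
    (trans (natrec-cong (eval tt q e) refl λ i a → cong (_+ a) (cong (12 +_)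
             (trans (eval-stepsTm s _)
                 (cong (steps tt s) (cong (i ∷_) (cong₂ _∷_ (inner i a) (evals-weaken₂ tt e)))))))
           (natrec-∑ (eval tt q e) _))))
  where
  inner : ∀ i a → natrec i (eval tt z (evals tt weaken₂ (i ∷ a ∷ e)))
                    (λ j b → eval tt s (j ∷ b ∷ evals tt weaken₄ (j ∷ b ∷ i ∷ a ∷ e)))
                  ≡ natrec i (eval tt z e) (λ j b → eval tt s (j ∷ b ∷ e))
  inner i a = natrec-cong i (cong (eval tt z) (evals-weaken₂ tt e))
    (λ j b → cong (λ e′ → eval tt s (j ∷ b ∷ e′)) (evals-weaken₄ tt e))
eval-stepssTm []       e = refl
eval-stepssTm (t ∷ ts) e = cong₂ _+_ (eval-stepsTm t e) (eval-stepssTm ts e)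

-- Functions given by terms, and polynomial bounds on their running time

record Pure {m} (f : Vec ℕ m → ℕ) : Set where
  constructor pure
  field
    tm : Tm false m
    ok : ∀ e → eval tt tm e ≡ f e

module _ {m : ℕ} where

  infixl 6 _+P_

  varP : (i : Fin m) → Pure (λ e → lookup e i)
  varP i = pure (var i) λ _ → refl

  litP : ∀ c → Pure {m} (λ _ → c)
  litP c = pure (lit c) λ _ → refl

  _+P_ : ∀ {f f′ : Vec ℕ m → ℕ} → Pure f → Pure f′ → Pure (λ e → f e + f′ e)
  pure t ok +P pure t′ ok′ = pure (t +′ t′) λ e → cong₂ _+_ (ok e) (ok′ e)

  appP : ∀ {f : Vec ℕ 1 → ℕ} {a : Vec ℕ m → ℕ} → Pure f → Pure a → Pure (λ e → f (a e ∷ []))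
  appP {f} (pure t ok) (pure a oka) = pure (app t (a ∷ [])) λ e →
      trans (ok _) (cong (λ x → f (x ∷ [])) (oka e))

  recP : ∀ {q z : Vec ℕ m → ℕ} {s : Vec ℕ (2 + m) → ℕ} → Pure q → Pure z → Pure s →
         Pure (λ e → natrec (q e) (z e) (λ i a → s (i ∷ a ∷ e)))
  recP {q = f} (pure q okq) (pure z okz) (pure s oks) = pure (rec q z s) λ e →
    trans (cong (λ k → natrec k _ _) (okq e)) (natrec-cong (f e) (okz e) (λ i a → oks (i ∷ a ∷ e)))

  stepsP : ∀ (t : Tm false m) → Pure (steps tt t)
  stepsP t = pure (stepsTm t) (eval-stepsTm t)

  congP : ∀ {f f′ : Vec ℕ m → ℕ} → (∀ e → f e ≡ f′ e) → Pure f → Pure f′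
  congP eq (pure t ok) = pure t λ e → trans (ok e) (eq e)

  weakenP : ∀ {f : Vec ℕ m → ℕ} → Pure f → Pure (λ e → f (tail (tail e)))
  weakenP (pure t ok) = pure
      (app t weaken₂) λ { (_ ∷ _ ∷ e) → trans (cong (eval tt t) (evals-weaken₂ tt e)) (ok e) }

infixl 7 _*P_

natrec-* : ∀ a b → natrec a 0 (λ _ x → b + x) ≡ a * b
natrec-* zero    b = refl
natrec-* (suc a) b = cong (b +_) (natrec-* a b)

natrec-^ : ∀ a b → natrec b 1 (λ _ x → a * x) ≡ a ^ b
natrec-^ a zero    = refl
natrec-^ a (suc b) = cong (a *_) (natrec-^ a b)

_*P_ : ∀ {m} {f f′ : Vec ℕ m → ℕ} → Pure f → Pure f′ → Pure (λ e → f e * f′ e)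
_*P_ {f = f} {f′} p p′ = congP (λ e → natrec-* (f e) (f′ e)) (recP p (litP 0) (weakenP p′ +P varP (suc zero)))

_^P_ : ∀ {m} {f f′ : Vec ℕ m → ℕ} → Pure f → Pure f′ → Pure (λ e → f e ^ f′ e)
_^P_ {f = f} {f′} p p′ = congP (λ e → natrec-^ (f e) (f′ e)) (recP p′ (litP 1) (weakenP p *P varP (suc zero)))

pure⇒computable : ∀ {f : Vec ℕ 1 → ℕ} → Pure f → Computable (λ x → f (x ∷ []))
pure⇒computable {f} (pure t ok) =
  code t (λ _ → 0) 1 ⨟ 0 ≔ var 1 , λ x →
  let (s , R , v) = code-correct {d = 1} {s = ⟨ zeros [ 0 ↦ x ] , zeros ⟩} t
                      {G = tt} {ρ = λ _ → 0} {e = x ∷ []} tt (λ { zero → s≤s z≤n , refl })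
  in _ , _ , seq (exec R) assign , trans v (ok (x ∷ []))

-- The bound is uniform in the argument vector `e`: since loops run only over globals, arguments
-- influence values but never the number of rounds. This makes the notion closed under composition
-- without any control of the size of intermediate values.
Fast : ∀ {m} → (Globals → Vec ℕ m → ℕ) → Set
Fast φ = ∃₂ λ K E → ∀ G e M → 1 ≤ M → (∀ i → glob G i ≤ M) → φ G e ≤ K * M ^ E

module _ {m : ℕ} where

  fast-const : ∀ c → Fast {m} (λ _ _ → c)
  fast-const c = c , 0 , λ G e M _ _ → ≤-reflexive (sym (*-identityʳ c))

  fast-+ : ∀ {φ ψ : Globals → Vec ℕ m → ℕ} → Fast φ → Fast ψ → Fast (λ G e → φ G e + ψ G e)
  fast-+ (K , E , h) (K′ , E′ , h′) = K + K′ , E + E′ , λ G e M 1≤M g≤M →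
    ≤-trans (+-mono-≤
      (≤-trans (h G e M 1≤M g≤M) (*-monoʳ-≤ K (^-monoʳ-≤ M {{>-nonZero 1≤M}} (m≤m+n E E′))))
      (≤-trans (h′ G e M 1≤M g≤M) (*-monoʳ-≤ K′ (^-monoʳ-≤ M {{>-nonZero 1≤M}} (m≤n+m E′ E)))))
      (≤-reflexive (sym (*-distribʳ-+ (M ^ (E + E′)) K K′)))

  fast-∘ : ∀ {k} {φ : Globals → Vec ℕ k → ℕ} {A : Globals → Vec ℕ m → Vec ℕ k} →
           Fast φ → Fast (λ G e → φ G (A G e))
  fast-∘ {A = A} (K , E , h) = K , E , λ G e → h G (A G e)

  fast-≡ : ∀ {φ ψ : Globals → Vec ℕ m → ℕ} → (∀ G e → φ G e ≡ ψ G e) → Fast φ → Fast ψ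
  fast-≡ eq (K , E , h) = K , E , λ G e M 1≤M g≤M → subst (_≤ K * M ^ E) (eq G e) (h G e M 1≤M g≤M)

  fast-∑ : ∀ {k} {φ : Globals → Vec ℕ k → ℕ} {A : Globals → ℕ → Vec ℕ m → Vec ℕ k} (g : Fin 4) →
           Fast φ → Fast (λ G e → ∑ (glob G g) (λ i → φ G (A G i e)))
  fast-∑ {A = A} g (K , E , h) = K , suc E , λ G e M 1≤M g≤M →
    ≤-trans (∑-bound (glob G g) λ i _ → h G (A G i e) M 1≤M g≤M)
      (≤-trans (*-monoˡ-≤ (K * M ^ E) (g≤M g)) (≤-reflexive (arrange M K (M ^ E))))
    where
    arrange : ∀ a b c → a * (b * c) ≡ b * (a * c)
    arrange = solve-∀

record Fn {m} (f : Globals → Vec ℕ m → ℕ) : Set where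
  constructor fn
  field
    tm   : Tm true m
    ok   : ∀ G e → eval G tm e ≡ f G e
    fast : Fast (λ G e → steps G tm e)

record Fns {m j} (f : Globals → Vec ℕ m → Vec ℕ j) : Set where
  constructor fns
  field
    tms  : Vec (Tm true m) j
    ok   : ∀ G e → evals G tms e ≡ f G e
    fast : Fast (λ G e → stepss G tms e)

module _ {m : ℕ} where

  infixl 6 _+F_ _∸F_
  infixr 5 _∷F_

  private
    variable
      f f′ f″ : Globals → Vec ℕ m → ℕ

  varF : (i : Fin m) → Fn (λ _ e → lookup e i)
  varF i = fn (var i) (λ _ _ → refl) (fast-const 2)

  litF : ∀ c → Fn {m} (λ _ _ → c)
  litF c = fn (lit c) (λ _ _ → refl) (fast-const 2)

  gblF : ∀ i → Fn {m} (λ G _ → glob G i)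
  gblF i = fn (gbl tt i) (λ _ _ → refl) (fast-const 2)

  inpF : Fn f → Fn (λ G e → cellOf {true} tt G (f G e))
  inpF (fn t ok fast) = fn (inp tt t) (λ G e → cong (cellOf {true} tt G) (ok G e))
      (fast-+ (fast-const 7) fast)

  _+F_ : Fn f → Fn f′ → Fn (λ G e → f G e + f′ G e)
  fn t ok fast +F fn t′ ok′ fast′ = fn (t +′ t′) (λ G e → cong₂ _+_ (ok G e) (ok′ G e))
    (fast-+ (fast-const 4) (fast-+ fast fast′))

  _∸F_ : Fn f → Fn f′ → Fn (λ G e → f G e ∸ f′ G e)
  fn t ok fast ∸F fn t′ ok′ fast′ = fn (t ∸′ t′) (λ G e → cong₂ _∸_ (ok G e) (ok′ G e))
    (fast-+ (fast-const 4) (fast-+ fast fast′))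

  ifzF : Fn f → Fn f′ → Fn f″ → Fn (λ G e → ifz (f G e) (f′ G e) (f″ G e))
  ifzF (fn c okc fc) (fn a oka fa) (fn b okb fb) = fn (ifz′ c a b)
    (λ G e → trans (cong (λ x → ifz x _ _) (okc G e)) (cong₂ (ifz _) (oka G e) (okb G e)))
    (fast-+ (fast-const 2) (fast-+ fc (fast-+ fa fb)))

  []F : Fns {m} (λ _ _ → [])
  []F = fns [] (λ _ _ → refl) (fast-const 1)

  _∷F_ : ∀ {j} {h : Globals → Vec ℕ m → Vec ℕ j} → Fn f → Fns h → Fns (λ G e → f G e ∷ h G e)
  fn t ok fast ∷F fns ts oks fasts = fns (t ∷ ts) (λ G e → cong₂ _∷_ (ok G e) (oks G e)) (fast-+ fast fasts)

  appF : ∀ {j} {φ : Globals → Vec ℕ j → ℕ} {h : Globals → Vec ℕ m → Vec ℕ j} →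
         Fn φ → Fns h → Fn (λ G e → φ G (h G e))
  appF {φ = φ} (fn t ok fast) (fns ts oks fasts) = fn (app t ts)
    (λ G e → trans (ok G _) (cong (φ G) (oks G e)))
    (fast-+ (fast-const 2) (fast-+ fasts (fast-∘ fast)))

  weakenF : Fn f → Fn (λ G e → f G (tail e))
  weakenF (fn t ok fast) = fn (app t weaken₁)
    (λ { G (_ ∷ e) → trans (cong (eval G t) (evals-weaken₁ G e)) (ok G e) })
    (fast-+ (fast-const 2) (fast-+
      (fast-≡ (λ G e → sym (stepss-var G suc e)) (fast-const (m * 2 + 1))) (fast-∘ fast)))

  recF : ∀ g {z : Globals → Vec ℕ m → ℕ} {s : Globals → Vec ℕ (2 + m) → ℕ} → Fn z → Fn s →
         Fn (λ G e → natrec (glob G g) (z G e) (λ i a → s G (i ∷ a ∷ e)))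
  recF g (fn z okz fz) (fn s oks fs) = fn (rec (gbl tt g) z s)
    (λ G e → natrec-cong (glob G g) (okz G e) (λ i a → oks G (i ∷ a ∷ e)))
    (fast-+ (fast-const 6) (fast-+ (fast-const 2) (fast-+ fz
      (fast-∑ {A = λ G i e → i ∷ natrec i (eval G z e) (λ i a → eval G s (i ∷ a ∷ e)) ∷ e} g
        (fast-+ (fast-const 12) fs)))))

  congF : (∀ G e → f G e ≡ f′ G e) → Fn f → Fn f′
  congF eq (fn t ok fast) = fn t (λ G e → trans (ok G e) (eq G e)) fast

-- In the step of a recursion the environment starts with index and accumulator; a summand takes the
-- index, the predicate of a search takes the accumulator.
underF : ∀ {m} (i : Fin (2 + m)) {f : Globals → Vec ℕ (1 + m) → ℕ} → Fn f →
         Fn {2 + m} (λ G e → f G (lookup e i ∷ tail (tail e)))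
underF {m} i f = appF f (varF i ∷F fns weaken₂ (λ { G (_ ∷ _ ∷ e) → evals-weaken₂ G e })
  (fast-≡ (λ G e → sym (stepss-var G (λ i → suc (suc i)) e)) (fast-const (m * 2 + 1))))

module _ {m : ℕ} where

  sumF : ∀ g {f : Globals → Vec ℕ (1 + m) → ℕ} → Fn f → Fn (λ G e → ∑ (glob G g) (λ i → f G (i ∷ e)))
  sumF g f = congF (λ G e → natrec-∑ (glob G g) _) (recF g (litF 0) (underF zero f +F varF (suc zero)))

  μF : ∀ g {f : Globals → Vec ℕ (1 + m) → ℕ} → Fn f → Fn (λ G e → μ (glob G g) (λ i → f G (i ∷ e)))
  μF g f = congF (λ G e → natrec-μ (glob G g) _)
    (recF g (litF 0) (ifzF (underF (suc zero) f) (varF (suc zero)) (litF 1 +F varF (suc zero))))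

  psumF : ∀ g {x : Globals → Vec ℕ m → ℕ} {f : Globals → Vec ℕ (1 + m) → ℕ} → Fn x → Fn f →
          Fn (λ G e → psum (glob G g) (x G e) (λ i → f G (i ∷ e)))
  psumF g x f = sumF g (ifzF (litF 1 +F varF zero ∸F weakenF x) f (litF 0))

  gapF : ∀ {f f′ : Globals → Vec ℕ m → ℕ} → Fn f → Fn f′ → Fn (λ G e → gap (f G e) (f′ G e))
  gapF f f′ = (f ∸F f′) +F (f′ ∸F f)

  indF : ∀ {f : Globals → Vec ℕ m → ℕ} → Fn f → Fn (λ G e → ind (f G e))
  indF f = litF 1 ∸F f

-- Integer vectors and quadratic forms

infixl 6 _+ᵛ_

∑ᶻ : ℕ → (ℕ → ℤ) → ℤ
∑ᶻ zero    f = 0ℤ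
∑ᶻ (suc n) f = f n +ᶻ ∑ᶻ n f

∑ᶻ-cong : ∀ n {f g : ℕ → ℤ} → (∀ i → i < n → f i ≡ g i) → ∑ᶻ n f ≡ ∑ᶻ n g
∑ᶻ-cong zero    h = refl
∑ᶻ-cong (suc n) h = cong₂ _+ᶻ_ (h n ≤-refl) (∑ᶻ-cong n (λ i i<n → h i (m<n⇒m<1+n i<n)))

∑ᶻ-zero : ∀ n {f : ℕ → ℤ} → (∀ i → i < n → f i ≡ 0ℤ) → ∑ᶻ n f ≡ 0ℤ
∑ᶻ-zero zero    h = refl
∑ᶻ-zero (suc n) h rewrite h n ≤-refl = trans (ℤₚ.+-identityˡ _) (∑ᶻ-zero n (λ i i<n → h i (m<n⇒m<1+n i<n)))

∑ᶻ-linear : ∀ n f g c → ∑ᶻ n (λ i → f i +ᶻ c *ᶻ g i) ≡ ∑ᶻ n f +ᶻ c *ᶻ ∑ᶻ n g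
∑ᶻ-linear zero    f g c = sym (trans (ℤₚ.+-identityˡ _) (ℤₚ.*-zeroʳ c))
∑ᶻ-linear (suc n) f g c rewrite ∑ᶻ-linear n f g c = arrange (f n) (g n) c (∑ᶻ n f) (∑ᶻ n g)
  where
  arrange : ∀ a b c d e → a +ᶻ c *ᶻ b +ᶻ (d +ᶻ c *ᶻ e) ≡ a +ᶻ d +ᶻ c *ᶻ (b +ᶻ e)
  arrange = solveᶻ-∀

∑ᶻ-+ : ∀ n f g → ∑ᶻ n (λ i → f i +ᶻ g i) ≡ ∑ᶻ n f +ᶻ ∑ᶻ n g
∑ᶻ-+ zero    f g = refl
∑ᶻ-+ (suc n) f g rewrite ∑ᶻ-+ n f g = arrange (f n) (g n) (∑ᶻ n f) (∑ᶻ n g)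
  where
  arrange : ∀ a b c d → a +ᶻ b +ᶻ (c +ᶻ d) ≡ a +ᶻ c +ᶻ (b +ᶻ d)
  arrange = solveᶻ-∀

∑ᶻ-*ˡ : ∀ n c f → ∑ᶻ n (λ i → c *ᶻ f i) ≡ c *ᶻ ∑ᶻ n f
∑ᶻ-*ˡ zero    c f = sym (ℤₚ.*-zeroʳ c)
∑ᶻ-*ˡ (suc n) c f rewrite ∑ᶻ-*ˡ n c f = sym (ℤₚ.*-distribˡ-+ c (f n) (∑ᶻ n f))

∑ᶻ-swap : ∀ m n (f : ℕ → ℕ → ℤ) → ∑ᶻ m (λ i → ∑ᶻ n (f i)) ≡ ∑ᶻ n (λ j → ∑ᶻ m (λ i → f i j))
∑ᶻ-swap zero    n f = sym (∑ᶻ-zero n (λ _ _ → refl))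
∑ᶻ-swap (suc m) n f = trans (cong (∑ᶻ n (f m) +ᶻ_) (∑ᶻ-swap m n f))
                            (sym (∑ᶻ-+ n (f m) (λ j → ∑ᶻ m (λ i → f i j))))

∑ᶻ-single : ∀ n f k → k < n → (∀ i → i < n → i ≢ k → f i ≡ 0ℤ) → ∑ᶻ n f ≡ f k
∑ᶻ-single (suc n) f k k<1+n h with k ≟ n
... | yes refl = trans (cong (f n +ᶻ_) (∑ᶻ-zero n λ i i<n → h i (m<n⇒m<1+n i<n) (<⇒≢ i<n)))
    (ℤₚ.+-identityʳ (f n))
... | no k≢n rewrite h n ≤-refl (≢-sym k≢n) =
  trans (ℤₚ.+-identityˡ _) (∑ᶻ-single n f k (≤∧≢⇒< (≤-pred k<1+n) k≢n) λ i i<n → h i (m<n⇒m<1+n i<n))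

∑ᶻ-nonneg : ∀ n {f : ℕ → ℤ} → (∀ i → i < n → 0ℤ ≤ᶻ f i) → 0ℤ ≤ᶻ ∑ᶻ n f
∑ᶻ-nonneg zero    h = +≤+ z≤n
∑ᶻ-nonneg (suc n) h = ℤₚ.+-mono-≤ (h n ≤-refl) (∑ᶻ-nonneg n λ i i<n → h i (m<n⇒m<1+n i<n))

∑ᶻ-abs : ∀ n f {c} → (∀ i → i < n → ∣ f i ∣ ≤ c) → ∣ ∑ᶻ n f ∣ ≤ n * c
∑ᶻ-abs zero    f h = z≤n
∑ᶻ-abs (suc n) f h = ≤-trans (ℤₚ.∣i+j∣≤∣i∣+∣j∣ (f n) (∑ᶻ n f))
  (+-mono-≤ (h n ≤-refl) (∑ᶻ-abs n f λ i i<n → h i (m<n⇒m<1+n i<n)))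

abs-*-≤ : ∀ {i j a b} → ∣ i ∣ ≤ a → ∣ j ∣ ≤ b → ∣ i *ᶻ j ∣ ≤ a * b
abs-*-≤ {i} {j} p q = ≤-trans (≤-reflexive (ℤₚ.abs-* i j)) (*-mono-≤ p q)

abs-+-≤ : ∀ {i j a b} → ∣ i ∣ ≤ a → ∣ j ∣ ≤ b → ∣ i +ᶻ j ∣ ≤ a + b
abs-+-≤ {i} {j} p q = ≤-trans (ℤₚ.∣i+j∣≤∣i∣+∣j∣ i j) (+-mono-≤ p q)

abs-neg-≤ : ∀ {i a} → ∣ i ∣ ≤ a → ∣ - i ∣ ≤ a
abs-neg-≤ {i} p = ≤-trans (≤-reflexive (ℤₚ.∣-i∣≡∣i∣ i)) p

δ : ℕ → ℕ → ℤ
δ i j = ⁺ ind (gap i j)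

δ-refl : ∀ i → δ i i ≡ 1ℤ
δ-refl i = cong ⁺_ (ind-gap-≡ {i} refl)

δ-≢ : ∀ {i j} → i ≢ j → δ i j ≡ 0ℤ
δ-≢ i≢j = cong ⁺_ (ind-gap-≢ i≢j)

∣δ∣≤1 : ∀ i j → ∣ δ i j ∣ ≤ 1
∣δ∣≤1 i j = ind≤1 (gap i j)

_+ᵛ_ : (ℕ → ℤ) → (ℕ → ℤ) → ℕ → ℤ
(f +ᵛ g) i = f i +ᶻ g i

scale : ℤ → (ℕ → ℤ) → ℕ → ℤ
scale c f i = c *ᶻ f i

dot : ℕ → (ℕ → ℤ) → (ℕ → ℤ) → ℤ
dot n r z = ∑ᶻ n λ j → r j *ᶻ z j

module _ (n : ℕ) where

  dot-+ʳ : ∀ r z y c → dot n r (z +ᵛ scale c y) ≡ dot n r z +ᶻ c *ᶻ dot n r y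
  dot-+ʳ r z y c = trans (∑ᶻ-cong n λ i _ → arrange (r i) (z i) c (y i)) (∑ᶻ-linear n _ _ c)
    where
    arrange : ∀ r z c y → r *ᶻ (z +ᶻ c *ᶻ y) ≡ r *ᶻ z +ᶻ c *ᶻ (r *ᶻ y)
    arrange = solveᶻ-∀

  dot-+ˡ : ∀ r r′ c z → dot n (r +ᵛ scale c r′) z ≡ dot n r z +ᶻ c *ᶻ dot n r′ z
  dot-+ˡ r r′ c z = trans (∑ᶻ-cong n λ i _ → arrange (r i) (z i) c (r′ i)) (∑ᶻ-linear n _ _ c)
    where
    arrange : ∀ r z c y → (r +ᶻ c *ᶻ y) *ᶻ z ≡ r *ᶻ z +ᶻ c *ᶻ (y *ᶻ z)
    arrange = solveᶻ-∀

  dot-δ : ∀ i z → i < n → dot n (δ i) z ≡ z i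
  dot-δ i z i<n = trans
    (∑ᶻ-single n _ i i<n λ j _ j≢i → trans (cong (_*ᶻ z j) (δ-≢ (≢-sym j≢i))) (ℤₚ.*-zeroˡ (z j)))
    (trans (cong (_*ᶻ z i) (δ-refl i)) (ℤₚ.*-identityˡ (z i)))

  dot-neg : ∀ r z → dot n (λ j → - r j) z ≡ - dot n r z
  dot-neg r z = trans (∑ᶻ-cong n λ i _ → arrange (r i) (z i)) (trans (∑ᶻ-*ˡ n -1ℤ _) (ℤₚ.-1*i≡-i _))
    where
    arrange : ∀ r z → (- r) *ᶻ z ≡ -1ℤ *ᶻ (r *ᶻ z)
    arrange = solveᶻ-∀

  dot-dot : ∀ r (M : ℕ → ℕ → ℤ) z → dot n (λ j → dot n r (λ i → M i j)) z ≡ dot n r (λ i → dot n (M i) z)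
  dot-dot r M z = begin
    (∑ᶻ n λ j → dot n r (λ i → M i j) *ᶻ z j)
      ≡⟨ ∑ᶻ-cong n (λ j _ → trans (ℤₚ.*-comm _ (z j)) (sym (∑ᶻ-*ˡ n (z j) _))) ⟩
    (∑ᶻ n λ j → ∑ᶻ n λ i → z j *ᶻ (r i *ᶻ M i j))  ≡⟨ ∑ᶻ-swap n n _ ⟩
    (∑ᶻ n λ i → ∑ᶻ n λ j → z j *ᶻ (r i *ᶻ M i j))
      ≡⟨ ∑ᶻ-cong n (λ i _ → trans (∑ᶻ-cong n λ j _ → arrange (z j) (r i) (M i j)) (∑ᶻ-*ˡ n (r i) _)) ⟩
    (∑ᶻ n λ i → r i *ᶻ dot n (M i) z)              ∎
    where
    open ≡-Reasoning
    arrange : ∀ z r m → z *ᶻ (r *ᶻ m) ≡ r *ᶻ (m *ᶻ z)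
    arrange = solveᶻ-∀

  dot-abs : ∀ r z {a b} → (∀ i → ∣ r i ∣ ≤ a) → (∀ i → ∣ z i ∣ ≤ b) → ∣ dot n r z ∣ ≤ n * (a * b)
  dot-abs r z {a} {b} p q = ∑ᶻ-abs n _ λ i _ → abs-*-≤ {r i} {z i} (p i) (q i)

module Form (n : ℕ) (Q : ℕ → ℕ → ℕ) where

  row : (ℕ → ℤ) → ℕ → ℤ
  row z i = dot n (λ j → ⁺ Q i j) z

  col : (ℕ → ℤ) → ℕ → ℤ
  col z j = dot n (λ i → ⁺ Q i j) z

  -- `Q` need not be symmetric, so the gradient at `y` is the product of `y` with the sum of `Q` and
  -- its transpose. The factor `1ℤ` gives it the shape of the linearity lemmas.
  grad : (ℕ → ℤ) → ℕ → ℤ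
  grad y = row y +ᵛ scale 1ℤ (col y)

  quad : (ℕ → ℤ) → ℤ
  quad z = dot n z (row z)

  dot-comm : ∀ r z → dot n r z ≡ dot n z r
  dot-comm r z = ∑ᶻ-cong n λ i _ → ℤₚ.*-comm (r i) (z i)

  row-+ : ∀ z y c i → row (z +ᵛ scale c y) i ≡ (row z +ᵛ scale c (row y)) i
  row-+ z y c i = dot-+ʳ n (λ j → ⁺ Q i j) z y c

  col-row : ∀ y z → dot n (col y) z ≡ dot n y (row z)
  col-row y z = trans (∑ᶻ-cong n λ j _ → cong (_*ᶻ z j) (dot-comm _ y)) (dot-dot n y (λ i j → ⁺ Q i j) z)

  grad-self : ∀ y → dot n (grad y) y ≡ quad y +ᶻ quad y
  grad-self y = trans (dot-+ˡ n (row y) (col y) 1ℤ y)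
    (cong₂ _+ᶻ_ (dot-comm (row y) y) (trans (ℤₚ.*-identityˡ _) (col-row y y)))

  quad-+ : ∀ z y c → quad (z +ᵛ scale c y) ≡ quad z +ᶻ c *ᶻ dot n (grad y) z +ᶻ c *ᶻ c *ᶻ quad y
  quad-+ z y c = begin
    dot n (z +ᵛ scale c y) (row (z +ᵛ scale c y))
      ≡⟨ ∑ᶻ-cong n (λ i _ → cong ((z +ᵛ scale c y) i *ᶻ_) (row-+ z y c i)) ⟩
    dot n (z +ᵛ scale c y) (row z +ᵛ scale c (row y))
      ≡⟨ dot-+ˡ n z y c _ ⟩
    dot n z (row z +ᵛ scale c (row y)) +ᶻ c *ᶻ dot n y (row z +ᵛ scale c (row y))
      ≡⟨ cong₂ (λ a b → a +ᶻ c *ᶻ b) (dot-+ʳ n z (row z) (row y) c) (dot-+ʳ n y (row z) (row y) c) ⟩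
    quad z +ᶻ c *ᶻ dot n z (row y) +ᶻ c *ᶻ (dot n y (row z) +ᶻ c *ᶻ quad y)
      ≡⟨ arrange (quad z) c (dot n z (row y)) (dot n y (row z)) (quad y) ⟩
    quad z +ᶻ c *ᶻ (dot n z (row y) +ᶻ 1ℤ *ᶻ dot n y (row z)) +ᶻ c *ᶻ c *ᶻ quad y
      ≡⟨ cong (λ x → quad z +ᶻ c *ᶻ x +ᶻ c *ᶻ c *ᶻ quad y) (sym (trans (dot-+ˡ n (row y) (col y) 1ℤ z)
           (cong₂ (λ a b → a +ᶻ 1ℤ *ᶻ b) (dot-comm (row y) z) (col-row y z)))) ⟩
    quad z +ᶻ c *ᶻ dot n (grad y) z +ᶻ c *ᶻ c *ᶻ quad y ∎
    where
    open ≡-Reasoning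
    arrange : ∀ q c a b s → q +ᶻ c *ᶻ a +ᶻ c *ᶻ (b +ᶻ c *ᶻ s) ≡ q +ᶻ c *ᶻ (a +ᶻ 1ℤ *ᶻ b) +ᶻ c *ᶻ c *ᶻ s
    arrange = solveᶻ-∀

  -- Bounds the form from below on feasible points, so that a strictly decreasing integer value can
  -- only decrease finitely often; the descent terminates by this.
  quad-nonneg : ∀ z → (∀ i → i < n → 0ℤ ≤ᶻ z i) → 0ℤ ≤ᶻ quad z
  quad-nonneg z h = ∑ᶻ-nonneg n λ i i<n → *-nonneg (z i) _ (h i i<n)
    (∑ᶻ-nonneg n λ j j<n → *-nonneg (⁺ Q i j) (z j) (+≤+ z≤n) (h j j<n))
    where
    *-nonneg : ∀ i j → 0ℤ ≤ᶻ i → 0ℤ ≤ᶻ j → 0ℤ ≤ᶻ i *ᶻ j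
    *-nonneg (⁺ i) (⁺ j) _ _ = subst (0ℤ ≤ᶻ_) (ℤₚ.pos-* i j) (+≤+ z≤n)

-- Integer quadratic programs

abs-mono-≤ : ∀ {i j} → 0ℤ ≤ᶻ i → i ≤ᶻ j → ∣ i ∣ ≤ ∣ j ∣
abs-mono-≤ {⁺ i} _ (+≤+ le) = le

abs-mono-< : ∀ {i j} → 0ℤ ≤ᶻ i → i <ᶻ j → ∣ i ∣ < ∣ j ∣
abs-mono-< {⁺ i} _ (+<+ lt) = lt

-- The coordinates below `d` are the unknowns. Those from `d` on stay fixed and serve as parameters;
-- one of them is the constant 1, at index `one`, which makes affine equations homogeneous.
record Program : Set where
  field
    n d c  : ℕ
    Q      : ℕ → ℕ → ℕ
    A      : ℕ → ℕ → ℤ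
    one    : ℕ
    d≤one  : d ≤ one
    one<n  : one < n

-- Covers the three origins of a new equation: `β` for a constraint, `1 + B` for a coordinate stuck
-- near the boundary, and the rest for stationarity, where the two products in parentheses bound the
-- gradient and the last one bounds its constant term.
rowBound : ℕ → ℕ → ℕ → ℕ
rowBound N β B = β + (1 + B) + (N * (β * B) + N * (β * B)) + N * (B * (N * (β * B)))

-- The new equation, rewritten in the remaining variables, has coefficients at most
-- `N * (rowBound N β B * B)`; the two summands bound the two products in an entry of the matrix
-- after elimination.
nextBound : ℕ → ℕ → ℕ → ℕ
nextBound N β B = N * (rowBound N β B * B) * B + B * (N * (rowBound N β B * B))

bounds : ℕ → ℕ → ℕ → ℕ
bounds N β zero    = 1
bounds N β (suc f) = nextBound N β (bounds N β f)

module Solve (P : Program) (N β : ℕ) (n≤N : Program.n P ≤ N)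
             (Q≤β : ∀ i j → Program.Q P i j ≤ β) (A≤β : ∀ r j → ∣ Program.A P r j ∣ ≤ β) where

  open Program P
  open Form n Q

  record Feasible (z : ℕ → ℤ) : Set where
    constructor feasible
    field
      nonneg : ∀ i → i < n → 0ℤ ≤ᶻ z i
      rows   : ∀ r → r < c → dot n (A r) z ≡ 0ℤ
      unit   : z one ≡ 1ℤ

  open Feasible public

  -- The variables below f are expressed through those from f on:
  -- D zᵢ = Σⱼ Mᵢⱼ zⱼ, where the columns of M below f vanish.
  record Solved (f B : ℕ) : Set where
    field
      D     : ℤ
      M     : ℕ → ℕ → ℤ
      D>0   : 0ℤ <ᶻ D
      cols  : ∀ i j → j < f → M i j ≡ 0ℤ
      diag  : ∀ i → f ≤ i → M i i ≡ D
      off   : ∀ i j → f ≤ i → i ≢ j → M i j ≡ 0ℤ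
      D≤B   : ∣ D ∣ ≤ B
      M≤B   : ∀ i j → ∣ M i j ∣ ≤ B

  open Solved public

  Satisfies : ∀ {f B} → Solved f B → (ℕ → ℤ) → Set
  Satisfies S z = ∀ i → i < n → D S *ᶻ z i ≡ dot n (M S i) z

  module Step {f B : ℕ} (f<d : f < d) (S : Solved f B) where

    f<n : f < n
    f<n = <-trans f<d (≤-<-trans d≤one one<n)

    y : ℕ → ℤ
    y i = M S i f

    y-fixed : ∀ i → d ≤ i → y i ≡ 0ℤ
    y-fixed i d≤i = off S i f (<⇒≤ (<-≤-trans f<d d≤i)) (≢-sym (<⇒≢ (<-≤-trans f<d d≤i)))

    -- Only the coordinate `f` contributes to the product of `M` with `y`: earlier columns of `M`
    -- vanish, `y` vanishes at later coordinates below which `M` is diagonal, and the entry of `y`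
    -- at `f` is `D`.
    y-kernel : ∀ i → D S *ᶻ y i ≡ dot n (M S i) y
    y-kernel i = sym (trans (∑ᶻ-single n _ f f<n others)
        (trans (cong (y i *ᶻ_) (diag S f ≤-refl)) (ℤₚ.*-comm (y i) (D S))))
      where
      others : ∀ j → j < n → j ≢ f → M S i j *ᶻ y j ≡ 0ℤ
      others j _ j≢f with <-cmp j f
      ... | tri< j<f _ _ = trans (cong (_*ᶻ y j) (cols S i j j<f)) (ℤₚ.*-zeroˡ (y j))
      ... | tri≈ _ eq _ = contradiction eq j≢f
      ... | tri> _ _ f<j = trans (cong (M S i j *ᶻ_) (off S j f (<⇒≤ f<j) j≢f)) (ℤₚ.*-zeroʳ (M S i j))

    -- Elimination without fractions. Multiplying the equation `R` by `D` and substituting turns it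
    -- into the equation `r`, whose coefficient at `f` is the value of `R` on `y`. Row `i` is scaled
    -- by `r f`, and `y i` times the equation `r` is subtracted, which clears column `f`.
    module Eliminate (R : ℕ → ℤ) (ρ>0 : 0ℤ <ᶻ dot n R y) (R≤ : ∀ j → ∣ R j ∣ ≤ rowBound N β B) where

      r : ℕ → ℤ
      r j = dot n R (λ i → M S i j)

      r≤ : ∀ j → ∣ r j ∣ ≤ N * (rowBound N β B * B)
      r≤ j = ≤-trans (dot-abs n R (λ i → M S i j) R≤ (λ i → M≤B S i j)) (*-monoˡ-≤ _ n≤N)

      solved : Solved (suc f) (nextBound N β B)
      solved = record
        { D    = r f *ᶻ D S
        ; M    = λ i j → r f *ᶻ M S i j +ᶻ - (y i *ᶻ r j)
        ; D>0  = pos-product ρ>0 (D>0 S)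
        ; cols = cols′
        ; diag = λ i f<i → trans (cong₂ (λ a b → r f *ᶻ a +ᶻ - (b *ᶻ r i)) (diag S i (<⇒≤ f<i)) (y≡0 i f<i))
                             (drop (r f *ᶻ D S) (r i))
        ; off  = λ i j f<i i≢j → trans
            (cong₂ (λ a b → r f *ᶻ a +ᶻ - (b *ᶻ r j)) (off S i j (<⇒≤ f<i) i≢j) (y≡0 i f<i))
                             (trans (drop (r f *ᶻ 0ℤ) (r j)) (ℤₚ.*-zeroʳ (r f)))
        ; D≤B  = ≤-trans (abs-*-≤ {r f} {D S} (r≤ f) (D≤B S)) (m≤m+n _ _)
        ; M≤B  = λ i j → abs-+-≤ {r f *ᶻ M S i j} {_}
                   (abs-*-≤ {r f} {M S i j} (r≤ f) (M≤B S i j))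
                   (abs-neg-≤ {y i *ᶻ r j} (abs-*-≤ {y i} {r j} (M≤B S i f) (r≤ j)))
        }
        where
        pos-product : ∀ {i j} → 0ℤ <ᶻ i → 0ℤ <ᶻ j → 0ℤ <ᶻ i *ᶻ j
        pos-product {⁺ suc i} {⁺ suc j} _ _ = +<+ (s≤s z≤n)
        pos-product {⁺ zero} (+<+ ())
        pos-product {⁺ suc i} {⁺ zero} _ (+<+ ())

        y≡0 : ∀ i → f < i → y i ≡ 0ℤ
        y≡0 i f<i = off S i f (<⇒≤ f<i) (≢-sym (<⇒≢ f<i))

        drop : ∀ a b → a +ᶻ - (0ℤ *ᶻ b) ≡ a
        drop = solveᶻ-∀

        cancel : ∀ a b → a *ᶻ b +ᶻ - (b *ᶻ a) ≡ 0ℤ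
        cancel = solveᶻ-∀

        cols′ : ∀ i j → j < suc f → r f *ᶻ M S i j +ᶻ - (y i *ᶻ r j) ≡ 0ℤ
        cols′ i j j<1+f with m≤n⇒m<n∨m≡n (≤-pred j<1+f)
        ... | inj₂ refl = cancel (r f) (y i)
        ... | inj₁ j<f rewrite cols S i j j<f
                             | ∑ᶻ-zero n {λ i → R i *ᶻ M S i j}
                                 (λ i _ → trans (cong (R i *ᶻ_) (cols S i j j<f)) (ℤₚ.*-zeroʳ (R i)))
          = vanish (r f) (y i)
          where
          vanish : ∀ a b → a *ᶻ 0ℤ +ᶻ - (b *ᶻ 0ℤ) ≡ 0ℤ
          vanish = solveᶻ-∀

      satisfies : ∀ z → Satisfies S z → dot n R z ≡ 0ℤ → Satisfies solved z
      satisfies z sat R·z≡0 i i<n = sym (begin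
        (∑ᶻ n λ j → (r f *ᶻ M S i j +ᶻ - (y i *ᶻ r j)) *ᶻ z j)
          ≡⟨ ∑ᶻ-cong n (λ j _ → arrange (r f) (M S i j) (y i) (r j) (z j)) ⟩
        (∑ᶻ n λ j → r f *ᶻ (M S i j *ᶻ z j) +ᶻ - y i *ᶻ (r j *ᶻ z j))
          ≡⟨ ∑ᶻ-linear n _ _ (- y i) ⟩
        (∑ᶻ n λ j → r f *ᶻ (M S i j *ᶻ z j)) +ᶻ - y i *ᶻ dot n r z
          ≡⟨ cong₂ (λ a b → a +ᶻ - y i *ᶻ b) (∑ᶻ-*ˡ n (r f) _) r·z≡0 ⟩
        r f *ᶻ dot n (M S i) z +ᶻ - y i *ᶻ 0ℤ
          ≡⟨ cong (λ a → r f *ᶻ a +ᶻ - y i *ᶻ 0ℤ) (sym (sat i i<n)) ⟩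
        r f *ᶻ (D S *ᶻ z i) +ᶻ - y i *ᶻ 0ℤ
          ≡⟨ finish (r f) (D S) (z i) (y i) ⟩
        r f *ᶻ D S *ᶻ z i ∎)
        where
        open ≡-Reasoning
        arrange : ∀ a m b c x → (a *ᶻ m +ᶻ - (b *ᶻ c)) *ᶻ x ≡ a *ᶻ (m *ᶻ x) +ᶻ - b *ᶻ (c *ᶻ x)
        arrange = solveᶻ-∀
        finish : ∀ a b x c → a *ᶻ (b *ᶻ x) +ᶻ - c *ᶻ 0ℤ ≡ a *ᶻ b *ᶻ x
        finish = solveᶻ-∀
        commute : ∀ a b c → a *ᶻ (b *ᶻ c) ≡ b *ᶻ (a *ᶻ c)
        commute = solveᶻ-∀
        r·z≡0 : dot n r z ≡ 0ℤ
        r·z≡0 = trans (dot-dot n R (M S) z) (trans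
          (∑ᶻ-cong n λ i i<n → trans (cong (R i *ᶻ_) (sym (sat i i<n))) (commute (R i) (D S) (z i)))
          (trans (∑ᶻ-*ˡ n (D S) _) (trans (cong (D S *ᶻ_) R·z≡0) (ℤₚ.*-zeroʳ (D S)))))

    record NewRow (z : ℕ → ℤ) : Set where
      field
        R    : ℕ → ℤ
        R·z  : dot n R z ≡ 0ℤ
        R·y  : dot n R y ≢ 0ℤ
        R≤   : ∀ j → ∣ R j ∣ ≤ rowBound N β B

    open NewRow

    eliminate : ∀ z → Satisfies S z → NewRow z → Σ (Solved (suc f) (nextBound N β B)) λ S′ → Satisfies S′ z
    eliminate z sat w with ℤₚ.<-cmp 0ℤ (dot n (R w) y)
    ... | tri< pos _ _ = solved , satisfies z sat (R·z w)
      where open Eliminate (R w) pos (R≤ w)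
    ... | tri≈ _ eq _ = contradiction (sym eq) (R·y w)
    -- The equation is negated so that the common denominator stays positive.
    ... | tri> _ _ neg = solved , satisfies z sat (trans (dot-neg n (R w) z) (cong -_ (R·z w)))
      where
      open Eliminate (λ j → - R w j) (subst (0ℤ <ᶻ_) (sym (dot-neg n (R w) y)) (ℤₚ.neg-mono-< neg))
        (λ j → abs-neg-≤ {R w j} (R≤ w j))

    record Better (z : ℕ → ℤ) : Set where
      constructor better
      field
        z′        : ℕ → ℤ
        isFeas    : Feasible z′
        isSat     : Satisfies S z′
        fixed     : ∀ i → d ≤ i → z′ i ≡ z i
        quad≤     : quad z′ ≤ᶻ quad z
        newRow    : NewRow z′

    move-sat : ∀ z ε → Satisfies S z → Satisfies S (z +ᵛ scale ε y)
    move-sat z ε sat i i<n = begin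
      D S *ᶻ (z i +ᶻ ε *ᶻ y i)                     ≡⟨ arrange (D S) (z i) ε (y i) ⟩
      D S *ᶻ z i +ᶻ ε *ᶻ (D S *ᶻ y i)              ≡⟨ cong₂ (λ a b → a +ᶻ ε *ᶻ b) (sat i i<n) (y-kernel i) ⟩
      dot n (M S i) z +ᶻ ε *ᶻ dot n (M S i) y      ≡⟨ dot-+ʳ n (M S i) z y ε ⟨
      dot n (M S i) (z +ᵛ scale ε y)               ∎
      where
      open ≡-Reasoning
      arrange : ∀ a b c e → a *ᶻ (b +ᶻ c *ᶻ e) ≡ a *ᶻ b +ᶻ c *ᶻ (a *ᶻ e)
      arrange = solveᶻ-∀

    move-fixed : ∀ z ε i → d ≤ i → (z +ᵛ scale ε y) i ≡ z i
    move-fixed z ε i d≤i rewrite y-fixed i d≤i | ℤₚ.*-zeroʳ ε = ℤₚ.+-identityʳ (z i)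

    extendBy : ∀ z ε → quad (z +ᵛ scale ε y) ≤ᶻ quad z → Better (z +ᵛ scale ε y) → Better z
    extendBy z ε q≤ (better z′ F′ s′ fx le w) =
      better z′ F′ s′ (λ i d≤i → trans (fx i d≤i) (move-fixed z ε i d≤i)) (ℤₚ.≤-trans le q≤) w

    nonneg-move : ∀ a b ε → 0ℤ ≤ᶻ a → ∣ ε ∣ ≤ 1 → ¬ (∣ a ∣ < ∣ b ∣) → 0ℤ ≤ᶻ a +ᶻ ε *ᶻ b
    nonneg-move (⁺ a) b ε _ ε≤1 ≮ = subst (_≤ᶻ ⁺ a +ᶻ ε *ᶻ b) (ℤₚ.+-inverseʳ (⁺ a))
      (ℤₚ.+-monoʳ-≤ (⁺ a) (≤abs (ε *ᶻ b)
          (≤-trans (abs-*-≤ {ε} {b} ε≤1 (≮⇒≥ ≮)) (≤-reflexive (*-identityˡ a)))))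
      where
      ≤abs : ∀ x → ∣ x ∣ ≤ a → - (⁺ a) ≤ᶻ x
      ≤abs (⁺ x) _ = ℤₚ.neg-≤-pos
      ≤abs -[1+ x ] x≤a = ℤₚ.neg-mono-≤ (+≤+ x≤a)

    module _ (A·y≡0 : ∀ r → r < c → dot n (A r) y ≡ 0ℤ) where

      move-feas : ∀ z ε → ∣ ε ∣ ≤ 1 → Feasible z → (∀ i → i < n → ¬ (∣ z i ∣ < ∣ y i ∣)) →
          Feasible (z +ᵛ scale ε y)
      move-feas z ε ε≤1 F big = feasible
        (λ i i<n → nonneg-move (z i) (y i) ε (nonneg F i i<n) ε≤1 (big i i<n))
        (λ r r<c → trans (dot-+ʳ n (A r) z y ε) (trans
          (cong₂ (λ a b → a +ᶻ ε *ᶻ b) (rows F r r<c) (A·y≡0 r r<c))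
              (trans (ℤₚ.+-identityˡ _) (ℤₚ.*-zeroʳ ε))))
        (trans (move-fixed z ε one d≤one) (unit F))

      -- As `z i` is below `∣ y i ∣`, it is a number at most `B`, and "coordinate `i` equals that
      -- number times coordinate `one`" is an equation with bounded coefficients. On `y` it takes
      -- the value `y i`, which is nonzero, because `y` vanishes at `one`.
      boundary : ∀ z → Feasible z → ∀ i → i < n → ∣ z i ∣ < ∣ y i ∣ → NewRow z
      boundary z F i i<n z<y = record
        { R   = δ i +ᵛ scale (- z i) (δ one)
        ; R·z = trans (dot-+ˡ n (δ i) (δ one) (- z i) z) (trans
                  (cong₂ (λ a b → a +ᶻ (- z i) *ᶻ b) (dot-δ n i z i<n) (trans (dot-δ n one z one<n) (unit F)))
                  (cancel (z i)))
        ; R·y = λ eq → ≢0 z<y (value eq)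
        ; R≤  = λ j → ≤-trans (abs-+-≤ {δ i j} {(- z i) *ᶻ δ one j} (∣δ∣≤1 i j)
                  (abs-*-≤ { - z i} {δ one j} (abs-neg-≤ {z i} (≤-trans (<⇒≤ z<y) (M≤B S i f)))
                      (∣δ∣≤1 one j)))
                  (≤-trans (≤-reflexive (cong suc (*-identityʳ B)))
                    (≤-trans (m≤n+m (1 + B) β) (≤-trans (m≤m+n _ _) (m≤m+n _ _))))
        }
        where
        cancel : ∀ a → a +ᶻ (- a) *ᶻ 1ℤ ≡ 0ℤ
        cancel = solveᶻ-∀
        value : dot n (δ i +ᵛ scale (- z i) (δ one)) y ≡ 0ℤ → y i ≡ 0ℤ
        value eq = trans (sym (trans (dot-+ˡ n (δ i) (δ one) (- z i) y) (trans
          (cong₂ (λ a b → a +ᶻ (- z i) *ᶻ b) (dot-δ n i y i<n)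
              (trans (dot-δ n one y one<n) (y-fixed one d≤one)))
          (trans (cong (y i +ᶻ_) (ℤₚ.*-zeroʳ (- z i))) (ℤₚ.+-identityʳ (y i)))))) eq
        ≢0 : ∀ {k a} → k < ∣ a ∣ → a ≢ 0ℤ
        ≢0 () refl

      -- With g for `dot n (grad y) z` and s for `quad y`, the hypotheses say that g lies between -s
      -- and s, strictly below s. So s is positive and g is bounded by s, which depends only on `y`
      -- and `Q`. The equation fixing the gradient at g is new, since its value on `y` is 2s.
      stationary : ∀ z → Feasible z → 0ℤ ≤ᶻ dot n (grad y) z +ᶻ quad y → 0ℤ <ᶻ quad y -ᶻ dot n (grad y) z →
          NewRow z
      stationary z F 0≤ 0< = record
        { R   = grad y +ᵛ scale (- g) (δ one)
        ; R·z = trans (dot-+ˡ n (grad y) (δ one) (- g) z) (trans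
                  (cong (λ b → g +ᶻ (- g) *ᶻ b) (trans (dot-δ n one z one<n) (unit F))) (cancel g))
        ; R·y = λ eq → ℤₚ.<-irrefl refl
            (subst (0ℤ <ᶻ_) (trans (sum-up g (quad y)) (value eq)) (ℤₚ.+-mono-≤-< 0≤ 0<))
        ; R≤  = λ j → ≤-trans (abs-+-≤ {grad y j} {_}
                  (abs-+-≤ {row y j} {_} (row≤ j)
                      (≤-trans (≤-reflexive (cong ∣_∣ (ℤₚ.*-identityˡ (col y j)))) (col≤ j)))
                  (abs-*-≤ { - g} {δ one j} (abs-neg-≤ {g} (≤-trans (abs≤ g (quad y) 0≤ (ℤₚ.<⇒≤ 0<)) quad-y≤))
                      (∣δ∣≤1 one j)))
                  (+-mono-≤ (m≤n+m _ (β + (1 + B))) (≤-reflexive (*-identityʳ _)))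
        }
        where
        g : ℤ
        g = dot n (grad y) z
        cancel : ∀ a → a +ᶻ (- a) *ᶻ 1ℤ ≡ 0ℤ
        cancel = solveᶻ-∀
        sum-up : ∀ g s → g +ᶻ s +ᶻ (s -ᶻ g) ≡ s +ᶻ s
        sum-up = solveᶻ-∀
        value : dot n (grad y +ᵛ scale (- g) (δ one)) y ≡ 0ℤ → quad y +ᶻ quad y ≡ 0ℤ
        value eq = trans (sym (trans (dot-+ˡ n (grad y) (δ one) (- g) y) (trans
          (cong₂ (λ a b → a +ᶻ (- g) *ᶻ b) (grad-self y) (trans (dot-δ n one y one<n) (y-fixed one d≤one)))
          (trans (cong (quad y +ᶻ quad y +ᶻ_) (ℤₚ.*-zeroʳ (- g))) (ℤₚ.+-identityʳ _))))) eq
        row≤ : ∀ j → ∣ row y j ∣ ≤ N * (β * B)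
        row≤ j = ≤-trans (dot-abs n (λ i → ⁺ Q j i) y (λ i → Q≤β j i) (λ i → M≤B S i f)) (*-monoˡ-≤ _ n≤N)
        col≤ : ∀ j → ∣ col y j ∣ ≤ N * (β * B)
        col≤ j = ≤-trans (dot-abs n (λ i → ⁺ Q i j) y (λ i → Q≤β i j) (λ i → M≤B S i f)) (*-monoˡ-≤ _ n≤N)
        quad-y≤ : ∣ quad y ∣ ≤ N * (B * (N * (β * B)))
        quad-y≤ = ≤-trans (dot-abs n y (row y) (λ i → M≤B S i f) row≤) (*-monoˡ-≤ _ n≤N)
        abs≤ : ∀ a b → 0ℤ ≤ᶻ a +ᶻ b → 0ℤ ≤ᶻ b -ᶻ a → ∣ a ∣ ≤ ∣ b ∣
        abs≤ a b p q with ℤₚ.≤-total 0ℤ a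
        ... | inj₁ 0≤a = abs-mono-≤ {a} {b} 0≤a (ℤₚ.0≤i-j⇒j≤i q)
        ... | inj₂ a≤0 = subst (_≤ ∣ b ∣) (ℤₚ.∣-i∣≡∣i∣ a) (abs-mono-≤ { - a} {b} (ℤₚ.neg-mono-≤ a≤0)
                 (ℤₚ.0≤i-j⇒j≤i (subst (0ℤ ≤ᶻ_) (flip a b) p)))
          where
          flip : ∀ a b → a +ᶻ b ≡ b -ᶻ (- a)
          flip = solveᶻ-∀

      -- Moving along y keeps everything but the value of the form, so descend
      -- lexicographically on the value and on z f; the descent stops at the
      -- boundary or at a point where both neighbours are no better.
      descend₁ : ∀ a → (∀ z → Feasible z → Satisfies S z → ∣ quad z ∣ < a → Better z) →
                 ∀ b z → Feasible z → Satisfies S z → ∣ quad z ∣ ≤ a → ∣ z f ∣ < b → Better z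
      descend₁ a again (suc b) z F sat q≤a (s≤s zf≤b)
        with anyUpTo? (λ i → ∣ z i ∣ <? ∣ y i ∣) n
      ... | yes (i , i<n , z<y) = better z F sat (λ _ _ → refl) ℤₚ.≤-refl (boundary z F i i<n z<y)
      -- The tests are asymmetric on purpose. A step against `y` is taken even if the value stays
      -- equal, because it lowers coordinate `f` by the positive `D`; a step along `y` raises that
      -- coordinate and is taken only if the value strictly drops.
      ... | no none with quad (z +ᵛ scale -1ℤ y) ℤₚ.≤? quad z | quad (z +ᵛ scale 1ℤ y) ℤₚ.<? quad z
      ...   | yes dec | _ = extendBy z -1ℤ dec
                (descend₁ a again b _ F₋ (move-sat z -1ℤ sat)
                  (≤-trans (abs-mono-≤ (quad-nonneg _ (nonneg F₋)) dec) q≤a)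
                  (<-≤-trans (shrink (z f) (nonneg F f f<n) (nonneg F₋ f f<n)) zf≤b))
        where
        big : ∀ i → i < n → ¬ (∣ z i ∣ < ∣ y i ∣)
        big i i<n lt = none (i , i<n , lt)
        F₋ : Feasible (z +ᵛ scale -1ℤ y)
        F₋ = move-feas z -1ℤ ≤-refl F big
        shrink : ∀ x → 0ℤ ≤ᶻ x → 0ℤ ≤ᶻ x +ᶻ -1ℤ *ᶻ y f → ∣ x +ᶻ -1ℤ *ᶻ y f ∣ < ∣ x ∣
        shrink x 0≤x 0≤x-y = abs-mono-< 0≤x-y
          (subst (x +ᶻ -1ℤ *ᶻ y f <ᶻ_) (ℤₚ.+-identityʳ x) (ℤₚ.+-monoʳ-< x
            (subst (_<ᶻ 0ℤ) (sym (trans (ℤₚ.-1*i≡-i (y f)) (cong -_ (diag S f ≤-refl))))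
                (ℤₚ.neg-mono-< (D>0 S)))))
      ...   | no _ | yes dec = extendBy z 1ℤ (ℤₚ.<⇒≤ dec)
                (again _ F₊ (move-sat z 1ℤ sat) (<-≤-trans (abs-mono-< (quad-nonneg _ (nonneg F₊)) dec) q≤a))
        where
        F₊ : Feasible (z +ᵛ scale 1ℤ y)
        F₊ = move-feas z 1ℤ ≤-refl F (λ i i<n lt → none (i , i<n , lt))
      ...   | no ≰ | no ≮ = better z F sat (λ _ _ → refl) ℤₚ.≤-refl (stationary z F
                (shift (quad z) _ (ℤₚ.≮⇒≥ ≮)
                    (trans (quad-+ z y 1ℤ) (plus (quad z) (dot n (grad y) z) (quad y))))
                (shift< (quad z) _ (ℤₚ.≰⇒> ≰)
                    (trans (quad-+ z y -1ℤ) (minus (quad z) (dot n (grad y) z) (quad y)))))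
        where
        plus : ∀ q g s → q +ᶻ 1ℤ *ᶻ g +ᶻ 1ℤ *ᶻ 1ℤ *ᶻ s ≡ q +ᶻ (g +ᶻ s)
        plus = solveᶻ-∀
        minus : ∀ q g s → q +ᶻ -1ℤ *ᶻ g +ᶻ -1ℤ *ᶻ -1ℤ *ᶻ s ≡ q +ᶻ (s -ᶻ g)
        minus = solveᶻ-∀
        cancel : ∀ q x → - q +ᶻ (q +ᶻ x) ≡ x
        cancel = solveᶻ-∀
        shift : ∀ q x {w} → q ≤ᶻ w → w ≡ q +ᶻ x → 0ℤ ≤ᶻ x
        shift q x q≤w refl = subst₂ _≤ᶻ_ (ℤₚ.+-inverseˡ q) (cancel q x) (ℤₚ.+-monoʳ-≤ (- q) q≤w)
        shift< : ∀ q x {w} → q <ᶻ w → w ≡ q +ᶻ x → 0ℤ <ᶻ x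
        shift< q x q<w refl = subst₂ _<ᶻ_ (ℤₚ.+-inverseˡ q) (cancel q x) (ℤₚ.+-monoʳ-< (- q) q<w)

      descend : ∀ a z → Feasible z → Satisfies S z → ∣ quad z ∣ < a → Better z
      descend (suc a) z F sat (s≤s q≤a) = descend₁ a (descend a) _ z F sat q≤a ≤-refl

    -- A constraint that does not vanish on `y` is itself the required equation, and `z` stays.
    -- Otherwise moving along `y` respects all constraints and the descent applies.
    improve : ∀ z → Feasible z → Satisfies S z → Better z
    improve z F sat with anyUpTo? (λ r → ¬? (dot n (A r) y ℤₚ.≟ 0ℤ)) c
    ... | yes (r , r<c , ≢0) = better z F sat (λ _ _ → refl) ℤₚ.≤-refl record
      { R = A r ; R·z = rows F r r<c ; R·y = ≢0
      ; R≤ = λ j → ≤-trans (A≤β r j) (≤-trans (m≤m+n β (1 + B)) (≤-trans (m≤m+n _ _) (m≤m+n _ _))) }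
    ... | no none = descend (λ r r<c → decidable-stable (dot n (A r) y ℤₚ.≟ 0ℤ) λ ≢0 → none (r , r<c , ≢0))
                      _ z F sat ≤-refl

  initial : Solved 0 1
  initial = record
    { D = 1ℤ ; M = δ ; D>0 = +<+ (s≤s z≤n) ; cols = λ _ _ () ; diag = λ i _ → δ-refl i
    ; off = λ _ _ _ i≢j → δ-≢ i≢j ; D≤B = ≤-refl ; M≤B = ∣δ∣≤1 }

  record Solution (f : ℕ) (z : ℕ → ℤ) : Set where
    constructor solution
    field
      point  : ℕ → ℤ
      feas   : Feasible point
      same   : ∀ i → d ≤ i → point i ≡ z i
      below  : quad point ≤ᶻ quad z
      system : Solved f (bounds N β f)
      sat    : Satisfies system point

  solve : ∀ f → f ≤ d → ∀ z → Feasible z → Solution f z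
  solve zero    _   z F = solution z F (λ _ _ → refl) ℤₚ.≤-refl initial
    (λ i i<n → trans (ℤₚ.*-identityˡ (z i)) (sym (dot-δ n i z i<n)))
  solve (suc f) f<d z F with solve f (<⇒≤ f<d) z F
  ... | solution z₁ F₁ same₁ below₁ S sat₁ with Step.improve f<d S z₁ F₁ sat₁
  ... | Step.better z₂ F₂ sat₂ same₂ below₂ w with Step.eliminate f<d S z₂ sat₂ w
  ... | S′ , sat′ = solution z₂ F₂ (λ i d≤i → trans (same₂ i d≤i) (same₁ i d≤i))
      (ℤₚ.≤-trans below₂ below₁) S′ sat′

-- Words and blocks

-- `Free` stands for lying outside the vertex cover, whence independence. Classes may mix free
-- vertices and vertices of the cover.
record ClassedGraph : Set₁ where
  field
    X        : Set
    a        : X → X → ℕ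
    a≤1      : ∀ u v → a u v ≤ 1
    a-sym    : ∀ u v → a u v ≡ a v u
    a-irrefl : ∀ u → a u u ≡ 0
    cls      : X → ℕ
    twin     : ∀ {u v} → cls u ≡ cls v → ∀ w → a u w ≡ a v w
    Free     : X → Set
    free?    : ∀ u → Dec (Free u)
    indep    : ∀ {u v} → Free u → Free v → a u v ≡ 0

-- A word lists the vertices of an arrangement from left to right.
module Words (Γ : ClassedGraph) where

  open ClassedGraph Γ

  -- The cost of the edges from `u` into a word whose first letter stands at distance `s` to the
  -- right of `u`.
  reach : X → ℕ → List X → ℕ
  reach u s []      = 0
  reach u s (v ∷ l) = s * a u v + reach u (suc s) l

  wcost : List X → ℕ
  wcost []      = 0
  wcost (u ∷ l) = reach u 1 l + wcost l

  deg : X → List X → ℕ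
  deg u []      = 0
  deg u (v ∷ l) = a u v + deg u l

  count : ℕ → List X → ℕ
  count t []      = 0
  count t (u ∷ l) = ind (gap (cls u) t) + count t l

  count-++ : ∀ t l l′ → count t (l ++ l′) ≡ count t l + count t l′
  count-++ t []      l′ = refl
  count-++ t (u ∷ l) l′ = trans (cong (_ +_) (count-++ t l l′)) (sym (+-assoc (ind (gap (cls u) t)) _ _))

  deg-++ : ∀ u l l′ → deg u (l ++ l′) ≡ deg u l + deg u l′
  deg-++ u []      l′ = refl
  deg-++ u (v ∷ l) l′ = trans (cong (a u v +_) (deg-++ u l l′)) (sym (+-assoc (a u v) _ _))

  deg-free : ∀ {u} l → Free u → All Free l → deg u l ≡ 0
  deg-free []      fu []       = refl
  deg-free (v ∷ l) fu (fv ∷ fl) = cong₂ _+_ (indep fu fv) (deg-free l fu fl)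

  deg-freeˡ : ∀ {u} l l′ → Free u → All Free l → deg u (l ++ l′) ≡ deg u l′
  deg-freeˡ {u} l l′ fu fl = trans (deg-++ u l l′) (cong (_+ deg u l′) (deg-free l fu fl))

  deg-freeʳ : ∀ {u} l l′ → Free u → All Free l′ → deg u (l ++ l′) ≡ deg u l
  deg-freeʳ {u} l l′ fu fl′ =
      trans (deg-++ u l l′) (trans (cong (deg u l +_) (deg-free l′ fu fl′)) (+-identityʳ _))

  deg-twin : ∀ {u v} l → cls u ≡ cls v → deg u l ≡ deg v l
  deg-twin []      eq = refl
  deg-twin (w ∷ l) eq = cong₂ _+_ (twin eq w) (deg-twin l eq)

  reach-suc : ∀ u s l → reach u (suc s) l ≡ reach u s l + deg u l
  reach-suc u s []      = refl
  reach-suc u s (v ∷ l) = trans (cong (suc s * a u v +_) (reach-suc u (suc s) l))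
    (arrange s (a u v) (reach u (suc s) l) (deg u l))
    where
    arrange : ∀ s x r d → suc s * x + (r + d) ≡ s * x + r + (x + d)
    arrange = solve-∀

  reach-swap : ∀ w s l₁ u v l₂ →
    reach w s (l₁ ++ v ∷ u ∷ l₂) + a w v ≡ reach w s (l₁ ++ u ∷ v ∷ l₂) + a w u
  reach-swap w s [] u v l₂ = arrange s (a w u) (a w v) (reach w (suc (suc s)) l₂)
    where
    arrange : ∀ s x y r → s * y + (suc s * x + r) + y ≡ s * x + (suc s * y + r) + x
    arrange = solve-∀
  reach-swap w s (x ∷ l₁) u v l₂ = trans (+-assoc (s * a w x) _ _)
    (trans (cong (s * a w x +_) (reach-swap w (suc s) l₁ u v l₂)) (sym (+-assoc (s * a w x) _ _)))

  -- The swap brings `v` one step closer to `l₁` and away from `l₂`, and `u` the other way round.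
  -- Each saving is added to the opposite side to avoid subtraction.
  cost-swap : ∀ l₁ u v l₂ → a u v ≡ 0 →
    wcost (l₁ ++ v ∷ u ∷ l₂) + (deg v l₁ + deg u l₂) ≡ wcost (l₁ ++ u ∷ v ∷ l₂) + (deg u l₁ + deg v l₂)
  cost-swap [] u v l₂ auv≡0
    rewrite auv≡0 | trans (a-sym v u) auv≡0 | reach-suc u 1 l₂ | reach-suc v 1 l₂ =
    arrange (reach v 1 l₂) (reach u 1 l₂) (deg u l₂) (deg v l₂) (wcost l₂)
    where
    arrange : ∀ x y p q c → x + q + (y + c) + p ≡ y + p + (x + c) + q
    arrange = solve-∀
  cost-swap (w ∷ l₁) u v l₂ auv≡0 rewrite a-sym v w | a-sym u w =
    trans (arrange (reach w 1 (l₁ ++ v ∷ u ∷ l₂)) _ (a w v) (deg v l₁) (deg u l₂))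
      (trans (cong₂ _+_ (reach-swap w 1 l₁ u v l₂) (cost-swap l₁ u v l₂ auv≡0))
        (sym (arrange (reach w 1 (l₁ ++ u ∷ v ∷ l₂)) _ (a w u) (deg u l₁) (deg v l₂))))
    where
    arrange : ∀ r c x y z → r + c + (x + y + z) ≡ (r + x) + (c + (y + z))
    arrange = solve-∀

  -- r may precede r′ between l₁ and l₂: moving r′ to the left is no better.
  Precedes : List X → List X → X → X → Set
  Precedes l₁ l₂ r r′ = Free r → Free r′ → deg r′ l₁ + deg r l₂ ≤ deg r l₁ + deg r′ l₂

  precedes-left : ∀ l₁ l₂ g → All Free g → ∀ r r′ → Precedes l₁ l₂ r r′ → Precedes (l₁ ++ g) l₂ r r′
  precedes-left l₁ l₂ g fg r r′ p fr fr′ =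
    subst₂ _≤_ (cong (_+ deg r l₂) (sym (deg-freeʳ l₁ g fr′ fg)))
        (cong (_+ deg r′ l₂) (sym (deg-freeʳ l₁ g fr fg))) (p fr fr′)

  precedes-right : ∀ l₁ l₂ g → All Free g → ∀ r r′ → Precedes l₁ l₂ r r′ → Precedes l₁ (g ++ l₂) r r′
  precedes-right l₁ l₂ g fg r r′ p fr fr′ =
    subst₂ _≤_ (cong (deg r′ l₁ +_) (sym (deg-freeˡ g l₂ fr fg)))
        (cong (deg r l₁ +_) (sym (deg-freeˡ g l₂ fr′ fg))) (p fr fr′)

  cost-swap-≤ : ∀ l₁ u v l₂ → Free u → Free v → Precedes l₁ l₂ v u →
                wcost (l₁ ++ v ∷ u ∷ l₂) ≤ wcost (l₁ ++ u ∷ v ∷ l₂)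
  cost-swap-≤ l₁ u v l₂ fu fv p = +-cancelʳ-≤ (deg v l₁ + deg u l₂) _ _
    (≤-trans (≤-reflexive (cost-swap l₁ u v l₂ (indep fu fv)))
        (+-monoʳ-≤ (wcost (l₁ ++ u ∷ v ∷ l₂)) (p fv fu)))

  move-past : ∀ l₁ u g l₂ → Free u → All Free g → All (λ v → Precedes l₁ l₂ v u) g →
              wcost (l₁ ++ g ++ u ∷ l₂) ≤ wcost (l₁ ++ u ∷ g ++ l₂)
  move-past l₁ u []      l₂ fu fg ps = ≤-refl
  move-past l₁ u (v ∷ g) l₂ fu (fv ∷ fg) (p ∷ ps) = begin
    wcost (l₁ ++ v ∷ g ++ u ∷ l₂)           ≡⟨ cong wcost (++-assoc l₁ [ v ] (g ++ u ∷ l₂)) ⟨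
    wcost ((l₁ ++ [ v ]) ++ g ++ u ∷ l₂)    ≤⟨ move-past (l₁ ++ [ v ]) u g l₂ fu fg
              (All-map (λ {w} → precedes-left l₁ l₂ [ v ] (fv ∷ []) w u) ps) ⟩
    wcost ((l₁ ++ [ v ]) ++ u ∷ g ++ l₂)    ≡⟨ cong wcost (++-assoc l₁ [ v ] (u ∷ g ++ l₂)) ⟩
    wcost (l₁ ++ v ∷ u ∷ g ++ l₂)           ≤⟨ cost-swap-≤ l₁ u v (g ++ l₂) fu fv
              (precedes-right l₁ l₂ g fg v u p) ⟩
    wcost (l₁ ++ u ∷ v ∷ g ++ l₂)           ∎
    where open ≤-Reasoning

  reach-twin : ∀ {u u′} s l l′ → cls u ≡ cls u′ → map cls l ≡ map cls l′ → reach u s l ≡ reach u′ s l′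
  reach-twin s []      []       eq eqs = refl
  reach-twin {u} {u′} s (v ∷ l) (v′ ∷ l′) eq eqs with ∷-injective eqs
  ... | eqv , eql = cong₂ _+_
    (cong (s *_) (trans (twin eq v) (trans (a-sym u′ v) (trans (twin eqv u′) (a-sym v′ u′)))))
    (reach-twin (suc s) l l′ eq eql)

  cost-twin : ∀ l l′ → map cls l ≡ map cls l′ → wcost l ≡ wcost l′
  cost-twin []      []        eqs = refl
  cost-twin (u ∷ l) (u′ ∷ l′) eqs with ∷-injective eqs
  ... | equ , eql = cong₂ _+_ (reach-twin 1 l l′ equ eql) (cost-twin l l′ eql)

  -- The flag marks a single vertex of the cover; the other blocks repeat a free vertex. Repeating a
  -- letter is harmless, since only the class of each letter and the class counts are retained in
  -- the end.
  Block : Set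
  Block = Bool × X × ℕ

  Valid : Block → Set
  Valid (true  , u , m) = m ≡ 1
  Valid (false , u , m) = Free u

  expand : List Block → List X
  expand []                 = []
  expand ((_ , u , m) ∷ bs) = replicate m u ++ expand bs

  covers : List X → ℕ
  covers [] = 0
  covers (u ∷ l) with free? u
  ... | yes _ = covers l
  ... | no _  = suc (covers l)

  record Blocked (l₁ l : List X) (b : ℕ) : Set where
    constructor blocked
    field
      bs      : List Block
      valid   : All Valid bs
      cost≤   : wcost (l₁ ++ expand bs) ≤ wcost (l₁ ++ l)
      counts  : ∀ t → count t (expand bs) ≡ count t l
      length≤ : length bs ≤ b

  groups : List (X × ℕ) → List X
  groups []             = []
  groups ((r , m) ∷ gs) = replicate m r ++ groups gs

  groups-free : ∀ gs → All Free (map proj₁ gs) → All Free (groups gs)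
  groups-free []             []       = []
  groups-free ((r , m) ∷ gs) (fr ∷ fs) = All-++⁺ (All-replicate m fr) (groups-free gs fs)

  record Grouped (rs : List X) (l₁ seg l₂ : List X) : Set where
    constructor grouped
    field
      gs      : List (X × ℕ)
      letters : map proj₁ gs ≡ rs
      cost≤   : wcost (l₁ ++ groups gs ++ l₂) ≤ wcost (l₁ ++ seg ++ l₂)
      counts  : ∀ t → count t (groups gs) ≡ count t seg

  -- The letter `u` travels right to the group of its class. It passes only groups whose letters may
  -- precede it, so no swap increases the cost, and on arrival it is replaced by its twin, the
  -- representative.
  insert : ∀ l₁ l₂ gs u → Free u → All Free (map proj₁ gs) → AllPairs (Precedes l₁ l₂) (map proj₁ gs) →
           Any (λ r → cls r ≡ cls u) (map proj₁ gs) → Grouped (map proj₁ gs) l₁ (u ∷ groups gs) l₂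
  insert l₁ l₂ ((r , m) ∷ gs) u fu (fr ∷ fs) (p ∷ ps) (here eq) = grouped ((r , suc m) ∷ gs) refl
    (≤-reflexive (cost-twin (l₁ ++ r ∷ rest ++ l₂) (l₁ ++ u ∷ rest ++ l₂)
      (trans (map-++ cls l₁ _) (trans (cong (λ t → map cls l₁ ++ t ∷ map cls (rest ++ l₂)) eq)
          (sym (map-++ cls l₁ _))))))
    (λ t → cong (λ c → ind (gap c t) + count t rest) eq)
    where
    rest : List X
    rest = replicate m r ++ groups gs
  insert l₁ l₂ ((r , m) ∷ gs) u fu (fr ∷ fs) (p ∷ ps) (there any)
    with insert (l₁ ++ replicate m r) l₂ gs u fu fs
           (AllPairs-map (λ {x} {y} → precedes-left l₁ l₂ (replicate m r) (All-replicate m fr) x y) ps) any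
  ... | grouped gs′ letters cost≤ counts = grouped ((r , m) ∷ gs′) (cong (r ∷_) letters) le
    (λ t → begin
      count t (replicate m r ++ groups gs′)                            ≡⟨ count-++ t (replicate m r) _ ⟩
      count t (replicate m r) + count t (groups gs′)
        ≡⟨ cong (count t (replicate m r) +_) (counts t) ⟩
      count t (replicate m r) + (ind (gap (cls u) t) + count t (groups gs))
        ≡⟨ shuffle (count t (replicate m r)) (ind (gap (cls u) t)) (count t (groups gs)) ⟩
      ind (gap (cls u) t) + (count t (replicate m r) + count t (groups gs))
        ≡⟨ cong (ind (gap (cls u) t) +_) (sym (count-++ t (replicate m r) _)) ⟩
      ind (gap (cls u) t) + count t (replicate m r ++ groups gs)       ∎)
    where
    open ≡-Reasoning
    shuffle : ∀ x y z → x + (y + z) ≡ y + (x + z)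
    shuffle = solve-∀
    Precedes-u : ∀ {rs} → All (Precedes l₁ l₂ r) rs → All Free rs → Any (λ r′ → cls r′ ≡ cls u) rs →
        Precedes l₁ l₂ r u
    Precedes-u (q ∷ qs) (f ∷ fs) (here eq) _ _ =
      subst₂ _≤_ (cong (_+ deg r l₂) (deg-twin l₁ eq)) (cong (deg r l₁ +_) (deg-twin l₂ eq)) (q fr f)
    Precedes-u (q ∷ qs) (f ∷ fs) (there any) = Precedes-u qs fs any
    le : wcost (l₁ ++ (replicate m r ++ groups gs′) ++ l₂) ≤ wcost
        (l₁ ++ u ∷ (replicate m r ++ groups gs) ++ l₂)
    le = ≤-trans (≤-reflexive
        (cong wcost (trans (cong (l₁ ++_) (++-assoc (replicate m r) _ l₂))
            (sym (++-assoc l₁ (replicate m r) _)))))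
      (≤-trans cost≤
        (≤-trans (≤-reflexive (cong wcost (++-assoc l₁ (replicate m r) _)))
          (≤-trans (move-past l₁ u (replicate m r) (groups gs ++ l₂) fu (All-replicate m fr)
                     (All-replicate m (precedes-right l₁ l₂ (groups gs) (groups-free gs fs) r u
                         (Precedes-u p fs any))))
            (≤-reflexive (cong (λ w → wcost (l₁ ++ u ∷ w))
                (sym (++-assoc (replicate m r) (groups gs) l₂)))))))

  module _ (reps : List X) (reps-free : All Free reps)
      (rep : ∀ u → Free u → Any (λ r → cls r ≡ cls u) reps) where

    -- Insertion sort towards an order of the representatives chosen beforehand. It is consistent
    -- because free vertices are independent: letters of the gap may be counted on either side
    -- without changing the degrees that the order compares.
    gather : ∀ rs l₁ seg l₂ → rs ↭ reps → AllPairs (Precedes l₁ l₂) rs → All Free seg → Grouped rs l₁ seg l₂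
    gather rs l₁ [] l₂ perm ord [] =
        grouped (map (_, 0) rs) (letters rs) (≤-reflexive (cong (λ w → wcost (l₁ ++ w ++ l₂)) (empty rs)))
      (λ t → cong (count t) (empty rs))
      where
      letters : ∀ rs → map proj₁ (map (_, 0) rs) ≡ rs
      letters []       = refl
      letters (r ∷ rs) = cong (r ∷_) (letters rs)
      empty : ∀ rs → groups (map (_, 0) rs) ≡ []
      empty []       = refl
      empty (r ∷ rs) = empty rs
    gather rs l₁ (u ∷ seg) l₂ perm ord (fu ∷ fseg)
      with gather rs (l₁ ++ [ u ]) seg l₂ perm
             (AllPairs-map (λ {x} {y} → precedes-left l₁ l₂ [ u ] (fu ∷ []) x y) ord) fseg
    ... | grouped gs refl cost≤ counts
      with insert l₁ l₂ gs u fu (All-resp-↭ (↭-sym perm) reps-free) ord (Any-resp-↭ (↭-sym perm) (rep u fu))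
    ... | grouped gs′ letters′ cost≤′ counts′ = grouped gs′ letters′
      (≤-trans cost≤′ (subst₂ _≤_ (cong wcost (++-assoc l₁ [ u ] _))
          (cong wcost (++-assoc l₁ [ u ] _)) cost≤))
      (λ t → trans (counts′ t) (cong (ind (gap (cls u) t) +_) (counts t)))

    -- `Precedes` compares an integer key, the degree to the right minus the degree to the left, so
    -- sorting by this key orders all pairs and not just consecutive ones.
    sorted : ∀ l₁ l₂ → Σ (List X) λ rs → rs ↭ reps × AllPairs (Precedes l₁ l₂) rs
    sorted l₁ l₂ = sort reps , sort-↭ reps ,
      AllPairs-map (λ {r} {r′} le _ _ → from-key r r′ le) (Linked⇒AllPairs ℤₚ.≤-trans (sort-↗ reps))
      where
      key : X → ℤ
      key r = ⁺ deg r l₂ -ᶻ ⁺ deg r l₁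
      open Sort (On.decTotalOrder ℤₚ.≤-decTotalOrder key)
      from-key : ∀ r r′ → key r ≤ᶻ key r′ → deg r′ l₁ + deg r l₂ ≤ deg r l₁ + deg r′ l₂
      from-key r r′ le = ℤₚ.drop‿+≤+ (subst₂ _≤ᶻ_
        (trans (left (⁺ deg r l₂) (⁺ deg r l₁) (⁺ deg r′ l₁)) (sym (ℤₚ.pos-+ (deg r′ l₁) (deg r l₂))))
        (trans (right (⁺ deg r′ l₂) (⁺ deg r′ l₁) (⁺ deg r l₁)) (sym (ℤₚ.pos-+ (deg r l₁) (deg r′ l₂))))
        (ℤₚ.+-monoʳ-≤ (⁺ deg r l₁ +ᶻ ⁺ deg r′ l₁) le))
        where
        left : ∀ x y z → y +ᶻ z +ᶻ (x -ᶻ y) ≡ z +ᶻ x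
        left = solveᶻ-∀
        right : ∀ x y z → z +ᶻ y +ᶻ (x -ᶻ y) ≡ z +ᶻ x
        right = solveᶻ-∀

    toBlocks : List (X × ℕ) → List Block
    toBlocks []       = []
    toBlocks (g ∷ gs) = (false , g) ∷ toBlocks gs

    toBlocks-length : ∀ gs → length (toBlocks gs) ≡ length (map proj₁ gs)
    toBlocks-length []       = refl
    toBlocks-length (g ∷ gs) = cong suc (toBlocks-length gs)

    expand-toBlocks : ∀ gs bs → expand (toBlocks gs ++ bs) ≡ groups gs ++ expand bs
    expand-toBlocks []             bs = refl
    expand-toBlocks ((r , m) ∷ gs) bs =
      trans (cong (replicate m r ++_) (expand-toBlocks gs bs))
          (sym (++-assoc (replicate m r) (groups gs) (expand bs)))

    toBlocks-valid : ∀ gs → All Free (map proj₁ gs) → All Valid (toBlocks gs)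
    toBlocks-valid []       []        = []
    toBlocks-valid (g ∷ gs) (fg ∷ fgs) = fg ∷ toBlocks-valid gs fgs

    -- The argument `seg` collects the gap before the next cover vertex. Each cover vertex pays for
    -- itself and for the gap to its left, with one possibly empty block per representative; the
    -- last gap accounts for the final summand.
    blockify : ∀ l₁ seg l₂ → All Free seg →
              Blocked l₁ (seg ++ l₂) (covers l₂ * suc (length reps) + length reps)
    blockify l₁ seg [] fseg with sorted l₁ []
    ... | rs , perm , ord with gather rs l₁ seg [] perm ord fseg
    ... | grouped gs refl cost≤ counts = blocked (toBlocks gs)
      (toBlocks-valid gs (All-resp-↭ (↭-sym perm) reps-free))
      (subst (λ w → wcost (l₁ ++ w) ≤ wcost (l₁ ++ seg ++ [])) (sym eq) cost≤)
      (λ t → trans (cong (count t) (trans eq (++-identityʳ (groups gs))))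
          (trans (counts t) (cong (count t) (sym (++-identityʳ seg)))))
      (≤-reflexive (trans (toBlocks-length gs) (↭-length perm)))
      where
      eq : expand (toBlocks gs) ≡ groups gs ++ []
      eq = trans (cong expand (sym (++-identityʳ (toBlocks gs)))) (expand-toBlocks gs [])
    blockify l₁ seg (v ∷ l₂) fseg with free? v
    ... | yes fv = subst (λ w → Blocked l₁ w (covers l₂ * suc (length reps) + length reps))
        (++-assoc seg [ v ] l₂)
                     (blockify l₁ (seg ++ [ v ]) l₂ (All-++⁺ fseg (fv ∷ [])))
    ... | no _ with sorted l₁ (v ∷ l₂)
    ... | rs , perm , ord with gather rs l₁ seg (v ∷ l₂) perm ord fseg
    ... | grouped gs refl cost≤ counts with blockify (l₁ ++ groups gs ++ [ v ]) [] l₂ []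
    ... | blocked bs valid cost≤′ counts′ length≤ = blocked (toBlocks gs ++ (true , v , 1) ∷ bs)
      (All-++⁺ (toBlocks-valid gs (All-resp-↭ (↭-sym perm) reps-free)) (refl ∷ valid))
      (≤-trans (≤-reflexive (cong wcost
          (trans (cong (l₁ ++_) (expand-toBlocks gs ((true , v , 1) ∷ bs))) (sym (reassoc (expand bs))))))
        (≤-trans cost≤′ (≤-trans (≤-reflexive (cong wcost (reassoc l₂))) cost≤)))
      (λ t → trans (cong (count t) (expand-toBlocks gs ((true , v , 1) ∷ bs)))
        (trans (count-++ t (groups gs) (v ∷ expand bs))
          (trans (cong₂ (λ x y → x + (ind (gap (cls v) t) + y)) (counts t) (counts′ t))
              (sym (count-++ t seg (v ∷ l₂))))))
      (begin
        length (toBlocks gs ++ (true , v , 1) ∷ bs)           ≡⟨ length-++ (toBlocks gs) ⟩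
        length (toBlocks gs) + suc (length bs)
          ≡⟨ cong (_+ suc (length bs)) (trans (toBlocks-length gs) (↭-length perm)) ⟩
        length reps + suc (length bs)                         ≤⟨ +-monoʳ-≤ (length reps) (s≤s length≤) ⟩
        length reps + suc (covers l₂ * suc (length reps) + length reps)
          ≡⟨ tidy (length reps) (covers l₂ * suc (length reps)) ⟩
        suc (length reps) + covers l₂ * suc (length reps) + length reps ∎)
      where
      open ≤-Reasoning
      tidy : ∀ x y → x + suc (y + x) ≡ suc x + y + x
      tidy = solve-∀
      reassoc : ∀ w → (l₁ ++ groups gs ++ [ v ]) ++ w ≡ l₁ ++ groups gs ++ v ∷ w
      reassoc w = trans (++-assoc l₁ (groups gs ++ [ v ]) w) (cong (l₁ ++_) (++-assoc (groups gs) [ v ] w))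

-- The cost of a sequence of blocks as a quadratic form

lin : ℕ → (ℕ → ℕ) → (ℕ → ℕ) → ℕ
lin n p z = ∑ n λ j → p j * z j

quadℕ : ℕ → (ℕ → ℕ → ℕ) → (ℕ → ℕ) → ℕ
quadℕ n Q z = ∑ n λ i → z i * lin n (Q i) z

lin-+ : ∀ n p q z → lin n (λ j → p j + q j) z ≡ lin n p z + lin n q z
lin-+ n p q z = trans (∑-cong n λ j _ → *-distribʳ-+ (z j) (p j) (q j)) (∑-+ n _ _)

∑-*ˡ : ∀ n c f → ∑ n (λ i → c * f i) ≡ c * ∑ n f
∑-*ˡ n c f = trans (∑-cong n λ i _ → *-comm c (f i)) (trans (∑-*ʳ n f c) (*-comm (∑ n f) c))

lin-*ˡ : ∀ n c p z → lin n (λ j → c * p j) z ≡ c * lin n p z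
lin-*ˡ n c p z = trans (∑-cong n λ j _ → *-assoc c (p j) (z j)) (∑-*ˡ n c _)

∑-single : ∀ n f k → k < n → (∀ i → i < n → i ≢ k → f i ≡ 0) → ∑ n f ≡ f k
∑-single (suc n) f k k<1+n h with k ≟ n
... | yes refl = trans (cong (f n +_) (≡0⇒∑≡0 n f λ i i<n → h i (m<n⇒m<1+n i<n) (<⇒≢ i<n)))
    (+-identityʳ (f n))
... | no k≢n rewrite h n ≤-refl (≢-sym k≢n) =
  ∑-single n f k (≤∧≢⇒< (≤-pred k<1+n) k≢n) λ i i<n → h i (m<n⇒m<1+n i<n)

unitAt : ℕ → ℕ → ℕ
unitAt b i = ind (gap b i)

lin-unit : ∀ n b z → b < n → lin n (unitAt b) z ≡ z b
lin-unit n b z b<n = trans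
  (∑-single n _ b b<n λ i _ i≢b → cong (_* z i) (ind-gap-≢ (≢-sym i≢b)))
  (trans (cong (_* z b) (ind-gap-≡ {b} refl)) (*-identityˡ (z b)))

quadℕ-+ : ∀ n P Q z → quadℕ n (λ i j → P i j + Q i j) z ≡ quadℕ n P z + quadℕ n Q z
quadℕ-+ n P Q z = trans
  (∑-cong n λ i _ → trans (cong (z i *_) (lin-+ n (P i) (Q i) z)) (*-distribˡ-+ (z i) _ _)) (∑-+ n _ _)

quadℕ-outer : ∀ n p r z → quadℕ n (λ i j → p i * r j) z ≡ lin n p z * lin n r z
quadℕ-outer n p r z = trans
  (∑-cong n λ i _ → trans (cong (z i *_) (lin-*ˡ n (p i) r z)) (arrange (z i) (p i) (lin n r z))) (∑-*ʳ n _ _)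
  where
  arrange : ∀ x y w → x * (y * w) ≡ y * x * w
  arrange = solve-∀

quadℕ-zero : ∀ n z → quadℕ n (λ _ _ → 0) z ≡ 0
quadℕ-zero n z = ≡0⇒∑≡0 n _ λ i _ → trans (cong (z i *_) (∑-zero n)) (*-zeroʳ (z i))

∑ᶻ-pos : ∀ n f → ∑ᶻ n (λ i → ⁺ f i) ≡ ⁺ ∑ n f
∑ᶻ-pos zero    f = refl
∑ᶻ-pos (suc n) f = trans (cong (⁺ f n +ᶻ_) (∑ᶻ-pos n f)) (sym (ℤₚ.pos-+ (f n) (∑ n f)))

dot-pos : ∀ n p z → dot n (λ j → ⁺ p j) (λ j → ⁺ z j) ≡ ⁺ lin n p z
dot-pos n p z = trans (∑ᶻ-cong n λ j _ → sym (ℤₚ.pos-* (p j) (z j))) (∑ᶻ-pos n _)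

quad-pos : ∀ n Q z → Form.quad n Q (λ i → ⁺ z i) ≡ ⁺ quadℕ n Q z
quad-pos n Q z = trans (∑ᶻ-cong n λ i _ → cong (⁺ z i *ᶻ_) (dot-pos n (Q i) z))
    (dot-pos n z (λ i → lin n (Q i) z))

module Patterns (Γ : ClassedGraph) where

  open ClassedGraph Γ
  open Words Γ

  Pattern : Set
  Pattern = List (Bool × X)

  spread : Pattern → ℕ → (ℕ → ℕ) → List X
  spread []            b z = []
  spread ((_ , u) ∷ π) b z = replicate (z b) u ++ spread π (suc b) z

  Fits : Pattern → ℕ → (ℕ → ℕ) → Set
  Fits []                b z = ⊤
  Fits ((true  , u) ∷ π) b z = z b ≡ 1 × Fits π (suc b) z
  Fits ((false , u) ∷ π) b z = Free u × Fits π (suc b) z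

  -- Twice the cost between a block of `x` copies of `u` and the blocks of the pattern. Blocks of
  -- sizes x and y with S letters between them have distances S + 1 + i + j for i < x and j < y, and
  -- twice their sum is x y (2 S + x + y).
  pairs : X → ℕ → ℕ → Pattern → ℕ → (ℕ → ℕ) → ℕ
  pairs u x S []            b z = 0
  pairs u x S ((_ , v) ∷ π) b z = a u v * (x * z b * (S + S + x + z b)) + pairs u x (S + z b) π (suc b) z

  total : Pattern → ℕ → (ℕ → ℕ) → ℕ
  total []            b z = 0
  total ((_ , u) ∷ π) b z = pairs u (z b) 0 π (suc b) z + total π (suc b) z

  -- The sum of an arithmetic progression, doubled. The summand `y * a u v` on the left replaces the
  -- subtraction of 1 in y (2 s + y - 1).
  reach-replicate : ∀ u v l y s →
    2 * reach u s (replicate y v ++ l) + y * a u v ≡ a u v * (y * (s + s + y)) + 2 * reach u (y + s) l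
  reach-replicate u v l zero s = arrange (reach u s l) (a u v)
    where
    arrange : ∀ r α → 2 * r + 0 ≡ α * 0 + 2 * r
    arrange = solve-∀
  reach-replicate u v l (suc y) s = begin
    2 * (s * α + R) + (α + y * α)
      ≡⟨ split s α R y ⟩
    s * α + s * α + α + (2 * R + y * α)
      ≡⟨ cong (s * α + s * α + α +_)
           (trans (reach-replicate u v l y (suc s))
               (cong (λ k → α * (y * (suc s + suc s + y)) + 2 * reach u k l) (+-suc y s))) ⟩
    s * α + s * α + α + (α * (y * (suc s + suc s + y)) + 2 * reach u (suc (y + s)) l)
      ≡⟨ join s α y (reach u (suc (y + s)) l) ⟩
    α * (suc y * (s + s + suc y)) + 2 * reach u (suc y + s) l ∎
    where
    open ≡-Reasoning
    α R : ℕ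
    α = a u v
    R = reach u (suc s) (replicate y v ++ l)
    split : ∀ s α R y → 2 * (s * α + R) + (α + y * α) ≡ s * α + s * α + α + (2 * R + y * α)
    split = solve-∀
    join : ∀ s α y R → s * α + s * α + α + (α * (y * (suc s + suc s + y)) + 2 * R) ≡ α *
        (suc y * (s + s + suc y)) + 2 * R
    join = solve-∀

  reach-block : ∀ u v l x y S →
    2 * ∑ x (λ i → reach u (suc (i + S)) (replicate y v ++ l)) ≡
    a u v * (x * y * (S + S + x + y)) + 2 * ∑ x (λ i → reach u (suc (i + (S + y))) l)
  reach-block u v l zero y S = sym (trans (+-identityʳ _) (*-zeroʳ (a u v)))
  reach-block u v l (suc x) y S = +-cancelʳ-≡ (y * α) _ _ (begin
    2 * (ρ + P) + y * α
      ≡⟨ split ρ P (y * α) ⟩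
    (2 * ρ + y * α) + 2 * P
      ≡⟨ cong₂ _+_ (trans (reach-replicate u v l y (suc (x + S)))
           (cong (λ k → α * (y * (suc (x + S) + suc (x + S) + y)) + 2 * reach u k l) (index x y S)))
               (reach-block u v l x y S) ⟩
    (α * (y * (suc (x + S) + suc (x + S) + y)) + 2 * ρ′) + (α * (x * y * (S + S + x + y)) + 2 * P′)
      ≡⟨ join α x y S ρ′ P′ ⟩
    α * (suc x * y * (S + S + suc x + y)) + 2 * (ρ′ + P′) + y * α ∎)
    where
    open ≡-Reasoning
    α ρ P ρ′ P′ : ℕ
    α = a u v
    ρ = reach u (suc (x + S)) (replicate y v ++ l)
    P = ∑ x (λ i → reach u (suc (i + S)) (replicate y v ++ l))
    ρ′ = reach u (suc (x + (S + y))) l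
    P′ = ∑ x (λ i → reach u (suc (i + (S + y))) l)
    split : ∀ a b c → 2 * (a + b) + c ≡ (2 * a + c) + 2 * b
    split = solve-∀
    index : ∀ x y S → y + suc (x + S) ≡ suc (x + (S + y))
    index = solve-∀
    join : ∀ α x y S ρ P →
      (α * (y * (suc (x + S) + suc (x + S) + y)) + 2 * ρ) + (α * (x * y * (S + S + x + y)) + 2 * P) ≡
      α * (suc x * y * (S + S + suc x + y)) + 2 * (ρ + P) + y * α
    join = solve-∀

  reach-self : ∀ u l x s → reach u s (replicate x u ++ l) ≡ reach u (x + s) l
  reach-self u l zero    s = refl
  reach-self u l (suc x) s rewrite a-irrefl u | *-zeroʳ s =
    trans (reach-self u l x (suc s)) (cong (λ k → reach u k l) (+-suc x s))

  cost-replicate : ∀ u l x → wcost (replicate x u ++ l) ≡ ∑ x (λ i → reach u (suc (i + 0)) l) + wcost l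
  cost-replicate u l zero    = refl
  cost-replicate u l (suc x) = trans
    (cong₂ _+_ (trans (reach-self u l x 1) (cong (λ k → reach u k l) (+-suc x 0))) (cost-replicate u l x))
    (sym (+-assoc (reach u (suc (x + 0)) l) _ _))

  reach-spread : ∀ u x S π b z → 2 * ∑ x (λ i → reach u (suc (i + S)) (spread π b z)) ≡ pairs u x S π b z
  reach-spread u x S []            b z = cong (2 *_) (∑-zero x)
  reach-spread u x S ((_ , v) ∷ π) b z = trans (reach-block u v (spread π (suc b) z) x (z b) S)
    (cong (_ +_) (reach-spread u x (S + z b) π (suc b) z))

  cost-spread : ∀ π b z → 2 * wcost (spread π b z) ≡ total π b z
  cost-spread []            b z = refl
  cost-spread ((_ , u) ∷ π) b z = trans (cong (2 *_) (cost-replicate u (spread π (suc b) z) (z b)))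
    (trans (*-distribˡ-+ 2 (∑ (z b) _) (wcost (spread π (suc b) z)))
        (cong₂ _+_ (reach-spread u (z b) 0 π (suc b) z) (cost-spread π (suc b) z)))

  -- x_b x_c (2 S + x_b + x_c) is cubic, but becomes quadratic because one of
  -- the blocks b, c is a single cover vertex whenever they are adjacent.
  pick : Bool → Bool → ℕ → ℕ → ℕ → ℕ
  pick true  _     b c = unitAt c
  pick false true  b c = unitAt b
  pick false false b c = λ _ → 0

  -- The outer product of two linear forms: `pick` for the product of the two block sizes, and the
  -- sum 2 S + x_b + x_c, where `S` is itself the linear form that adds up the blocks in between.
  pairForm : ℕ → Bool → Bool → ℕ → ℕ → (ℕ → ℕ) → ℕ → ℕ → ℕ
  pairForm α f f′ b c S i j = pick f f′ b c i * (α * (S j + S j + unitAt b j + unitAt c j))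

  pairsForm : Bool → X → ℕ → (ℕ → ℕ) → Pattern → ℕ → ℕ → ℕ → ℕ
  pairsForm f u b S []             c i j = 0
  pairsForm f u b S ((f′ , v) ∷ π) c i j =
    pairForm (a u v) f f′ b c S i j + pairsForm f u b (λ k → S k + unitAt c k) π (suc c) i j

  form : Pattern → ℕ → ℕ → ℕ → ℕ
  form []            b i j = 0
  form ((f , u) ∷ π) b i j = pairsForm f u b (λ _ → 0) π (suc b) i j + form π (suc b) i j

  FitsOne : Bool → X → ℕ → (ℕ → ℕ) → Set
  FitsOne true  u b z = z b ≡ 1
  FitsOne false u b z = Free u

  fits-head : ∀ f {u} π {b z} → Fits ((f , u) ∷ π) b z → FitsOne f u b z × Fits π (suc b) z
  fits-head true  π h = h
  fits-head false π h = h

  pick-value : ∀ n f f′ {u v} b c z w → b < n → c < n → FitsOne f u b z → FitsOne f′ v c z →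
               lin n (pick f f′ b c) z * (a u v * w) ≡ a u v * (z b * z c * w)
  pick-value n true f′ {u} {v} b c z w b<n c<n zb≡1 _ rewrite lin-unit n c z c<n | zb≡1 =
      arrange (z c) (a u v) w
    where
    arrange : ∀ x α w → x * (α * w) ≡ α * (1 * x * w)
    arrange = solve-∀
  pick-value n false true {u} {v} b c z w b<n c<n _ zc≡1 rewrite lin-unit n b z b<n | zc≡1 =
      arrange (z b) (a u v) w
    where
    arrange : ∀ x α w → x * (α * w) ≡ α * (x * 1 * w)
    arrange = solve-∀
  pick-value n false false {u} {v} b c z w b<n c<n fu fv rewrite indep fu fv = *-zeroʳ (lin n (λ _ → 0) z)

  pairForm-value : ∀ n f f′ {u v} b c S z → b < n → c < n → FitsOne f u b z → FitsOne f′ v c z →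
    quadℕ n (pairForm (a u v) f f′ b c S) z ≡ a u v * (z b * z c * (lin n S z + lin n S z + z b + z c))
  pairForm-value n f f′ {u} {v} b c S z b<n c<n hb hc = begin
    quadℕ n (pairForm (a u v) f f′ b c S) z
      ≡⟨ quadℕ-outer n (pick f f′ b c) _ z ⟩
    lin n (pick f f′ b c) z * lin n (λ j → a u v * (S j + S j + unitAt b j + unitAt c j)) z
      ≡⟨ cong (lin n (pick f f′ b c) z *_) (trans (lin-*ˡ n (a u v) _ z) (cong (a u v *_) inner)) ⟩
    lin n (pick f f′ b c) z * (a u v * (lin n S z + lin n S z + z b + z c))
      ≡⟨ pick-value n f f′ {u} {v} b c z _ b<n c<n hb hc ⟩
    a u v * (z b * z c * (lin n S z + lin n S z + z b + z c)) ∎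
    where
    open ≡-Reasoning
    inner : lin n (λ j → S j + S j + unitAt b j + unitAt c j) z ≡ lin n S z + lin n S z + z b + z c
    inner = trans (lin-+ n (λ j → S j + S j + unitAt b j) (unitAt c) z)
        (cong₂ _+_ (trans (lin-+ n (λ j → S j + S j) (unitAt b) z)
      (cong₂ _+_ (lin-+ n S S z) (lin-unit n b z b<n))) (lin-unit n c z c<n))

  pairsForm-value : ∀ n f u b S π c z → b < n → c + length π ≤ n → FitsOne f u b z → Fits π c z →
    quadℕ n (pairsForm f u b S π c) z ≡ pairs u (z b) (lin n S z) π c z
  pairsForm-value n f u b S [] c z b<n len hb fits = quadℕ-zero n z
  pairsForm-value n f u b S ((f′ , v) ∷ π) c z b<n len hb fits with fits-head f′ π fits
  ... | hc , rest = trans (quadℕ-+ n (pairForm (a u v) f f′ b c S)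
      (pairsForm f u b (λ k → S k + unitAt c k) π (suc c)) z) (cong₂ _+_
      (pairForm-value n f f′ b c S z b<n c<n hb hc)
      (trans (pairsForm-value n f u b (λ k → S k + unitAt c k) π (suc c) z b<n
          (subst (_≤ n) (+-suc c (length π)) len) hb rest)
        (cong (λ s → pairs u (z b) s π (suc c) z)
            (trans (lin-+ n S (unitAt c) z) (cong (lin n S z +_) (lin-unit n c z c<n))))))
    where
    c<n : c < n
    c<n = <-≤-trans (m<m+n c (s≤s z≤n)) len

  form-value : ∀ n π b z → b + length π ≤ n → Fits π b z → quadℕ n (form π b) z ≡ total π b z
  form-value n []            b z len fits = quadℕ-zero n z
  form-value n ((f , u) ∷ π) b z len fits with fits-head f π fits
  ... | hb , rest = trans (quadℕ-+ n (pairsForm f u b (λ _ → 0) π (suc b)) (form π (suc b)) z) (cong₂ _+_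
      (trans (pairsForm-value n f u b (λ _ → 0) π (suc b) z (<-≤-trans (m<m+n b (s≤s z≤n)) len) len′ hb rest)
        (cong (λ s → pairs u (z b) s π (suc b) z) (∑-zero n)))
      (form-value n π (suc b) z len′ rest))
    where
    len′ : suc b + length π ≤ n
    len′ = subst (_≤ n) (+-suc b (length π)) len

  pick≤1 : ∀ f f′ b c i → pick f f′ b c i ≤ 1
  pick≤1 true  _     b c i = ind≤1 (gap c i)
  pick≤1 false true  b c i = ind≤1 (gap b i)
  pick≤1 false false b c i = z≤n

  pairsForm≤ : ∀ f u b S π c L → (∀ k → S k + length π ≤ L) → ∀ i j →
               pairsForm f u b S π c i j ≤ length π * (L + L + 1 + 1)
  pairsForm≤ f u b S []             c L h i j = z≤n
  pairsForm≤ f u b S ((f′ , v) ∷ π) c L h i j = +-mono-≤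
    (≤-trans (*-mono-≤ (pick≤1 f f′ b c i)
        (*-mono-≤ (a≤1 u v) (+-mono-≤ (+-mono-≤ (+-mono-≤ S≤ S≤) (ind≤1 (gap b j))) (ind≤1 (gap c j)))))
      (≤-reflexive (trans (*-identityˡ _) (*-identityˡ _))))
    (pairsForm≤ f u b (λ k → S k + unitAt c k) π (suc c) L
      (λ k → ≤-trans (+-monoˡ-≤ (length π) (+-monoʳ-≤ (S k) (ind≤1 (gap c k))))
          (≤-trans (≤-reflexive (+-assoc (S k) 1 (length π))) (h k))) i j)
    where
    S≤ : S j ≤ L
    S≤ = ≤-trans (m≤m+n (S j) _) (h j)

  form≤ : ∀ π b L → length π ≤ L → ∀ i j → form π b i j ≤ length π * (L * (L + L + 1 + 1))
  form≤ []            b L len i j = z≤n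
  form≤ ((f , u) ∷ π) b L len i j = +-mono-≤
    (≤-trans (pairsForm≤ f u b (λ _ → 0) π (suc b) L (λ _ → <⇒≤ len) i j) (*-monoˡ-≤ _ (<⇒≤ len)))
    (form≤ π (suc b) L (<⇒≤ len) i j)

  classCoef : Pattern → ℕ → ℕ → ℕ
  classCoef []            t j       = 0
  classCoef ((_ , u) ∷ π) t zero    = ind (gap (cls u) t)
  classCoef ((_ , u) ∷ π) t (suc j) = classCoef π t j

  classCoef≤1 : ∀ π t j → classCoef π t j ≤ 1
  classCoef≤1 []            t j       = z≤n
  classCoef≤1 ((_ , u) ∷ π) t zero    = ind≤1 (gap (cls u) t)
  classCoef≤1 ((_ , u) ∷ π) t (suc j) = classCoef≤1 π t j

  count-replicate : ∀ t u m → count t (replicate m u) ≡ ind (gap (cls u) t) * m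
  count-replicate t u zero    = sym (*-zeroʳ (ind (gap (cls u) t)))
  count-replicate t u (suc m) = trans (cong (ind (gap (cls u) t) +_) (count-replicate t u m))
      (sym (*-suc (ind (gap (cls u) t)) m))

  count-spread : ∀ t n π b z → length π ≤ n →
    count t (spread π b z) ≡ ∑ n (λ j → classCoef π t j * z (b + j))
  count-spread t n       []            b z len = sym (∑-zero n)
  count-spread t (suc n) ((_ , u) ∷ π) b z (s≤s len) = trans (count-++ t (replicate (z b) u) _)
    (trans (cong₂ _+_
        (trans (count-replicate t u (z b)) (cong (λ k → ind (gap (cls u) t) * z k) (sym (+-identityʳ b))))
        (trans (count-spread t n π (suc b) z len)
            (∑-cong n λ j _ → cong (λ k → classCoef π t j * z k) (sym (+-suc b j)))))
      (sym (∑-head n (λ j → classCoef ((_ , u) ∷ π) t j * z (b + j)))))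

  isCover : Pattern → ℕ → Bool
  isCover []            j       = false
  isCover ((f , _) ∷ π) zero    = f
  isCover ((f , _) ∷ π) (suc j) = isCover π j

∑ᶻ-head : ∀ n f → ∑ᶻ (suc n) f ≡ f 0 +ᶻ ∑ᶻ n (λ i → f (suc i))
∑ᶻ-head zero    f = refl
∑ᶻ-head (suc n) f = trans (cong (f (suc n) +ᶻ_) (∑ᶻ-head n f)) (swap (f (suc n)) (f 0) _)
  where
  swap : ∀ a b c → a +ᶻ (b +ᶻ c) ≡ b +ᶻ (a +ᶻ c)
  swap a b c = trans (sym (ℤₚ.+-assoc a b c)) (trans (cong (_+ᶻ c) (ℤₚ.+-comm a b)) (ℤₚ.+-assoc b a c))

∑ᶻ-drop : ∀ d m f → (∀ i → i < d → f i ≡ 0ℤ) → ∑ᶻ (d + m) f ≡ ∑ᶻ m (λ j → f (d + j))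
∑ᶻ-drop zero    m f h = refl
∑ᶻ-drop (suc d) m f h = trans (∑ᶻ-head (d + m) f)
  (trans (cong (_+ᶻ ∑ᶻ (d + m) (λ i → f (suc i))) (h 0 (s≤s z≤n)))
      (trans (ℤₚ.+-identityˡ _) (∑ᶻ-drop d m (λ i → f (suc i)) λ i i<d → h (suc i) (s≤s i<d))))

-- Elimination takes one round per block of the pattern at hand; this passes to the bound for the
-- maximal number of blocks, which depends on k only.
bounds-inflate : ∀ N β {f f′} → 1 ≤ N → f ≤ f′ → bounds N β f ≤ bounds N β f′
bounds-inflate N β {f} {f′} 1≤N f≤f′ with m≤n⇒m<n∨m≡n f≤f′
... | inj₂ refl = ≤-refl
bounds-inflate N β {f} {suc f′} 1≤N _ | inj₁ (s≤s f≤f′) =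
  ≤-trans (bounds-inflate N β 1≤N f≤f′) (inflate (bounds N β f′))
  where
  inflate : ∀ B → B ≤ nextBound N β B
  inflate zero    = z≤n
  inflate (suc B) = ≤-trans (≤-trans (≤-reflexive (sym (*-identityʳ (suc B))))
    (*-monoʳ-≤ (suc B) (*-mono-≤ 1≤N (*-mono-≤ 1≤row (s≤s (z≤n {B}))))))
        (m≤n+m _ (N * (rowBound N β (suc B) * suc B) * suc B))
    where
    1≤row : 1 ≤ rowBound N β (suc B)
    1≤row = ≤-trans (s≤s z≤n) (≤-trans (m≤n+m (1 + suc B) β) (≤-trans (m≤m+n _ _) (m≤m+n _ _)))

-- The product bounds the coefficients of the quadratic form; the 2 takes care of the constraints,
-- whose entries are differences of two numbers at most 1.
formBound : ℕ → ℕ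
formBound L = L * (L * (L + L + 1 + 1)) + 2

coefBound : ℕ → ℕ → ℕ
coefBound K L = bounds (L + suc K) (formBound L) L

-- Optimal multiplicities as linear forms in the class sizes

module Structure (Γ : ClassedGraph) where

  open ClassedGraph Γ
  open Words Γ
  open Patterns Γ

  patternOf : List Block → Pattern
  patternOf []                 = []
  patternOf ((f , u , _) ∷ bs) = (f , u) ∷ patternOf bs

  patternOf-length : ∀ bs → length (patternOf bs) ≡ length bs
  patternOf-length []       = refl
  patternOf-length (b ∷ bs) = cong suc (patternOf-length bs)

  -- the multiplicities, then 1, then the numbers of letters of each class
  point₀ : List Block → (ℕ → ℕ) → ℕ → ℕ
  point₀ []                 p zero    = 1
  point₀ []                 p (suc t) = p t
  point₀ ((_ , _ , m) ∷ bs) p zero    = m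
  point₀ (_ ∷ bs)           p (suc i) = point₀ bs p i

  point₀-one : ∀ bs p → point₀ bs p (length (patternOf bs)) ≡ 1
  point₀-one []       p = refl
  point₀-one (_ ∷ bs) p = point₀-one bs p

  point₀-param : ∀ bs p t → point₀ bs p (suc (length (patternOf bs) + t)) ≡ p t
  point₀-param []       p t = refl
  point₀-param (_ ∷ bs) p t = point₀-param bs p t

  expand-spread : ∀ bs p b z → (∀ j → z (b + j) ≡ point₀ bs p j) → expand bs ≡ spread (patternOf bs) b z
  expand-spread []                 p b z h = refl
  expand-spread ((_ , u , m) ∷ bs) p b z h = cong₂ _++_
    (cong (λ k → replicate k u) (trans (sym (h 0)) (cong z (+-identityʳ b))))
    (expand-spread bs p (suc b) z λ j → trans (cong z (sym (+-suc b j))) (h (suc j)))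

  valid-fits : ∀ bs p b z → (∀ j → z (b + j) ≡ point₀ bs p j) → All Valid bs → Fits (patternOf bs) b z
  valid-fits []                     p b z h [] = tt
  valid-fits ((true  , u , m) ∷ bs) p b z h (v ∷ vs) =
    trans (cong z (sym (+-identityʳ b))) (trans (h 0) v) ,
    valid-fits bs p (suc b) z (λ j → trans (cong z (sym (+-suc b j))) (h (suc j))) vs
  valid-fits ((false , u , m) ∷ bs) p b z h (v ∷ vs) =
    v , valid-fits bs p (suc b) z (λ j → trans (cong z (sym (+-suc b j))) (h (suc j))) vs

  fits-cover : ∀ π b z → Fits π b z → ∀ j → isCover π j ≡ true → z (b + j) ≡ 1
  fits-cover ((true  , u) ∷ π) b z (e , f) zero    c = trans (cong z (+-identityʳ b)) e
  fits-cover ((true  , u) ∷ π) b z (e , f) (suc j) c =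
      trans (cong z (+-suc b j)) (fits-cover π (suc b) z f j c)
  fits-cover ((false , u) ∷ π) b z (e , f) (suc j) c =
      trans (cong z (+-suc b j)) (fits-cover π (suc b) z f j c)

  fits-change : ∀ π b z z′ → Fits π b z → (∀ j → j < length π → isCover π j ≡ true → z′ (b + j) ≡ 1) →
      Fits π b z′
  fits-change []                b z z′ f       h = tt
  fits-change ((true  , u) ∷ π) b z z′ (_ , f) h =
      trans (cong z′ (sym (+-identityʳ b))) (h 0 (s≤s z≤n) refl) ,
    fits-change π (suc b) z z′ f λ j j< c → trans (cong z′ (sym (+-suc b j))) (h (suc j) (s≤s j<) c)
  fits-change ((false , u) ∷ π) b z z′ (e , f) h =
    e , fits-change π (suc b) z z′ f λ j j< c → trans (cong z′ (sym (+-suc b j))) (h (suc j) (s≤s j<) c)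

  record Structured (K L : ℕ) (l : List X) : Set where
    field
      π       : Pattern
      x       : ℕ → ℕ
      length≤ : length π ≤ L
      cost≤   : wcost (spread π 0 x) ≤ wcost l
      counts  : ∀ t → t < K → count t (spread π 0 x) ≡ count t l
      den     : ℕ
      den>0   : 1 ≤ den
      den≤    : den ≤ coefBound K L
      coef    : ℕ → ℕ → ℤ
      coef≤   : ∀ b t → ∣ coef b t ∣ ≤ coefBound K L
      solved  : ∀ b → b < length π →
                ⁺ (den * x b) ≡ coef b 0 +ᶻ ∑ᶻ K (λ t → coef b (suc t) *ᶻ ⁺ count t l)

  module Optimise (K L : ℕ) (l : List X) (bs : List Block) (valid : All Valid bs)
                  (bs-cost : wcost (expand bs) ≤ wcost l) (bs-counts : ∀ t → count t (expand bs) ≡ count t l)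
                  (bs-length : length bs ≤ L) where

    π : Pattern
    π = patternOf bs

    d n : ℕ
    d = length π
    n = d + suc K

    d≤L : d ≤ L
    d≤L = ≤-trans (≤-reflexive (patternOf-length bs)) bs-length

    d<n : d < n
    d<n = m<m+n d (s≤s z≤n)

    p : ℕ → ℕ
    p t = count t l

    x₀ : ℕ → ℕ
    x₀ = point₀ bs p

    param : ℕ → ℕ
    param t = suc (d + t)

    param<n : ∀ t → t < K → param t < n
    param<n t t<K = ≤-trans (≤-reflexive (sym (cong suc (+-suc d t))))
        (≤-trans (≤-reflexive (sym (+-suc d (suc t)))) (+-monoʳ-≤ d (s≤s t<K)))

    -- The first kind preserves the number of letters of each class. The second ties the
    -- multiplicity of a cover block to the constant 1, without which the quadratic form need not
    -- equal the cost; for other blocks it is the trivial equation, so that blocks can index the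
    -- rows.
    classRow coverRow : ℕ → ℕ → ℤ
    classRow t = (λ j → ⁺ classCoef π t j) +ᵛ scale -1ℤ (δ (param t))
    coverRow b = if isCover π b then δ b +ᵛ scale -1ℤ (δ d) else (λ _ → 0ℤ)

    A : ℕ → ℕ → ℤ
    A r with r <? K
    ... | yes _ = classRow r
    ... | no  _ = coverRow (r ∸ K)

    P : Program
    P = record { n = n ; d = d ; c = K + d ; Q = form π 0 ; A = A ; one = d ; d≤one = ≤-refl ; one<n = d<n }

    Q≤ : ∀ i j → form π 0 i j ≤ formBound L
    Q≤ i j = ≤-trans (form≤ π 0 L d≤L i j) (≤-trans (*-monoˡ-≤ _ d≤L) (m≤m+n _ 2))

    minus-δ≤ : ∀ f k → (∀ j → ∣ f j ∣ ≤ 1) → ∀ j → ∣ (f +ᵛ scale -1ℤ (δ k)) j ∣ ≤ formBound L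
    minus-δ≤ f k f≤1 j = ≤-trans
      (abs-+-≤ {f j} { -1ℤ *ᶻ δ k j} (f≤1 j) (abs-*-≤ { -1ℤ} {δ k j} ≤-refl (∣δ∣≤1 k j))) (m≤n+m 2 _)

    A≤ : ∀ r j → ∣ A r j ∣ ≤ formBound L
    A≤ r j with r <? K
    ... | yes _ = minus-δ≤ (λ j → ⁺ classCoef π r j) (param r) (classCoef≤1 π r) j
    ... | no  _ with isCover π (r ∸ K)
    ...   | true  = minus-δ≤ (δ (r ∸ K)) d (∣δ∣≤1 (r ∸ K)) j
    ...   | false = z≤n

    open Solve P (L + suc K) (formBound L) (+-monoˡ-≤ (suc K) d≤L) Q≤ A≤
    open Form n (form π 0)

    minus-δ-value : ∀ f k z → k < n → dot n (f +ᵛ scale -1ℤ (δ k)) z ≡ dot n f z -ᶻ z k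
    minus-δ-value f k z k<n = trans (dot-+ˡ n f (δ k) -1ℤ z)
      (cong (dot n f z +ᶻ_) (trans (ℤₚ.-1*i≡-i _) (cong -_ (dot-δ n k z k<n))))

    z₀ : ℕ → ℤ
    z₀ i = ⁺ x₀ i

    x₀-fits : Fits π 0 x₀
    x₀-fits = valid-fits bs p 0 x₀ (λ _ → refl) valid

    x₀-spread : spread π 0 x₀ ≡ expand bs
    x₀-spread = sym (expand-spread bs p 0 x₀ (λ _ → refl))

    class-value : ∀ t x → dot n (λ j → ⁺ classCoef π t j) (λ j → ⁺ x j) ≡ ⁺ count t (spread π 0 x)
    class-value t x = trans (dot-pos n (classCoef π t) x) (cong ⁺_ (sym (count-spread t n π 0 x (<⇒≤ d<n))))

    z₀-feasible : Feasible z₀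
    z₀-feasible = feasible (λ _ _ → +≤+ z≤n) rows₀ (cong ⁺_ (point₀-one bs p))
      where
      rows₀ : ∀ r → r < K + d → dot n (A r) z₀ ≡ 0ℤ
      rows₀ r r< with r <? K
      ... | yes r<K = trans (minus-δ-value (λ j → ⁺ classCoef π r j) (param r) z₀ (param<n r r<K)) (trans
        (cong₂ _-ᶻ_ (trans (class-value r x₀) (cong ⁺_ (trans (cong (count r) x₀-spread) (bs-counts r))))
            (cong ⁺_ (point₀-param bs p r)))
        (ℤₚ.+-inverseʳ (⁺ count r l)))
      ... | no r≮K with isCover π (r ∸ K) in eq
      ...   | false = ∑ᶻ-zero n λ _ _ → refl
      ...   | true  = trans (minus-δ-value (δ b) d z₀ d<n) (trans
        (cong₂ _-ᶻ_ (trans (dot-δ n b z₀ (<-trans b<d d<n)) (cong ⁺_ (fits-cover π 0 x₀ x₀-fits b eq)))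
            (cong ⁺_ (point₀-one bs p)))
        refl)
        where
        b : ℕ
        b = r ∸ K
        b<d : b < d
        b<d = +-cancelˡ-< K b d (subst (_< K + d) (sym (m+[n∸m]≡n (≮⇒≥ r≮K))) r<)

    open Solution

    best : Solution d z₀
    best = solve d ≤-refl z₀ z₀-feasible

    x : ℕ → ℕ
    x i = ∣ point best i ∣

    point≡ : ∀ i → i < n → point best i ≡ ⁺ x i
    point≡ i i<n = sym (ℤₚ.0≤i⇒+∣i∣≡i (nonneg (feas best) i i<n))

    dot-point : ∀ r → dot n r (point best) ≡ dot n r (λ i → ⁺ x i)
    dot-point r = ∑ᶻ-cong n λ i i<n → cong (r i *ᶻ_) (point≡ i i<n)

    x-fits : Fits π 0 x
    x-fits = fits-change π 0 x₀ x x₀-fits cover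
      where
      cover : ∀ j → j < d → isCover π j ≡ true → x j ≡ 1
      cover j j<d eq with A (K + j) | rows (feas best) (K + j) (+-monoʳ-< K j<d) | A-cover
        where
        A-cover : A (K + j) ≡ δ j +ᵛ scale -1ℤ (δ d)
        A-cover with K + j <? K
        ... | yes lt = contradiction lt (≤⇒≯ (m≤m+n K j))
        ... | no  _ rewrite m+n∸m≡n K j | eq = refl
      ... | _ | row≡0 | refl = cong ∣_∣ (trans
        (ℤₚ.i-j≡0⇒i≡j (point best j) (point best d)
            (trans (cong (_-ᶻ point best d) (sym (dot-δ n j (point best) (<-trans j<d d<n))))
                (trans (sym (minus-δ-value (δ j) d (point best) d<n)) row≡0)))
        (unit (feas best)))

    x-counts : ∀ t → t < K → count t (spread π 0 x) ≡ count t l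
    x-counts t t<K with A t | rows (feas best) t (<-≤-trans t<K (m≤m+n K d)) | A-class
      where
      A-class : A t ≡ classRow t
      A-class with t <? K
      ... | yes _ = refl
      ... | no t≮K = contradiction t<K t≮K
    ... | _ | row≡0 | refl = ℤₚ.+-injective
        (trans (sym (class-value t x)) (trans (sym (dot-point (λ j → ⁺ classCoef π t j))) (trans
      (ℤₚ.i-j≡0⇒i≡j _ _ (trans (sym
          (minus-δ-value (λ j → ⁺ classCoef π t j) (param t) (point best) (param<n t t<K))) row≡0))
      (trans (same best (param t) (m≤n⇒m≤1+n (m≤m+n d t))) (cong ⁺_ (point₀-param bs p t))))))

    quad-cost : ∀ x → Fits π 0 x → quad (λ i → ⁺ x i) ≡ ⁺ (2 * wcost (spread π 0 x))
    quad-cost x fits = trans (quad-pos n (form π 0) x)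
      (cong ⁺_ (trans (form-value n π 0 x (<⇒≤ d<n) fits) (sym (cost-spread π 0 x))))

    x-cost : wcost (spread π 0 x) ≤ wcost l
    x-cost = ≤-trans (*-cancelˡ-≤ 2 (ℤₚ.drop‿+≤+ (subst₂ _≤ᶻ_
        (trans quad-point (quad-cost x x-fits)) (quad-cost x₀ x₀-fits) (below best))))
      (≤-trans (≤-reflexive (cong wcost x₀-spread)) bs-cost)
      where
      quad-point : quad (point best) ≡ quad (λ i → ⁺ x i)
      quad-point = ∑ᶻ-cong n λ i i<n → cong₂ _*ᶻ_ (point≡ i i<n) (dot-point (λ j → ⁺ form π 0 i j))

    structured : Structured K L l
    structured = record
      { π = π ; x = x ; length≤ = d≤L ; cost≤ = x-cost ; counts = x-counts
      ; den = ∣ D (system best) ∣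
      ; den>0 = abs-mono-< (+≤+ z≤n) (D>0 (system best))
      ; den≤ = ≤-trans (D≤B (system best)) W≤
      ; coef = λ b t → M (system best) b (d + t)
      ; coef≤ = λ b t → ≤-trans (M≤B (system best) b (d + t)) W≤
      ; solved = eqn
      }
      where
      W≤ : bounds (L + suc K) (formBound L) d ≤ coefBound K L
      W≤ = bounds-inflate _ _ (≤-trans (s≤s z≤n) (m≤n+m (suc K) L)) d≤L
      eqn : ∀ b → b < d → ⁺ (∣ D (system best) ∣ * x b) ≡
            M (system best) b (d + 0) +ᶻ ∑ᶻ K (λ t → M (system best) b (d + suc t) *ᶻ ⁺ count t l)
      eqn b b<d = begin
        ⁺ (∣ D (system best) ∣ * x b)             ≡⟨ ℤₚ.pos-* ∣ D (system best) ∣ (x b) ⟩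
        ⁺ ∣ D (system best) ∣ *ᶻ ⁺ x b
          ≡⟨ cong₂ _*ᶻ_ (ℤₚ.0≤i⇒+∣i∣≡i (ℤₚ.<⇒≤ (D>0 (system best)))) (sym (point≡ b (<-trans b<d d<n))) ⟩
        D (system best) *ᶻ point best b           ≡⟨ sat best b (<-trans b<d d<n) ⟩
        dot n (M (system best) b) (point best)
          -- After `d` rounds the columns of all unknowns vanish; only the constant 1 and the class
          -- sizes are left on the right.
          ≡⟨ ∑ᶻ-drop d (suc K) _ (λ i i<d → trans (cong (_*ᶻ point best i) (cols (system best) b i i<d))
               (ℤₚ.*-zeroˡ (point best i))) ⟩
        ∑ᶻ (suc K) (λ t → M (system best) b (d + t) *ᶻ point best (d + t))
          ≡⟨ ∑ᶻ-head K (λ t → M (system best) b (d + t) *ᶻ point best (d + t)) ⟩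
        M (system best) b (d + 0) *ᶻ point best (d + 0) +ᶻ ∑ᶻ K
            (λ t → M (system best) b (d + suc t) *ᶻ point best (d + suc t))
          ≡⟨ cong₂ _+ᶻ_ (trans (cong (M (system best) b (d + 0) *ᶻ_)
               (trans (cong (point best) (+-identityʳ d)) (unit (feas best))))
                   (ℤₚ.*-identityʳ (M (system best) b (d + 0))))
               (∑ᶻ-cong K λ t _ → cong (M (system best) b (d + suc t) *ᶻ_)
                 (trans (same best (d + suc t) (m≤m+n d (suc t)))
                     (cong ⁺_ (trans (cong x₀ (+-suc d t)) (point₀-param bs p t))))) ⟩
        M (system best) b (d + 0) +ᶻ ∑ᶻ K (λ t → M (system best) b (d + suc t) *ᶻ ⁺ count t l) ∎
        where open ≡-Reasoning

  structure : ∀ K L (reps : List X) → All Free reps → (∀ u → Free u → Any (λ r → cls r ≡ cls u) reps) →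
              ∀ l → covers l * suc (length reps) + length reps ≤ L → Structured K L l
  structure K L reps reps-free rep l len with blockify reps reps-free rep [] [] l []
  ... | blocked bs valid cost≤ counts length≤ =
    Optimise.structured K L l bs valid cost≤ counts (≤-trans length≤ len)

-- Reading a code

n<m^n : ∀ m n → 2 ≤ m → n < m ^ n
n<m^n m zero    2≤m = s≤s z≤n
n<m^n m (suc n) 2≤m = begin-strict
  suc n          ≡⟨ +-comm 1 n ⟩
  n + 1          <⟨ +-mono-<-≤ (n<m^n m n 2≤m) (≤-trans (s≤s z≤n) (n<m^n m n 2≤m)) ⟩
  m ^ n + m ^ n  ≡⟨ cong (m ^ n +_) (+-identityʳ (m ^ n)) ⟨
  2 * m ^ n      ≤⟨ *-monoˡ-≤ (m ^ n) 2≤m ⟩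
  m * m ^ n      ∎
  where open ≤-Reasoning

module Digits (Y V : ℕ) where

  -- c stands for a Y × Y table, read off from its digits in base Y.
  quo : ℕ → ℕ
  quo c = μ V λ q → suc c ∸ ∑ Y (λ _ → suc q)

  -- Division by `Y`, iterated `i` times inside a loop of fixed length `V`: from round `i` on the
  -- value is kept.
  shift : ℕ → ℕ → ℕ
  shift c i = natrec V c λ j x → ifz (suc j ∸ i) (quo x) x

  digit : ℕ → ℕ → ℕ
  digit c i = shift c i ∸ ∑ Y (λ _ → quo (shift c i))

  entry : ℕ → ℕ → ℕ → ℕ
  entry c b j = digit c (∑ Y (λ _ → b) + j)

module Decoding (Y V : ℕ) (2≤Y : 2 ≤ Y) (V≡ : V ≡ Y ^ (Y * Y)) where

  open Digits Y V

  encode : ℕ → (ℕ → ℕ) → ℕ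
  encode zero    f = 0
  encode (suc l) f = f 0 + Y * encode l (λ i → f (suc i))

  encode-cong : ∀ l {f g} → (∀ i → f i ≡ g i) → encode l f ≡ encode l g
  encode-cong zero    h = refl
  encode-cong (suc l) h = cong₂ (λ x y → x + Y * y) (h 0) (encode-cong l λ i → h (suc i))

  encode< : ∀ l f → (∀ i → f i < Y) → encode l f < Y ^ l
  encode< zero    f f<Y = s≤s z≤n
  encode< (suc l) f f<Y = begin-strict
    f 0 + Y * c        <⟨ +-monoˡ-< (Y * c) (f<Y 0) ⟩
    Y + Y * c          ≡⟨ *-suc Y c ⟨
    Y * suc c          ≤⟨ *-monoʳ-≤ Y (encode< l _ λ i → f<Y (suc i)) ⟩
    Y * Y ^ l          ∎
    where
    open ≤-Reasoning
    c : ℕ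
    c = encode l (λ i → f (suc i))

  quo-spec : ∀ x c → x < Y → x + Y * c < V → quo (x + Y * c) ≡ c
  quo-spec x c x<Y <V = μ-unique V _ c
    (<⇒≤ (≤-<-trans (≤-trans (m≤n*m c Y {{>-nonZero (≤-trans (s≤s z≤n) 2≤Y)}}) (m≤n+m (Y * c) x)) <V))
    (λ _ → m≤n⇒m∸n≡0 (begin
      suc x + Y * c         ≤⟨ +-monoˡ-≤ (Y * c) x<Y ⟩
      Y + Y * c             ≡⟨ *-suc Y c ⟨
      Y * suc c             ≡⟨ ∑-const Y (suc c) ⟨
      ∑ Y (λ _ → suc c)     ∎))
    (λ j j<c eq → <-irrefl refl (begin-strict
      x + Y * c             <⟨ m∸n≡0⇒m≤n eq ⟩
      ∑ Y (λ _ → suc j)     ≡⟨ ∑-const Y (suc j) ⟩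
      Y * suc j             ≤⟨ *-monoʳ-≤ Y j<c ⟩
      Y * c                 ≤⟨ m≤n+m (Y * c) x ⟩
      x + Y * c             ∎))
    where open ≤-Reasoning

  quos : ℕ → ℕ → ℕ
  quos zero    c = c
  quos (suc i) c = quo (quos i c)

  shift-low : ∀ c i m → m ≤ i → natrec m c (λ j x → ifz (suc j ∸ i) (quo x) x) ≡ quos m c
  shift-low c i zero    _   = refl
  shift-low c i (suc m) m<i rewrite m≤n⇒m∸n≡0 m<i = cong quo (shift-low c i m (<⇒≤ m<i))

  shift-high : ∀ c i m → i ≤ m → natrec m c (λ j x → ifz (suc j ∸ i) (quo x) x) ≡ quos i c
  shift-high c i m i≤m with m≤n⇒m<n∨m≡n i≤m
  ... | inj₂ refl = shift-low c i i ≤-refl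
  shift-high c i (suc m) _ | inj₁ (s≤s i≤m) with suc m ∸ i | m<n⇒0<n∸m (s≤s i≤m)
  ... | suc _ | _ = shift-high c i m i≤m

  quos-encode : ∀ i l f → (∀ i → f i < Y) → Y ^ (i + l) ≤ V →
      quos i (encode (i + l) f) ≡ encode l (λ j → f (i + j))
  quos-encode zero    l f f<Y ≤V = refl
  quos-encode (suc i) l f f<Y ≤V = begin
    quo (quos i (encode (suc i + l) f))
      ≡⟨ cong (λ k → quo (quos i (encode k f))) (sym (+-suc i l)) ⟩
    quo (quos i (encode (i + suc l) f))
      ≡⟨ cong quo (quos-encode i (suc l) f f<Y (subst (λ k → Y ^ k ≤ V) (sym (+-suc i l)) ≤V)) ⟩
    quo (encode (suc l) (λ j → f (i + j)))
      ≡⟨ quo-spec (f (i + 0)) (encode l (λ j → f (i + suc j))) (f<Y (i + 0))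
              (<-≤-trans (encode< (suc l) (λ j → f (i + j)) (λ j → f<Y (i + j)))
              (≤-trans (^-monoʳ-≤ Y {{>-nonZero (≤-trans (s≤s z≤n) 2≤Y)}} (s≤s (m≤n+m l i))) ≤V)) ⟩
    encode l (λ j → f (i + suc j))                   ≡⟨ encode-cong l (λ j → cong f (+-suc i j)) ⟩
    encode l (λ j → f (suc i + j))                   ∎
    where open ≡-Reasoning

  digit-encode : ∀ i l f → (∀ i → f i < Y) → i + suc l ≡ Y * Y → digit (encode (Y * Y) f) i ≡ f i
  digit-encode i l f f<Y eq = begin
    shift c i ∸ ∑ Y (λ _ → quo (shift c i))  ≡⟨ cong (shift c i ∸_) (∑-const Y (quo (shift c i))) ⟩
    shift c i ∸ Y * quo (shift c i)
      ≡⟨ cong₂ (λ x q → x ∸ Y * q) shift≡ (trans (cong quo shift≡) quo≡) ⟩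
    f (i + 0) + Y * r ∸ Y * r                ≡⟨ m+n∸n≡m (f (i + 0)) (Y * r) ⟩
    f (i + 0)                                ≡⟨ cong f (+-identityʳ i) ⟩
    f i                                      ∎
    where
    open ≡-Reasoning
    c r : ℕ
    c = encode (Y * Y) f
    r = encode l (λ j → f (i + suc j))
    i<YY : i < Y * Y
    i<YY = subst (i <_) eq (m<m+n i (s≤s z≤n))
    i≤V : i ≤ V
    i≤V = ≤-trans (<⇒≤ (<-trans i<YY (n<m^n Y (Y * Y) 2≤Y))) (≤-reflexive (sym V≡))
    Y^≤V : Y ^ (i + suc l) ≤ V
    Y^≤V = ≤-reflexive (trans (cong (Y ^_) eq) (sym V≡))
    shift≡ : shift c i ≡ encode (suc l) (λ j → f (i + j))
    shift≡ = trans (shift-high c i V i≤V)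
        (trans (cong (λ k → quos i (encode k f)) (sym eq)) (quos-encode i (suc l) f f<Y Y^≤V))
    quo≡ : quo (encode (suc l) (λ j → f (i + j))) ≡ r
    quo≡ = quo-spec (f (i + 0)) r (f<Y (i + 0))
        (<-≤-trans (encode< (suc l) (λ j → f (i + j)) (λ j → f<Y (i + j)))
      (≤-trans (^-monoʳ-≤ Y {{>-nonZero (≤-trans (s≤s z≤n) 2≤Y)}} (m≤n+m (suc l) i)) Y^≤V))

  decode : (d : ℕ → ℕ → ℕ) → (∀ b j → d b j < Y) →
           Σ ℕ λ c → c < V × (∀ b j → b < Y → j < Y → entry c b j ≡ d b j)
  decode d d<Y = encode (Y * Y) f , subst (encode (Y * Y) f <_) (sym V≡)
      (encode< (Y * Y) f f<Y) , λ b j b<Y j<Y →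
    let i<YY : b * Y + j < Y * Y
        i<YY = <-≤-trans (+-monoʳ-< (b * Y) j<Y) (≤-trans (≤-reflexive (+-comm (b * Y) Y)) (*-monoˡ-≤ Y b<Y))
        (l , eq) = m≤n⇒∃[o]m+o≡n i<YY
    in begin
    digit c (∑ Y (λ _ → b) + j)  ≡⟨ cong (λ k → digit c (k + j)) (trans (∑-const Y b) (*-comm Y b)) ⟩
    digit c (b * Y + j)          ≡⟨ digit-encode (b * Y + j) l f f<Y (trans (+-suc (b * Y + j) l) eq) ⟩
    f (b * Y + j)                ≡⟨ cong₂ d (quotient b j j<Y) (remainder b j j<Y) ⟩
    d b j                        ∎
    where
    open ≡-Reasoning
    instance
      Y≢0 : NonZero Y
      Y≢0 = >-nonZero (≤-trans (s≤s z≤n) 2≤Y)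
    f : ℕ → ℕ
    f i = d (i / Y) (i % Y)
    f<Y : ∀ i → f i < Y
    f<Y i = d<Y (i / Y) (i % Y)
    c : ℕ
    c = encode (Y * Y) f
    remainder : ∀ b j → j < Y → (b * Y + j) % Y ≡ j
    remainder b j j<Y = trans (cong (_% Y) (+-comm (b * Y) j)) (trans ([m+kn]%n≡m%n j b Y) (m<n⇒m%n≡m j<Y))
    quotient : ∀ b j → j < Y → (b * Y + j) / Y ≡ b
    quotient b j j<Y = *-cancelʳ-≡ _ b Y (+-cancelˡ-≡ j _ _ (trans
      (cong (_+ (b * Y + j) / Y * Y) (sym (remainder b j j<Y)))
      (trans (sym (m≡m%n+[m/n]*n (b * Y + j) Y)) (+-comm (b * Y) j))))

-- Twin classes and the placement of vertices

∑-at-most-one : ∀ n f → (∀ i → f i ≤ 1) → (∀ i j → i < n → j < n → f i ≢ 0 → f j ≢ 0 → i ≡ j) → ∑ n f ≤ 1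
∑-at-most-one zero    f f≤1 uniq = z≤n
∑-at-most-one (suc n) f f≤1 uniq with f n ≟ 0
... | yes fn≡0 rewrite fn≡0 = ∑-at-most-one n f f≤1 λ i j i<n j<n → uniq i j (m<n⇒m<1+n i<n) (m<n⇒m<1+n j<n)
... | no fn≢0 = ≤-trans (≤-reflexive (trans (cong (f n +_) (≡0⇒∑≡0 n f others)) (+-identityʳ (f n)))) (f≤1 n)
  where
  others : ∀ i → i < n → f i ≡ 0
  others i i<n with f i ≟ 0
  ... | yes fi≡0 = fi≡0
  ... | no fi≢0 = contradiction (uniq i n (m<n⇒m<1+n i<n) ≤-refl fi≢0 fn≢0) (<⇒≢ i<n)

∑-by-class : ∀ n K (κ f : ℕ → ℕ) → (∀ i → i < n → κ i < K) →
    ∑ n f ≡ ∑ K (λ t → ∑ n λ i → ind (gap (κ i) t) * f i)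
∑-by-class n K κ f κ<K = trans
  (∑-cong n λ i i<n → sym (trans
    (∑-single K _ (κ i) (κ<K i i<n) λ t _ t≢ → cong (_* f i) (ind-gap-≢ (≢-sym t≢)))
    (trans (cong (_* f i) (ind-gap-≡ {κ i} refl)) (*-identityˡ (f i)))))
  (∑-swap n K _)

-- The pigeonhole principle: `f` is the indicator of a set on which `κ` is injective, so each fibre
-- of `κ` contributes at most 1.
∑-injective-≤ : ∀ n K (κ f : ℕ → ℕ) → (∀ i → f i ≤ 1) → (∀ i → i < n → κ i < K) →
                (∀ i j → i < n → j < n → f i ≢ 0 → f j ≢ 0 → κ i ≡ κ j → i ≡ j) → ∑ n f ≤ K
∑-injective-≤ n K κ f f≤1 κ<K inj = begin
  ∑ n f                                              ≡⟨ ∑-by-class n K κ f κ<K ⟩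
  ∑ K (λ t → ∑ n λ i → ind (gap (κ i) t) * f i)      ≤⟨ ∑-bound K (λ t _ → ∑-at-most-one n _
              (λ i → *-mono-≤ (ind≤1 (gap (κ i) t)) (f≤1 i)) (unique t)) ⟩
  K * 1                                              ≡⟨ *-identityʳ K ⟩
  K                                                  ∎
  where
  open ≤-Reasoning
  ind≢0 : ∀ a b x → ind (gap a b) * x ≢ 0 → a ≡ b × x ≢ 0
  ind≢0 a b x ≢0 with a ≟ b
  ... | yes a≡b = a≡b , λ x≡0 → ≢0 (trans (cong (ind (gap a b) *_) x≡0) (*-zeroʳ (ind (gap a b))))
  ... | no a≢b  = contradiction (cong (_* x) (ind-gap-≢ a≢b)) ≢0
  unique : ∀ t i j → i < n → j < n → ind (gap (κ i) t) * f i ≢ 0 → ind (gap (κ j) t) * f j ≢ 0 → i ≡ j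
  unique t i j i<n j<n p q with ind≢0 (κ i) t (f i) p | ind≢0 (κ j) t (f j) q
  ... | κi≡t , fi≢0 | κj≡t , fj≢0 = inj i j i<n j<n fi≢0 fj≢0 (trans κi≡t (sym κj≡t))

∑-find : ∀ n (f : ℕ → ℕ) t r → r < ∑ n (λ q → ind (gap (f q) t)) →
         Σ ℕ λ p → p < n × f p ≡ t × ∑ p (λ q → ind (gap (f q) t)) ≡ r
∑-find (suc n) f t r r< with r <? ∑ n (λ q → ind (gap (f q) t))
... | yes lt with ∑-find n f t r lt
...   | p , p<n , fp≡t , eq = p , m<n⇒m<1+n p<n , fp≡t , eq
∑-find (suc n) f t r r< | no ≮ with f n ≟ t
...   | no f≢t rewrite ind-gap-≢ f≢t = contradiction r< ≮
...   | yes f≡t rewrite ind-gap-≡ f≡t = n , ≤-refl , f≡t , ≤-antisym (≮⇒≥ ≮) (≤-pred r<)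

module Classes (n : ℕ) (A : ℕ → ℕ → ℕ) where

  diff : ℕ → ℕ → ℕ
  diff u v = ∑ n λ w → gap (A u w) (A v w)

  rep : ℕ → ℕ
  rep v = μ n λ u → diff u v

  isRep : ℕ → ℕ
  isRep u = ind (gap (rep u) u)

  -- Counting the representatives before that of `v` numbers the classes consecutively, so the
  -- numbers are bounded by the number of classes and not by n.
  cls : ℕ → ℕ
  cls v = psum n (rep v) isRep

  Twins : ℕ → ℕ → Set
  Twins u v = ∀ w → w < n → A u w ≡ A v w

  diff⇒twins : ∀ u v → diff u v ≡ 0 → Twins u v
  diff⇒twins u v eq w w<n = gap≡0⇒≡ (A u w) (A v w) (∑≡0⇒≡0 n _ eq w w<n)

  twins⇒diff : ∀ u v → Twins u v → diff u v ≡ 0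
  twins⇒diff u v tw = ≡0⇒∑≡0 n _ λ w w<n → trans (cong (gap (A u w)) (sym (tw w w<n))) (gap-refl (A u w))

  twins-sym : ∀ {u v} → Twins u v → Twins v u
  twins-sym tw w w<n = sym (tw w w<n)

  twins-trans : ∀ {u v w} → Twins u v → Twins v w → Twins u w
  twins-trans tw tw′ x x<n = trans (tw x x<n) (tw′ x x<n)

  rep<n : ∀ v → v < n → rep v < n
  rep<n v v<n = μ-found n _ v v<n (twins⇒diff v v λ _ _ → refl)

  rep-twins : ∀ v → v < n → Twins (rep v) v
  rep-twins v v<n = diff⇒twins (rep v) v (μ-hit n (λ u → diff u v) (rep<n v v<n))

  twins⇒rep : ∀ u v → u < n → v < n → Twins u v → rep u ≡ rep v
  twins⇒rep u v u<n v<n tw = μ-unique n _ (rep v) (<⇒≤ (rep<n v v<n))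
    (λ _ → twins⇒diff (rep v) u (twins-trans (rep-twins v v<n) (twins-sym {u} {v} tw)))
    (λ j j<rep eq → μ-least n (λ w → diff w v) j j<rep (twins⇒diff j v (twins-trans (diff⇒twins j u eq) tw)))

  isRep-rep : ∀ v → v < n → isRep (rep v) ≡ 1
  isRep-rep v v<n = ind-gap-≡ (twins⇒rep (rep v) v (rep<n v v<n) v<n (rep-twins v v<n))

  isRep≢0 : ∀ u → isRep u ≢ 0 → rep u ≡ u
  isRep≢0 u ≢0 with rep u ≟ u
  ... | yes eq = eq
  ... | no neq = contradiction (ind-gap-≢ neq) ≢0

  cls≡ : ∀ v → v < n → cls v ≡ ∑ (rep v) isRep
  cls≡ v v<n = psum≡∑ n (rep v) isRep (<⇒≤ (rep<n v v<n))

  cls-separates : ∀ u v → u < n → v < n → rep u < rep v → cls u < cls v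
  cls-separates u v u<n v<n lt = begin-strict
    cls u                        ≡⟨ cls≡ u u<n ⟩
    ∑ (rep u) isRep              <⟨ n<1+n _ ⟩
    1 + ∑ (rep u) isRep          ≡⟨ cong (_+ ∑ (rep u) isRep) (isRep-rep u u<n) ⟨
    ∑ (suc (rep u)) isRep        ≤⟨ ∑-monoˡ-≤ isRep lt ⟩
    ∑ (rep v) isRep              ≡⟨ cls≡ v v<n ⟨
    cls v                        ∎
    where open ≤-Reasoning

  cls⇒twins : ∀ u v → u < n → v < n → cls u ≡ cls v → Twins u v
  cls⇒twins u v u<n v<n eq with <-cmp (rep u) (rep v)
  ... | tri< lt _ _ = contradiction eq (<⇒≢ (cls-separates u v u<n v<n lt))
  ... | tri> _ _ gt = contradiction (sym eq) (<⇒≢ (cls-separates v u v<n u<n gt))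
  ... | tri≈ _ r≡ _ = twins-trans (twins-sym {rep u} {u} (rep-twins u u<n))
      (subst (λ r → Twins r v) (sym r≡) (rep-twins v v<n))

  -- Distinct representatives are not twins, so any labelling that separates non-twins is injective
  -- on them.
  cls-bound : ∀ K (κ : ℕ → ℕ) → (∀ u → u < n → κ u < K) → (∀ u v → u < n → v < n → κ u ≡ κ v → Twins u v) →
              ∀ v → v < n → cls v ≤ K
  cls-bound K κ κ<K κ⇒twins v v<n = begin
    cls v              ≡⟨ cls≡ v v<n ⟩
    ∑ (rep v) isRep    ≤⟨ ∑-monoˡ-≤ isRep (<⇒≤ (rep<n v v<n)) ⟩
    ∑ n isRep          ≤⟨ ∑-injective-≤ n K κ isRep (λ i → ind≤1 (gap (rep i) i)) κ<K
                            (λ i j i<n j<n p q eq → trans (sym (isRep≢0 i p))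
                                (trans (twins⇒rep i j i<n j<n (κ⇒twins i j i<n j<n eq)) (isRep≢0 j q))) ⟩
    K                  ∎
    where open ≤-Reasoning

module Placement (n : ℕ) (cls word : ℕ → ℕ) where

  rank : ℕ → ℕ
  rank v = psum n v λ u → ind (gap (cls u) (cls v))

  occ : ℕ → ℕ → ℕ
  occ t p = psum n p λ q → ind (gap (word q) t)

  -- The vertices of class t go to the positions of the letter t in order.
  pos : ℕ → ℕ
  pos v = μ n λ p → gap (word p) (cls v) + gap (occ (cls v) p) (rank v)

  -- The search `pos v` returns `n` if it fails, and then the summand is 1; hence 0 means that every
  -- vertex is placed.
  bad : ℕ
  bad = ∑ n λ v → suc (pos v) ∸ n

  rank≡ : ∀ v → v < n → rank v ≡ ∑ v (λ u → ind (gap (cls u) (cls v)))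
  rank≡ v v<n = psum≡∑ n v _ (<⇒≤ v<n)

  rank-mono : ∀ u v → v < n → u < v → cls u ≡ cls v → rank u < rank v
  rank-mono u v v<n u<v eq = begin-strict
    rank u                                      ≡⟨ rank≡ u (<-trans u<v v<n) ⟩
    ∑ u (λ w → ind (gap (cls w) (cls u)))       ≡⟨ ∑-cong u (λ w _ → cong (λ t → ind (gap (cls w) t)) eq) ⟩
    ∑ u (λ w → ind (gap (cls w) (cls v)))       <⟨ n<1+n _ ⟩
    1 + ∑ u (λ w → ind (gap (cls w) (cls v)))
      ≡⟨ cong (_+ ∑ u (λ w → ind (gap (cls w) (cls v)))) (ind-gap-≡ eq) ⟨
    ∑ (suc u) (λ w → ind (gap (cls w) (cls v))) ≤⟨ ∑-monoˡ-≤ _ u<v ⟩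
    ∑ v (λ w → ind (gap (cls w) (cls v)))       ≡⟨ rank≡ v v<n ⟨
    rank v                                      ∎
    where open ≤-Reasoning

  pos<n : bad ≡ 0 → ∀ v → v < n → pos v < n
  pos<n good v v<n = m∸n≡0⇒m≤n (∑≡0⇒≡0 n (λ v → suc (pos v) ∸ n) good v v<n)

  pos-hit : ∀ v → pos v < n → word (pos v) ≡ cls v × occ (cls v) (pos v) ≡ rank v
  pos-hit v lt = gap≡0⇒≡ _ _ (m+n≡0⇒m≡0 _ hit) , gap≡0⇒≡ _ _ (m+n≡0⇒n≡0 (gap (word (pos v)) (cls v)) hit)
    where hit = μ-hit n (λ p → gap (word p) (cls v) + gap (occ (cls v) p) (rank v)) lt

  pos-injective : bad ≡ 0 → ∀ u v → u < n → v < n → pos u ≡ pos v → u ≡ v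
  pos-injective good u v u<n v<n eq with pos-hit u (pos<n good u u<n) | pos-hit v (pos<n good v v<n)
  ... | wu , ou | wv , ov = tri (<-cmp u v)
    where
    cls≡cls : cls u ≡ cls v
    cls≡cls = trans (sym wu) (trans (cong word eq) wv)
    rank≡rank : rank u ≡ rank v
    rank≡rank = trans (sym ou) (trans (cong₂ occ cls≡cls eq) ov)
    tri : _ → u ≡ v
    tri (tri< u<v _ _) = contradiction rank≡rank (<⇒≢ (rank-mono u v v<n u<v cls≡cls))
    tri (tri≈ _ u≡v _) = u≡v
    tri (tri> _ _ v<u) = contradiction (sym rank≡rank) (<⇒≢ (rank-mono v u u<n v<u (sym cls≡cls)))

  good-intro : (∀ v → v < n →
      ∑ n (λ q → ind (gap (word q) (cls v))) ≡ ∑ n (λ u → ind (gap (cls u) (cls v)))) → bad ≡ 0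
  good-intro counts = ≡0⇒∑≡0 n _ λ v v<n → m≤n⇒m∸n≡0 (found v v<n)
    where
    found : ∀ v → v < n → pos v < n
    found v v<n with ∑-find n word (cls v) (rank v) (begin-strict
        rank v                                      ≡⟨ rank≡ v v<n ⟩
        ∑ v (λ u → ind (gap (cls u) (cls v)))       <⟨ n<1+n _ ⟩
        1 + ∑ v (λ u → ind (gap (cls u) (cls v)))
          ≡⟨ cong (_+ ∑ v (λ u → ind (gap (cls u) (cls v)))) (ind-gap-≡ {cls v} refl) ⟨
        ∑ (suc v) (λ u → ind (gap (cls u) (cls v))) ≤⟨ ∑-monoˡ-≤ _ v<n ⟩
        ∑ n (λ u → ind (gap (cls u) (cls v)))       ≡⟨ counts v v<n ⟨
        ∑ n (λ q → ind (gap (word q) (cls v)))    ∎)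
      where open ≤-Reasoning
    ... | p , p<n , w≡ , o≡ = μ-found n _ p p<n (cong₂ _+_
      (trans (cong (gap (word p)) (sym w≡)) (gap-refl (word p)))
      (trans (cong (λ o → gap o (rank v)) (trans (psum≡∑ n p _ (<⇒≤ p<n)) o≡)) (gap-refl (rank v))))


-- One round of the search for a minimum: a good candidate `c` replaces `b` if `b` is not good or
-- `c` is strictly cheaper. The search starts with 0, which may itself be bad, hence the test of
-- `b`.
select : (ℕ → ℕ) → (ℕ → ℕ) → ℕ → ℕ → ℕ
select bad value c b = ifz (bad c) (ifz (bad b) (ifz (suc (value c) ∸ value b) c b) c) b

select-best : ∀ bad value m c → c < m → bad c ≡ 0 →
  bad (natrec m 0 (select bad value)) ≡ 0 × value (natrec m 0 (select bad value)) ≤ value c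
select-best bad value (suc m) c c<1+m good = step (m≤n⇒m<n∨m≡n (≤-pred c<1+m))
  where
  b : ℕ
  b = natrec m 0 (select bad value)
  step : c < m ⊎ c ≡ m → bad (select bad value m b) ≡ 0 × value (select bad value m b) ≤ value c
  step c≤m with bad m in eqm | bad b in eqb
  step (inj₁ c<m) | zero | zero with suc (value m) ∸ value b in eqv
  ... | zero  = eqm , ≤-trans (<⇒≤ (m∸n≡0⇒m≤n eqv)) (proj₂ (select-best bad value m c c<m good))
  ... | suc _ = eqb , proj₂ (select-best bad value m c c<m good)
  step (inj₂ refl) | zero | zero with suc (value m) ∸ value b in eqv
  ... | zero  = eqm , ≤-refl
  ... | suc _ = eqb , ≮⇒≥ (λ lt → contradiction (trans (sym eqv) (m≤n⇒m∸n≡0 lt)) λ ())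
  step (inj₁ c<m)  | zero | suc _ =
      contradiction (trans (sym eqb) (proj₁ (select-best bad value m c c<m good))) λ ()
  step (inj₂ refl) | zero | suc _ = eqm , ≤-refl
  step (inj₁ c<m)  | suc _ | _ = select-best bad value m c c<m good
  step (inj₂ refl) | suc _ | _ = contradiction (trans (sym eqm) good) λ ()

-- Row b of the table e describes the b-th block of a word: its class, the
-- denominator minus one, an offset h, and the coefficients of the linear form
-- in 1 and the class sizes that gives its multiplicity, increased by h.
module Reading (n Y : ℕ) (cls : ℕ → ℕ) (e : ℕ → ℕ → ℕ) where

  -- Summing over all vertices the coefficient of their class multiplies each coefficient by its
  -- class size. As all coefficients are stored with offset h, the result is too large by h for the
  -- constant and by h for each vertex, which is what `down` amounts to.
  up : ℕ → ℕ
  up b = e b 3 + ∑ n λ v → e b (4 + cls v)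

  down : ℕ → ℕ
  down b = e b 2 + ∑ n λ _ → e b 2

  -- Division by search: the least x for which `down` plus denominator times x reaches `up`. For a
  -- table that comes from an exact equation this is the quotient.
  mult : ℕ → ℕ
  mult b = μ n λ x → up b ∸ (down b + psum n x λ _ → suc (e b 1))

  block : ℕ → ℕ
  block p = μ Y λ b → suc p ∸ psum Y (suc b) mult

  word : ℕ → ℕ
  word p = e (block p) 0

  size : ℕ → ℕ
  size t = ∑ n λ v → ind (gap (cls v) t)

  mult-correct : ∀ K b (x h : ℕ) (coef : ℕ → ℤ) → (∀ v → v < n → cls v < K) → x ≤ n →
    e b 2 ≡ h → ⁺ e b 3 ≡ ⁺ h +ᶻ coef 0 → (∀ t → t < K → ⁺ e b (4 + t) ≡ ⁺ h +ᶻ coef (suc t)) →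
    ⁺ (suc (e b 1) * x) ≡ coef 0 +ᶻ ∑ᶻ K (λ t → coef (suc t) *ᶻ ⁺ size t) →
    mult b ≡ x
  mult-correct K b x h coef cls<K x≤n e2 e3 e4 eqn = μ-unique n _ x x≤n
    (λ _ → m≤n⇒m∸n≡0 (≤-reflexive (trans up≡ (cong (down b +_) (sym (product x x≤n))))))
    (λ j j<x eq → <-irrefl refl (begin-strict
      up b                             ≤⟨ m∸n≡0⇒m≤n eq ⟩
      down b + psum n j (λ _ → den)    ≡⟨ cong (down b +_) (product j (<⇒≤ (<-≤-trans j<x x≤n))) ⟩
      down b + den * j                 <⟨ +-monoʳ-< (down b) (*-monoʳ-< den j<x) ⟩
      down b + den * x                 ≡⟨ up≡ ⟨
      up b                             ∎))
    where
    open ≤-Reasoning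
    den : ℕ
    den = suc (e b 1)
    product : ∀ j → j ≤ n → psum n j (λ _ → den) ≡ den * j
    product j j≤n = trans (psum≡∑ n j _ j≤n) (trans (∑-const j den) (*-comm j den))
    sizes : ∑ K size ≡ n
    sizes = trans (∑-cong K λ t _ → ∑-cong n λ v _ → sym (*-identityʳ (ind (gap (cls v) t))))
      (trans (sym (∑-by-class n K cls (λ _ → 1) cls<K)) (trans (∑-const n 1) (*-identityʳ n)))
    by-class : ∑ n (λ v → e b (4 + cls v)) ≡ ∑ K (λ t → e b (4 + t) * size t)
    by-class = trans (∑-by-class n K cls _ cls<K)
        (∑-cong K λ t _ → trans (∑-cong n λ v _ → same t v) (∑-*ˡ n (e b (4 + t)) _))
      where
      same : ∀ t v → ind (gap (cls v) t) * e b (4 + cls v) ≡ e b (4 + t) * ind (gap (cls v) t)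
      same t v with cls v ≟ t
      ... | yes refl = *-comm (ind (gap (cls v) t)) (e b (4 + t))
      ... | no neq rewrite ind-gap-≢ neq = sym (*-zeroʳ (e b (4 + t)))
    terms : ⁺ ∑ K (λ t → e b (4 + t) * size t) ≡ ∑ᶻ K (λ t → coef (suc t) *ᶻ ⁺ size t) +ᶻ ⁺ h *ᶻ ⁺ n
    terms = trans (sym (∑ᶻ-pos K _)) (trans
      (∑ᶻ-cong K λ t t<K → trans (ℤₚ.pos-* (e b (4 + t)) (size t))
          (trans (cong (_*ᶻ ⁺ size t) (e4 t t<K)) (expand (⁺ h) (coef (suc t)) (⁺ size t))))
      (trans (∑ᶻ-linear K _ _ (⁺ h))
          (cong (λ s → ∑ᶻ K (λ t → coef (suc t) *ᶻ ⁺ size t) +ᶻ ⁺ h *ᶻ s)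
              (trans (∑ᶻ-pos K size) (cong ⁺_ sizes)))))
      where
      expand : ∀ h c s → (h +ᶻ c) *ᶻ s ≡ c *ᶻ s +ᶻ h *ᶻ s
      expand = solveᶻ-∀
    down≡ : down b ≡ h + h * n
    down≡ = cong₂ _+_ e2 (trans (∑-const n (e b 2)) (trans (*-comm n (e b 2)) (cong (_* n) e2)))
    up≡ : up b ≡ down b + den * x
    up≡ = ℤₚ.+-injective (trans (ℤₚ.pos-+ (e b 3) _) (trans
      (cong₂ _+ᶻ_ e3 (trans (cong ⁺_ by-class) terms))
      (trans (regroup (⁺ h) (coef 0) _ (⁺ n)) (trans
        (cong₂ (λ s w → ⁺ h +ᶻ s +ᶻ w) (sym (ℤₚ.pos-* h n)) (sym eqn))
        (trans (cong (_+ᶻ ⁺ (den * x)) (sym (ℤₚ.pos-+ h (h * n))))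
          (trans (sym (ℤₚ.pos-+ (h + h * n) (den * x))) (cong (λ s → ⁺ (s + den * x)) (sym down≡))))))))
      where
      regroup : ∀ h c s n → h +ᶻ c +ᶻ (s +ᶻ h *ᶻ n) ≡ h +ᶻ h *ᶻ n +ᶻ (c +ᶻ s)
      regroup = solveᶻ-∀

  block-correct : ∀ (x : ℕ → ℕ) b p → b < Y → (∀ i → i ≤ b → mult i ≡ x i) →
    ∑ b x ≤ p → p < ∑ (suc b) x → block p ≡ b
  block-correct x b p b<Y mult≡ lo hi = μ-unique Y _ b (<⇒≤ b<Y)
    (λ _ → m≤n⇒m∸n≡0 (≤-trans hi (≤-reflexive (sym (sums b ≤-refl)))))
    (λ j j<b eq → <-irrefl refl (≤-trans (m∸n≡0⇒m≤n eq)
      (≤-trans (≤-reflexive (sums j (<⇒≤ j<b))) (≤-trans (∑-monoˡ-≤ x j<b) lo))))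
    where
    sums : ∀ j → j ≤ b → psum Y (suc j) mult ≡ ∑ (suc j) x
    sums j j≤b = trans (psum≡∑ Y (suc j) mult (≤-<-trans j≤b b<Y))
      (∑-cong (suc j) λ i i<1+j → mult≡ i (≤-trans (≤-pred i<1+j) j≤b))

-- The algorithm

pattern gN = zero
pattern gV = suc zero
pattern gY = suc (suc zero)
pattern gL = suc (suc (suc zero))

module Algorithm (G : Globals) where

  n V Y : ℕ
  n = glob G gN
  V = glob G gV
  Y = glob G gY

  A : ℕ → ℕ → ℕ
  A u v = cellOf {true} tt G (∑ n (λ _ → u) + v)

  open Classes n A using (diff; rep; cls) public
  open Digits Y V public

  word : ℕ → ℕ → ℕ
  word c = Reading.word n Y cls (entry c)

  pos : ℕ → ℕ → ℕ
  pos c = Placement.pos n cls (word c)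

  bad : ℕ → ℕ
  bad c = Placement.bad n cls (word c)

  -- Every edge is seen from both ends, so this is twice the cost of the decoded arrangement.
  value : ℕ → ℕ
  value c = ∑ n λ u → ∑ n λ v → ifz (A u v) 0 (gap (pos c u) (pos c v))

  best : ℕ
  best = natrec V 0 (select bad value)

  out : ℕ → ℕ
  out v = suc (pos best v)

module _ where

  open Algorithm

  pattern 0F = zero
  pattern 1F = suc zero
  pattern 2F = suc (suc zero)

  AF : Fn {2} λ G e → A G (lookup e 0F) (lookup e 1F)
  AF = inpF (sumF gN (varF 1F) +F varF 1F)

  diffF : Fn {2} λ G e → diff G (lookup e 0F) (lookup e 1F)
  diffF = sumF gN (gapF (appF AF (varF 1F ∷F varF 0F ∷F []F)) (appF AF (varF 2F ∷F varF 0F ∷F []F)))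

  repF : Fn {1} λ G e → rep G (lookup e 0F)
  repF = μF gN (appF diffF (varF 0F ∷F varF 1F ∷F []F))

  clsF : Fn {1} λ G e → cls G (lookup e 0F)
  clsF = psumF gN repF (indF (gapF (appF repF (varF 0F ∷F []F)) (varF 0F)))

  rankF : Fn {1} λ G e → Placement.rank (n G) (cls G) (λ _ → 0) (lookup e 0F)
  rankF = psumF gN (varF 0F) (indF (gapF (appF clsF (varF 0F ∷F []F)) (appF clsF (varF 1F ∷F []F))))

  quoF : Fn {1} λ G e → quo G (lookup e 0F)
  quoF = μF gV ((litF 1 +F varF 1F) ∸F sumF gY (litF 1 +F varF 1F))

  shiftF : Fn {2} λ G e → shift G (lookup e 0F) (lookup e 1F)
  shiftF = recF gV (varF 0F)
    (ifzF ((litF 1 +F varF 0F) ∸F varF (suc (suc (suc zero)))) (appF quoF (varF 1F ∷F []F)) (varF 1F))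

  digitF : Fn {2} λ G e → digit G (lookup e 0F) (lookup e 1F)
  digitF = shiftF ∸F sumF gY (appF quoF (appF shiftF (varF 1F ∷F varF 2F ∷F []F) ∷F []F))

  entryF : Fn {3} λ G e → entry G (lookup e 0F) (lookup e 1F) (lookup e 2F)
  entryF = appF digitF (varF 0F ∷F (sumF gY (varF 2F) +F varF 2F) ∷F []F)

  upF : Fn {2} λ G e → Reading.up (n G) (Y G) (cls G) (entry G (lookup e 0F)) (lookup e 1F)
  upF = appF entryF (varF 0F ∷F varF 1F ∷F litF 3 ∷F []F) +F
        sumF gN (appF entryF (varF 1F ∷F varF 2F ∷F (litF 4 +F appF clsF (varF 0F ∷F []F)) ∷F []F))

  downF : Fn {2} λ G e → Reading.down (n G) (Y G) (cls G) (entry G (lookup e 0F)) (lookup e 1F)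
  downF = appF entryF (varF 0F ∷F varF 1F ∷F litF 2 ∷F []F) +F
          sumF gN (appF entryF (varF 1F ∷F varF 2F ∷F litF 2 ∷F []F))

  multF : Fn {2} λ G e → Reading.mult (n G) (Y G) (cls G) (entry G (lookup e 0F)) (lookup e 1F)
  multF = μF gN (appF upF (varF 1F ∷F varF 2F ∷F []F) ∸F
    (appF downF (varF 1F ∷F varF 2F ∷F []F) +F
     psumF gN (varF 0F) (litF 1 +F appF entryF (varF 2F ∷F varF (suc (suc (suc zero))) ∷F litF 1 ∷F []F))))

  blockF : Fn {2} λ G e → Reading.block (n G) (Y G) (cls G) (entry G (lookup e 0F)) (lookup e 1F)
  blockF = μF gY ((litF 1 +F varF 2F) ∸F
    psumF gY (litF 1 +F varF 0F) (appF multF (varF 2F ∷F varF 0F ∷F []F)))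

  wordF : Fn {2} λ G e → word G (lookup e 0F) (lookup e 1F)
  wordF = appF entryF (varF 0F ∷F blockF ∷F litF 0 ∷F []F)

  occF : Fn {3} λ G e → Placement.occ (n G) (cls G) (word G (lookup e 0F)) (lookup e 1F) (lookup e 2F)
  occF = psumF gN (varF 2F) (indF (gapF (appF wordF (varF 1F ∷F varF 0F ∷F []F)) (varF 2F)))

  posF : Fn {2} λ G e → pos G (lookup e 0F) (lookup e 1F)
  posF = μF gN (
    gapF (appF wordF (varF 1F ∷F varF 0F ∷F []F)) (appF clsF (varF 2F ∷F []F)) +F
    gapF (appF occF (varF 1F ∷F appF clsF (varF 2F ∷F []F) ∷F varF 0F ∷F []F)) (appF rankF (varF 2F ∷F []F)))

  badF : Fn {1} λ G e → bad G (lookup e 0F)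
  badF = sumF gN ((litF 1 +F appF posF (varF 1F ∷F varF 0F ∷F []F)) ∸F gblF gN)

  valueF : Fn {1} λ G e → value G (lookup e 0F)
  valueF = sumF gN (sumF gN (ifzF (appF AF (varF 1F ∷F varF 0F ∷F []F)) (litF 0)
    (gapF (appF posF (varF 2F ∷F varF 1F ∷F []F)) (appF posF (varF 2F ∷F varF 0F ∷F []F)))))

  bestF : Fn {0} λ G e → best G
  bestF = recF gV (litF 0)
    (ifzF (appF badF (varF 0F ∷F []F))
      (ifzF (appF badF (varF 1F ∷F []F))
        (ifzF ((litF 1 +F appF valueF (varF 0F ∷F []F)) ∸F appF valueF (varF 1F ∷F []F)) (varF 0F) (varF 1F))
        (varF 0F))
      (varF 1F))

  outF : Fn {1} λ G e → out G (lookup e 0F)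
  outF = litF 1 +F appF posF (appF bestF []F ∷F varF 0F ∷F []F)

-- Arrangements as permutations

∑≡∑ᶠ : ∀ n f → ∑ n f ≡ ∑ᶠ {n} (λ i → f (toℕ i))
∑≡∑ᶠ zero    f = refl
∑≡∑ᶠ (suc n) f = trans (∑-head n f) (cong (f 0 +_) (∑≡∑ᶠ n (f ∘ suc)))

module _ {n : ℕ} (f : Fin n → Fin n) (f-injective : ∀ {i j} → f i ≡ f j → i ≡ j) where

  -- A missed value could be punched out of the codomain, leaving an injection into a smaller set.
  injective⇒hit : ∀ y → ∃ λ x → f x ≡ y
  injective⇒hit y with Fin.any? (λ x → f x Fin.≟ y)
  ... | yes hit = hit
  ... | no miss = ⊥-elim (impossible f f-injective y (λ x eq → miss (x , eq)))
    where
    impossible : ∀ {n} (f : Fin n → Fin n) → (∀ {i j} → f i ≡ f j → i ≡ j) → ∀ y → (∀ x → f x ≢ y) → ⊥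
    impossible {suc n} f inj y miss = 1+n≰n (Fin.injective⇒≤ {f = λ x → punchOut (≢-sym (miss x))}
      (λ eq → inj (Fin.punchOut-injective (≢-sym (miss _)) (≢-sym (miss _)) eq)))

  injective⇒permutation : Permutation′ n
  injective⇒permutation = permutation f (proj₁ ∘ injective⇒hit) (proj₂ ∘ injective⇒hit)
    (λ x → f-injective (proj₂ (injective⇒hit (f x))))

bit : Bool → ℕ
bit b = if b then 1 else 0

sum-tabulate : ∀ {n} {X : Set} (f : X → ℕ) (g : Fin n → X) → sum (map f (tabulate g)) ≡ ∑ᶠ (f ∘ g)
sum-tabulate {zero}  f g = refl
sum-tabulate {suc n} f g = cong (f (g zero) +_) (sum-tabulate f (g ∘ suc))

sum-cartesianProduct : ∀ {X Y : Set} (f : X × Y → ℕ) xs ys →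
  sum (map f (cartesianProduct xs ys)) ≡ sum (map (λ x → sum (map (λ y → f (x , y)) ys)) xs)
sum-cartesianProduct f []       ys = refl
sum-cartesianProduct f (x ∷ xs) ys = begin
  sum (map f (map (x ,_) ys ++ cartesianProduct xs ys))
    ≡⟨ cong sum (map-++ f (map (x ,_) ys) _) ⟩
  sum (map f (map (x ,_) ys) ++ map f (cartesianProduct xs ys))
    ≡⟨ sum-++ (map f (map (x ,_) ys)) _ ⟩
  sum (map f (map (x ,_) ys)) + sum (map f (cartesianProduct xs ys))
    ≡⟨ cong₂ _+_ (cong sum (sym (map-∘ ys))) (sum-cartesianProduct f xs ys) ⟩
  sum (map (λ y → f (x , y)) ys) + sum (map (λ x → sum (map (λ y → f (x , y)) ys)) xs) ∎
  where open ≡-Reasoning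

sum-filter : ∀ {X : Set} {P : X → Set} (P? : Decidable P) (f : X → ℕ) xs →
  sum (map f (filter P? xs)) ≡ sum (map (λ x → bit (does (P? x)) * f x) xs)
sum-filter P? f []       = refl
sum-filter P? f (x ∷ xs) with does (P? x)
... | true  = cong₂ _+_ (sym (+-identityʳ (f x))) (sum-filter P? f xs)
... | false = sum-filter P? f xs

distances : ∀ {n} → (Fin n → Fin n → Bool) → (Fin n → ℕ) → ℕ
distances a p = ∑ᶠ λ u → ∑ᶠ λ v → bit (a u v) * ∣ p u - p v ∣

-- The edge list keeps each pair in one order. Adding the transposed sum restores symmetry, because
-- exactly one of the two orders holds for distinct vertices, and the diagonal contributes nothing.
double-val : ∀ {n} (G : Graph n) (σ : Permutation′ n) → 2 * val σ G ≡ distances (adj G) (λ u → toℕ (σ ⟨$⟩ʳ u))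
double-val {n} G σ = begin
  2 * val σ G                                       ≡⟨ cong (val σ G +_) (+-identityʳ (val σ G)) ⟩
  val σ G + val σ G                                 ≡⟨ cong₂ _+_ val≡ (trans val≡ (∑-comm half)) ⟩
  (∑ᶠ λ u → ∑ᶠ λ v → half u v) + (∑ᶠ λ u → ∑ᶠ λ v → half v u)
    ≡⟨ ∑-distrib-+ (λ u → ∑ᶠ (half u)) (λ u → ∑ᶠ λ v → half v u) ⟨
  (∑ᶠ λ u → (∑ᶠ λ v → half u v) + (∑ᶠ λ v → half v u))
    ≡⟨ sum-cong-≗ {n} (λ u → trans (sym (∑-distrib-+ (half u) (λ v → half v u))) (sum-cong-≗ {n} (both u))) ⟩
  (∑ᶠ λ u → ∑ᶠ λ v → bit (adj G u v) * D u v)      ∎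
  where
  open ≡-Reasoning
  D : Fin n → Fin n → ℕ
  D u v = ∣ toℕ (σ ⟨$⟩ʳ u) - toℕ (σ ⟨$⟩ʳ v) ∣
  E? : Decidable {A = Fin n × Fin n} (λ (u , v) → toℕ u < toℕ v × T (adj G u v))
  E? (u , v) = (u Fin.<? v) ×-dec Bool.T? (adj G u v)
  half : Fin n → Fin n → ℕ
  half u v = bit (does (E? (u , v))) * D u v
  val≡ : val σ G ≡ ∑ᶠ λ u → ∑ᶠ λ v → half u v
  val≡ = trans (sum-filter E? _ (cartesianProduct (allFin n) (allFin n)))
    (trans (sum-cartesianProduct _ (allFin n) (allFin n))
      (trans (sum-tabulate {n} (λ u → sum (map (half u) (allFin n))) id)
          (sum-cong-≗ {n} (λ u → sum-tabulate (half u) id))))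
  bit-∧ : ∀ a b → bit (a ∧ b) ≡ bit a * bit b
  bit-∧ true  b = sym (+-identityʳ (bit b))
  bit-∧ false b = refl
  E≡ : ∀ u v → bit (does (E? (u , v))) ≡ bit (does (u Fin.<? v)) * bit (adj G u v)
  E≡ u v = bit-∧ (does (u Fin.<? v)) (adj G u v)
  exactly-one : ∀ {P Q : Set} (p : Dec P) (q : Dec Q) → ¬ (P × Q) → ¬ (¬ P × ¬ Q) →
      bit (does p) + bit (does q) ≡ 1
  exactly-one (yes _) (no _)  _ _ = refl
  exactly-one (no _)  (yes _) _ _ = refl
  exactly-one (yes p) (yes q) h _ = contradiction (p , q) h
  exactly-one (no p)  (no q)  _ h = contradiction (p , q) h
  either : ∀ u v → u ≢ v → bit (does (u Fin.<? v)) + bit (does (v Fin.<? u)) ≡ 1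
  either u v u≢v = exactly-one (u Fin.<? v) (v Fin.<? u) (λ (p , q) → <-asym p q)
    (λ (p , q) → u≢v (Fin.toℕ-injective (≤-antisym (≮⇒≥ q) (≮⇒≥ p))))
  both : ∀ u v → half u v + half v u ≡ bit (adj G u v) * D u v
  both u v with u Fin.≟ v
  ... | yes refl rewrite E≡ u u | irrefl G u | *-zeroʳ (bit (does (u Fin.<? u))) = refl
  ... | no u≢v rewrite E≡ u v | E≡ v u | symm G v u | ∣-∣-comm (toℕ (σ ⟨$⟩ʳ v)) (toℕ (σ ⟨$⟩ʳ u)) =
    trans (factor (bit (does (u Fin.<? v))) (bit (does (v Fin.<? u))) (bit (adj G u v)) (D u v))
      (trans (cong (_* (bit (adj G u v) * D u v)) (either u v u≢v)) (*-identityˡ _))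
    where
    factor : ∀ x y a d → x * a * d + y * a * d ≡ (x + y) * (a * d)
    factor = solve-∀

distances-permute : ∀ {n} (a : Fin n → Fin n → Bool) (σ : Permutation′ n) →
  distances (λ p q → a (σ ⟨$⟩ˡ p) (σ ⟨$⟩ˡ q)) toℕ ≡ distances a (λ u → toℕ (σ ⟨$⟩ʳ u))
distances-permute {n} a σ = trans (sum-permute _ σ) (sum-cong-≗ {n} λ u → trans (sum-permute _ σ)
  (sum-cong-≗ {n} λ v → cong₂ (λ x y → bit (a x y) * ∣ toℕ (σ ⟨$⟩ʳ u) - toℕ (σ ⟨$⟩ʳ v) ∣) (inverseˡ σ)
      (inverseˡ σ)))

module Listing (Γ : ClassedGraph) where

  open ClassedGraph Γ
  open Words Γ

  reach-tabulate : ∀ {m} u s (h : Fin m → X) → reach u s (tabulate h) ≡ ∑ᶠ (λ q → a u (h q) * (s + toℕ q))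
  reach-tabulate {zero}  u s h = refl
  reach-tabulate {suc m} u s h = cong₂ _+_
    (trans (*-comm s (a u (h zero))) (cong (a u (h zero) *_) (sym (+-identityʳ s))))
    (trans (reach-tabulate u (suc s) (h ∘ suc))
      (sum-cong-≗ {m} λ q → cong (a u (h (suc q)) *_) (sym (+-suc s (toℕ q)))))

  double-cost : ∀ {m} (g : Fin m → X) →
    2 * wcost (tabulate g) ≡ ∑ᶠ (λ p → ∑ᶠ λ q → a (g p) (g q) * ∣ toℕ p - toℕ q ∣)
  double-cost {zero}  g = refl
  double-cost {suc m} g = begin
    2 * (R + C)
      ≡⟨ split R C ⟩
    R + (R + 2 * C)
      ≡⟨ cong₂ (λ x y → x + (x + y)) (reach-tabulate (g zero) 1 (g ∘ suc)) (double-cost (g ∘ suc)) ⟩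
    row + (row + rest)
      ≡⟨ cong (row +_) (cong (_+ rest)
           (sum-cong-≗ {m} λ p → cong (_* suc (toℕ p)) (a-sym (g zero) (g (suc p))))) ⟩
    row + (∑ᶠ (λ p → a (g (suc p)) (g zero) * suc (toℕ p)) + rest)
      ≡⟨ cong₂ _+_ (sym (cong (_+ row) (trans (cong (_* 0) (a-irrefl (g zero))) refl)))
           (sym (∑-distrib-+ {m} _ _)) ⟩
    ∑ᶠ (λ p → ∑ᶠ λ q → a (g p) (g q) * ∣ toℕ p - toℕ q ∣) ∎
    where
    open ≡-Reasoning
    R C row rest : ℕ
    R = reach (g zero) 1 (tabulate (g ∘ suc))
    C = wcost (tabulate (g ∘ suc))
    row = ∑ᶠ (λ q → a (g zero) (g (suc q)) * suc (toℕ q))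
    rest = ∑ᶠ (λ p → ∑ᶠ λ q → a (g (suc p)) (g (suc q)) * ∣ toℕ p - toℕ q ∣)
    split : ∀ x y → 2 * (x + y) ≡ x + (x + 2 * y)
    split = solve-∀

  count-tabulate : ∀ {m} t (g : Fin m → X) → count t (tabulate g) ≡ ∑ᶠ (λ p → ind (gap (cls (g p)) t))
  count-tabulate {zero}  t g = refl
  count-tabulate {suc m} t g = cong (ind (gap (cls (g zero)) t) +_) (count-tabulate t (g ∘ suc))

  covers-tabulate : ∀ {m} (g : Fin m → X) → covers (tabulate g) ≡ ∑ᶠ (λ p → 1 ∸ bit (does (free? (g p))))
  covers-tabulate {zero}  g = refl
  covers-tabulate {suc m} g with free? (g zero)
  ... | yes _ = covers-tabulate (g ∘ suc)
  ... | no _  = cong suc (covers-tabulate (g ∘ suc))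

  -- 0 beyond the end
  classAt : List X → ℕ → ℕ
  classAt []      p       = 0
  classAt (u ∷ l) zero    = cls u
  classAt (u ∷ l) (suc p) = classAt l p

  map-cls : ∀ {m} l (f : Fin m → ℕ) → length l ≡ m → (∀ p → classAt l (toℕ p) ≡ f p) → map cls l ≡ tabulate f
  map-cls {zero}  []      f eq h = refl
  map-cls {suc m} (u ∷ l) f eq h = cong₂ _∷_ (h zero) (map-cls l (f ∘ suc) (suc-injective eq) (h ∘ suc))

  count-classAt : ∀ t l → count t l ≡ ∑ (length l) (λ p → ind (gap (classAt l p) t))
  count-classAt t []      = refl
  count-classAt t (u ∷ l) = trans (cong (ind (gap (cls u) t) +_) (count-classAt t l))
    (sym (∑-head (length l) (λ p → ind (gap (classAt (u ∷ l) p) t))))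

  length-counts : ∀ K → (∀ u → cls u < K) → ∀ l → length l ≡ ∑ K (λ t → count t l)
  length-counts K cls<K []      = sym (∑-zero K)
  length-counts K cls<K (u ∷ l) = trans
    (cong₂ _+_ (sym (trans (∑-single K _ (cls u) (cls<K u) (λ t _ t≢ → ind-gap-≢ (≢-sym t≢)))
        (ind-gap-≡ {cls u} refl)))
      (length-counts K cls<K l))
    (sym (∑-+ K _ _))

module Locating (Γ : ClassedGraph) where

  open ClassedGraph Γ
  open Patterns Γ
  open Listing Γ

  -- 0 beyond the end
  blockClass : Pattern → ℕ → ℕ
  blockClass []            b       = 0
  blockClass ((_ , u) ∷ π) zero    = cls u
  blockClass ((_ , u) ∷ π) (suc b) = blockClass π b

  classAt-replicate : ∀ m u l p → p < m → classAt (replicate m u ++ l) p ≡ cls u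
  classAt-replicate (suc m) u l zero    _         = refl
  classAt-replicate (suc m) u l (suc p) (s≤s p<m) = classAt-replicate m u l p p<m

  classAt-beyond : ∀ m u l p → classAt (replicate m u ++ l) (m + p) ≡ classAt l p
  classAt-beyond zero    u l p = refl
  classAt-beyond (suc m) u l p = classAt-beyond m u l p

  mult≤length : ∀ π b₀ z b → b < length π → z (b₀ + b) ≤ length (spread π b₀ z)
  mult≤length ((_ , u) ∷ π) b₀ z b b< rewrite length-++
      (replicate (z b₀) u) {spread π (suc b₀) z} | length-replicate (z b₀) {u}
    with b
  ... | zero  rewrite +-identityʳ b₀ = m≤m+n (z b₀) _
  ... | suc b rewrite +-suc b₀ b = ≤-trans (mult≤length π (suc b₀) z b (≤-pred b<)) (m≤n+m _ (z b₀))

  locate : ∀ π b₀ z p → p < length (spread π b₀ z) →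
    Σ ℕ λ b → b < length π × ∑ b (λ i → z (b₀ + i)) ≤ p × p < ∑ (suc b) (λ i → z (b₀ + i)) ×
              classAt (spread π b₀ z) p ≡ blockClass π b
  locate ((_ , u) ∷ π) b₀ z p p< with p <? z b₀
  ... | yes p<z = 0 , s≤s z≤n , z≤n ,
    ≤-trans p<z (≤-reflexive (trans (cong z (sym (+-identityʳ b₀))) (sym (+-identityʳ _)))) ,
    classAt-replicate (z b₀) u (spread π (suc b₀) z) p p<z
  ... | no p≮z with m≤n⇒∃[o]m+o≡n (≮⇒≥ p≮z)
  ... | q , refl
    with locate π (suc b₀) z q (+-cancelˡ-< (z b₀) _ _ (subst (z b₀ + q <_)
           (trans (length-++ (replicate (z b₀) u)) (cong (_+ _) (length-replicate (z b₀)))) p<))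
  ... | b , b< , lo , hi , eq = suc b , s≤s b< ,
    ≤-trans (≤-reflexive (sum≡ b)) (+-monoʳ-≤ (z b₀) lo) ,
    <-≤-trans (+-monoʳ-< (z b₀) hi) (≤-reflexive (sym (sum≡ (suc b)))) ,
    trans (classAt-beyond (z b₀) u (spread π (suc b₀) z) q) eq
    where
    sum≡ : ∀ b → ∑ (suc b) (λ i → z (b₀ + i)) ≡ z b₀ + ∑ b (λ i → z (suc b₀ + i))
    sum≡ b = trans (∑-head b _) (cong₂ _+_ (cong z (+-identityʳ b₀)) (∑-cong b λ i _ → cong z (+-suc b₀ i)))

-- Correctness of the algorithm

-- There are at most `3 ^ k` signatures, which bounds `cls` by that number inclusively; the
-- successor makes the bound strict.
classes : ℕ → ℕ
classes k = suc (3 ^ k)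

blocks : ℕ → ℕ
blocks k = k * suc (classes k) + classes k

weight : ℕ → ℕ
weight k = coefBound (classes k) (blocks k)

opaque

  -- A common bound for everything in a table: it has `4 + classes k` columns and at most `blocks k`
  -- rows, and a coefficient shifted by `weight k` is at most twice that weight.
  base : ℕ → ℕ
  base k = 4 + classes k + blocks k + (weight k + weight k)

  base≡ : ∀ k → base k ≡ 4 + classes k + blocks k + (weight k + weight k)
  base≡ k = refl

  codeCount : ℕ → ℕ
  codeCount k = base k ^ (base k * base k)

  codeCount≡ : ∀ k → codeCount k ≡ base k ^ (base k * base k)
  codeCount≡ k = refl

4+classes≤base : ∀ k → 4 + classes k ≤ base k
4+classes≤base k = subst (4 + classes k ≤_) (sym (base≡ k)) (≤-trans (m≤m+n _ (blocks k)) (m≤m+n _ _))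

blocks≤base : ∀ k → blocks k ≤ base k
blocks≤base k = subst (blocks k ≤_) (sym (base≡ k)) (≤-trans (m≤n+m _ (4 + classes k)) (m≤m+n _ _))

weight+weight<base : ∀ k → weight k + weight k < base k
weight+weight<base k = subst (weight k + weight k <_) (sym (base≡ k))
    (m<n+m (weight k + weight k) {4 + classes k + blocks k} (s≤s z≤n))

4≤base : ∀ k → 4 ≤ base k
4≤base k = ≤-trans (m≤m+n 4 (classes k)) (4+classes≤base k)

globals : ∀ {n} → Graph n → ℕ → Globals
globals {n} G k = record { glob = value ; cell = adjacencyMatrix G }
  where
  value : Fin 4 → ℕ
  value gN = n
  value gV = codeCount k
  value gY = base k
  value gL = n * n

elements : ∀ {n} → Subset n → List (Fin n)
elements []          = []
elements (true  ∷ p) = zero ∷ map suc (elements p)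
elements (false ∷ p) = map suc (elements p)

length-elements : ∀ {n} (p : Subset n) → length (elements p) ≡ ∣ p ∣ˢ
length-elements []          = refl
length-elements (true  ∷ p) = cong suc (trans (length-map suc (elements p)) (length-elements p))
length-elements (false ∷ p) = trans (length-map suc (elements p)) (length-elements p)

∈-elements : ∀ {n} (p : Subset n) x → lookup p x ≡ true → x ∈ₗ elements p
∈-elements (true  ∷ p) zero    eq = here refl
∈-elements (true  ∷ p) (suc x) eq = there (Any-map⁺ (Any-map (cong suc) (∈-elements p x eq)))
∈-elements (false ∷ p) (suc x) eq = Any-map⁺ (Any-map (cong suc) (∈-elements p x eq))

∑-subset : ∀ {n} (p : Subset n) → ∑ᶠ (λ x → bit (lookup p x)) ≡ ∣ p ∣ˢ
∑-subset []          = refl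
∑-subset (true  ∷ p) = cong suc (∑-subset p)
∑-subset (false ∷ p) = ∑-subset p

adjacencyMatrix-combine : ∀ {n} (G : Graph n) u v → adjacencyMatrix G (toℕ (combine u v)) ≡ bit (adj G u v)
adjacencyMatrix-combine {n} G u v with toℕ (combine u v) <? n * n
... | yes lt = cong (λ (x , y) → bit (adj G x y))
    (trans (cong (remQuot n) (Fin.fromℕ<-toℕ (combine u v) lt)) (Fin.remQuot-combine u v))
... | no ≮ = contradiction (Fin.toℕ<n (combine u v)) ≮

bit≤1 : ∀ b → bit b ≤ 1
bit≤1 true  = ≤-refl
bit≤1 false = z≤n

module Covered {n : ℕ} (G : Graph n) (k : ℕ) (C : Subset n) (cover : IsVertexCover G C)
    (∣C∣≤k : ∣ C ∣ˢ ≤ k) where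

  module Alg = Algorithm (globals G k)

  A-adj : ∀ u v → Alg.A (toℕ u) (toℕ v) ≡ bit (adj G u v)
  A-adj u v = trans (cong (adjacencyMatrix G)
      (trans (cong (clamp (n * n)) address) (clamp-id (<⇒≤ (Fin.toℕ<n (combine u v))))))
    (adjacencyMatrix-combine G u v)
    where
    address : ∑ n (λ _ → toℕ u) + toℕ v ≡ toℕ (combine u v)
    address = trans (cong (_+ toℕ v) (∑-const n (toℕ u))) (sym (Fin.toℕ-combine u v))
    clamp-id : ∀ {l a} → a ≤ l → clamp l a ≡ a
    clamp-id a≤l rewrite m≤n⇒m∸n≡0 a≤l = refl

  non-edge : ∀ u v → lookup C u ≡ false → lookup C v ≡ false → adj G u v ≡ false
  non-edge u v fu fv with adj G u v in eq
  ... | false = refl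
  ... | true with cover u v (subst T (sym eq) tt)
  ...   | inj₁ u∈C = contradiction (trans (sym fu) ([]=⇒lookup u∈C)) λ ()
  ...   | inj₂ v∈C = contradiction (trans (sym fv) ([]=⇒lookup v∈C)) λ ()

  -- Vertices with the same signature are equal or have the same neighbours.
  mark : Fin n → Fin n → Fin 3
  mark u c with u Fin.≟ c
  ... | yes _ = suc (suc zero)
  ... | no  _ = if adj G u c then suc zero else zero

  mark-self : ∀ u v → mark u u ≡ mark v u → v ≡ u
  mark-self u v eq with u Fin.≟ u | v Fin.≟ u
  ... | yes _ | yes v≡u = v≡u
  ... | no ≢  | _ = contradiction refl ≢
  ... | yes _ | no _ with adj G v u | eq
  ...   | true  | ()
  ...   | false | ()

  mark-adj : ∀ u v c → u ≢ c → v ≢ c → mark u c ≡ mark v c → adj G u c ≡ adj G v c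
  mark-adj u v c u≢c v≢c eq with u Fin.≟ c | v Fin.≟ c
  ... | yes u≡c | _ = contradiction u≡c u≢c
  ... | no _ | yes v≡c = contradiction v≡c v≢c
  ... | no _ | no _ with adj G u c | adj G v c | eq
  ...   | true  | true  | _ = refl
  ...   | false | false | _ = refl

  signature : Fin n → Fin (3 ^ length (elements C))
  signature u = funToFin (λ i → mark u (lookupₗ (elements C) i))

  -- A vertex of the cover marks itself with the third value and therefore shares its signature with
  -- no other vertex. Outside the cover all neighbours lie in the cover, where the marks record
  -- adjacency.
  signature-twins : ∀ u v → signature u ≡ signature v → ∀ w → adj G u w ≡ adj G v w
  signature-twins u v eq = by (lookup C u Bool.≟ true) (lookup C v Bool.≟ true)
    where
    marks : ∀ c → lookup C c ≡ true → mark u c ≡ mark v c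
    marks c c∈C = subst (λ x → mark u x ≡ mark v x) (sym (lookup-index at))
      (trans (sym (Fin.finToFun-funToFin _ (indexₐ at)))
          (trans (cong (λ s → finToFun s (indexₐ at)) eq) (Fin.finToFun-funToFin _ (indexₐ at))))
      where at = ∈-elements C c c∈C
    by : Dec (lookup C u ≡ true) → Dec (lookup C v ≡ true) → ∀ w → adj G u w ≡ adj G v w
    by (yes u∈C) _ w = cong (λ x → adj G x w) (sym (mark-self u v (marks u u∈C)))
    by (no _) (yes v∈C) w = cong (λ x → adj G x w) (mark-self v u (sym (marks v v∈C)))
    by (no u∉C) (no v∉C) w with lookup C w Bool.≟ true
    ... | yes w∈C = mark-adj u v w (λ { refl → u∉C w∈C }) (λ { refl → v∉C w∈C }) (marks w w∈C)
    ... | no w∉C  = trans (non-edge u w (Bool.¬-not u∉C) (Bool.¬-not w∉C))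
        (sym (non-edge v w (Bool.¬-not v∉C) (Bool.¬-not w∉C)))

  open Classes n Alg.A using (Twins; cls; cls⇒twins; cls-bound)

  K L W : ℕ
  K = classes k
  L = blocks k
  W = weight k

  cls<K : ∀ v → v < n → cls v < K
  cls<K v v<n = s≤s (cls-bound (3 ^ k) κ κ< κ-twins v v<n)
    where
    κ : ℕ → ℕ
    κ u with u <? n
    ... | yes u<n = toℕ (signature (fromℕ< u<n))
    ... | no _    = 0
    κ≡ : ∀ u (u<n : u < n) → κ u ≡ toℕ (signature (fromℕ< u<n))
    κ≡ u u<n with u <? n
    ... | yes _ = refl
    ... | no ≮  = contradiction u<n ≮
    κ< : ∀ u → u < n → κ u < 3 ^ k
    κ< u u<n = <-≤-trans (subst (_< 3 ^ length (elements C)) (sym (κ≡ u u<n)) (Fin.toℕ<n _))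
      (^-monoʳ-≤ 3 (≤-trans (≤-reflexive (length-elements C)) ∣C∣≤k))
    κ-twins : ∀ u v → u < n → v < n → κ u ≡ κ v → Twins u v
    κ-twins u v u<n v<n eq w w<n = begin
      Alg.A u w                                        ≡⟨ A≡ u u<n ⟩
      bit (adj G (fromℕ< u<n) (fromℕ< w<n))            ≡⟨ cong bit (signature-twins (fromℕ< u<n) (fromℕ< v<n)
              (Fin.toℕ-injective (trans (sym (κ≡ u u<n)) (trans eq (κ≡ v v<n)))) (fromℕ< w<n)) ⟩
      bit (adj G (fromℕ< v<n) (fromℕ< w<n))            ≡⟨ A≡ v v<n ⟨
      Alg.A v w                                        ∎
      where
      open ≡-Reasoning
      A≡ : ∀ x (x<n : x < n) → Alg.A x w ≡ bit (adj G (fromℕ< x<n) (fromℕ< w<n))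
      A≡ x x<n = trans (cong₂ Alg.A (sym (Fin.toℕ-fromℕ< x<n)) (sym (Fin.toℕ-fromℕ< w<n)))
          (A-adj (fromℕ< x<n) (fromℕ< w<n))

  graph : ClassedGraph
  graph = record
    { X        = Fin n
    ; a        = λ u v → bit (adj G u v)
    ; a≤1      = λ u v → bit≤1 (adj G u v)
    ; a-sym    = λ u v → cong bit (symm G u v)
    ; a-irrefl = λ u → cong bit (irrefl G u)
    ; cls      = λ u → cls (toℕ u)
    ; twin     = λ {u} {v} eq w → trans (sym (A-adj u w)) (trans
                   (cls⇒twins (toℕ u) (toℕ v) (Fin.toℕ<n u) (Fin.toℕ<n v) eq (toℕ w) (Fin.toℕ<n w))
                       (A-adj v w))
    ; Free     = λ u → lookup C u ≡ false
    ; free?    = λ u → lookup C u Bool.≟ false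
    ; indep    = λ {u} {v} fu fv → cong bit (non-edge u v fu fv)
    }

  open Words graph
  open Patterns graph
  open Structure graph
  open Listing graph

  clsᶠ : Fin n → ℕ
  clsᶠ u = cls (toℕ u)

  Free : Fin n → Set
  Free u = lookup C u ≡ false

  -- The representative of a class is chosen afresh among its free vertices, since the least vertex
  -- of the class may belong to the cover.
  repsBelow : ℕ → List (Fin n)
  repsBelow zero = []
  repsBelow (suc t) with Fin.any? (λ v → (lookup C v Bool.≟ false) ×-dec (clsᶠ v ≟ t))
  ... | yes (v , _) = v ∷ repsBelow t
  ... | no _        = repsBelow t

  repsBelow-free : ∀ t → All Free (repsBelow t)
  repsBelow-free zero = []
  repsBelow-free (suc t) with Fin.any? (λ v → (lookup C v Bool.≟ false) ×-dec (clsᶠ v ≟ t))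
  ... | yes (v , fv , _) = fv ∷ repsBelow-free t
  ... | no _             = repsBelow-free t

  repsBelow-length : ∀ t → length (repsBelow t) ≤ t
  repsBelow-length zero = z≤n
  repsBelow-length (suc t) with Fin.any? (λ v → (lookup C v Bool.≟ false) ×-dec (clsᶠ v ≟ t))
  ... | yes _ = s≤s (repsBelow-length t)
  ... | no _  = m≤n⇒m≤1+n (repsBelow-length t)

  repsBelow-any : ∀ t u → Free u → clsᶠ u < t → Any (λ r → clsᶠ r ≡ clsᶠ u) (repsBelow t)
  repsBelow-any (suc t) u fu lt with Fin.any?
      (λ v → (lookup C v Bool.≟ false) ×-dec (clsᶠ v ≟ t)) | m≤n⇒m<n∨m≡n (≤-pred lt)
  ... | yes (v , _ , eq) | inj₂ eq′ = here (trans eq (sym eq′))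
  ... | yes _            | inj₁ lt′ = there (repsBelow-any t u fu lt′)
  ... | no miss          | inj₂ eq  = contradiction (u , fu , eq) miss
  ... | no _             | inj₁ lt′ = repsBelow-any t u fu lt′

  list : Permutation′ n → List (Fin n)
  list τ = tabulate (τ ⟨$⟩ˡ_)

  cost-list : ∀ τ → wcost (list τ) ≡ val τ G
  cost-list τ = *-cancelˡ-≡ _ _ 2
      (trans (double-cost (τ ⟨$⟩ˡ_)) (trans (distances-permute (adj G) τ) (sym (double-val G τ))))

  size : ℕ → ℕ
  size t = ∑ n λ v → ind (gap (cls v) t)

  count-list : ∀ τ t → count t (list τ) ≡ size t
  count-list τ t = trans (count-tabulate t (τ ⟨$⟩ˡ_)) (trans (sum-permute _ τ)
    (trans (sum-cong-≗ {n} λ u → cong (λ v → ind (gap (clsᶠ v) t)) (inverseˡ τ)) (sym (∑≡∑ᶠ n _))))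

  covers-list : ∀ τ → covers (list τ) ≡ ∣ C ∣ˢ
  covers-list τ = trans (covers-tabulate (τ ⟨$⟩ˡ_)) (trans (sum-permute _ τ)
    (trans (sum-cong-≗ {n} λ u → trans (cong (λ v → 1 ∸ bit (does (lookup C v Bool.≟ false))) (inverseˡ τ))
        (flip (lookup C u))) (∑-subset C)))
    where
    flip : ∀ b → 1 ∸ bit (does (b Bool.≟ false)) ≡ bit b
    flip true  = refl
    flip false = refl

  structured : ∀ τ → Structured K L (list τ)
  structured τ = structure K L (repsBelow K) (repsBelow-free K)
      (λ u fu → repsBelow-any K u fu (cls<K (toℕ u) (Fin.toℕ<n u))) (list τ)
    (+-mono-≤ (*-mono-≤ (≤-trans (≤-reflexive (covers-list τ)) ∣C∣≤k) (s≤s (repsBelow-length K)))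
        (repsBelow-length K))

  open Locating graph
  open Structured

  module Code (τ : Permutation′ n) (S : Structured K L (list τ)) where

    w : List (Fin n)
    w = spread (π S) 0 (x S)

    length-w : length w ≡ n
    length-w = begin
      length w                           ≡⟨ length-counts K (λ u → cls<K (toℕ u) (Fin.toℕ<n u)) w ⟩
      ∑ K (λ t → count t w)              ≡⟨ ∑-cong K (λ t t<K → counts S t t<K) ⟩
      ∑ K (λ t → count t (list τ))       ≡⟨ length-counts K (λ u → cls<K (toℕ u) (Fin.toℕ<n u)) (list τ) ⟨
      length (list τ)                    ≡⟨ length-tabulate (τ ⟨$⟩ˡ_) ⟩
      n                                  ∎
      where open ≡-Reasoning

    -- The offset `W` bounds all coefficients, so the shifted ones are nonnegative and the absolute
    -- value loses nothing.
    row : ℕ → ℕ → ℕ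
    row b 0                   = blockClass (π S) b
    row b 1                   = pred (den S)
    row b 2                   = W
    row b (suc (suc (suc t))) = ∣ ⁺ W +ᶻ coef S b t ∣

    blockClass<K : ∀ π b → blockClass π b < K
    blockClass<K []            b       = s≤s z≤n
    blockClass<K ((_ , u) ∷ π) zero    = cls<K (toℕ u) (Fin.toℕ<n u)
    blockClass<K ((_ , u) ∷ π) (suc b) = blockClass<K π b

    row< : ∀ b j → row b j < base k
    row< b 0 = <-≤-trans (blockClass<K (π S) b) (≤-trans (m≤n+m K 4) (4+classes≤base k))
    row< b 1 = ≤-<-trans (≤-trans pred[n]≤n (≤-trans (den≤ S) (m≤m+n W W))) (weight+weight<base k)
    row< b 2 = ≤-<-trans (m≤m+n W W) (weight+weight<base k)
    row< b (suc (suc (suc t))) =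
        ≤-<-trans (abs-+-≤ {⁺ W} {coef S b t} ≤-refl (coef≤ S b t)) (weight+weight<base k)

    open Decoding (base k) (codeCount k) (≤-trans (s≤s (s≤s z≤n)) (4≤base k)) (codeCount≡ k) using (decode)

    c : ℕ
    c = proj₁ (decode row row<)

    c<V : c < codeCount k
    c<V = proj₁ (proj₂ (decode row row<))

    entry≡ : ∀ b j → b < base k → j < base k → Alg.entry c b j ≡ row b j
    entry≡ = proj₂ (proj₂ (decode row row<))

    open Reading n (base k) cls (Alg.entry c) using (mult; mult-correct; block-correct)

    shifted : ∀ i → ∣ i ∣ ≤ W → ⁺ ∣ ⁺ W +ᶻ i ∣ ≡ ⁺ W +ᶻ i
    shifted i i≤W = ℤₚ.0≤i⇒+∣i∣≡i (nonneg i i≤W)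
      where
      nonneg : ∀ i → ∣ i ∣ ≤ W → 0ℤ ≤ᶻ ⁺ W +ᶻ i
      nonneg (⁺ i)    _   = subst (0ℤ ≤ᶻ_) (ℤₚ.pos-+ W i) (+≤+ z≤n)
      nonneg -[1+ i ] i<W = subst (_≤ᶻ ⁺ W +ᶻ -[1+ i ]) (ℤₚ.+-inverseʳ (⁺ W))
          (ℤₚ.+-monoʳ-≤ (⁺ W) (ℤₚ.neg-mono-≤ (+≤+ i<W)))

    column< : ∀ t → t < K → 4 + t < base k
    column< t t<K = ≤-trans (+-monoʳ-≤ 4 t<K) (4+classes≤base k)

    b<base : ∀ b → b < length (π S) → b < base k
    b<base b b< = <-≤-trans b< (≤-trans (length≤ S) (blocks≤base k))

    mult≡ : ∀ b → b < length (π S) → mult b ≡ x S b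
    mult≡ b b< = mult-correct K b (x S b) W (coef S b) cls<K
      (≤-trans (mult≤length (π S) 0 (x S) b b<) (≤-reflexive length-w))
      (entry≡ b 2 b<Y (column 2 (s≤s (s≤s (s≤s z≤n)))))
      (trans (cong ⁺_ (entry≡ b 3 b<Y (column 3 ≤-refl))) (shifted (coef S b 0) (coef≤ S b 0)))
      (λ t t<K → trans (cong ⁺_ (entry≡ b (4 + t) b<Y (column< t t<K)))
          (shifted (coef S b (suc t)) (coef≤ S b (suc t))))
      (begin
        ⁺ (suc (Alg.entry c b 1) * x S b)
          ≡⟨ cong (λ e → ⁺ (suc e * x S b)) (entry≡ b 1 b<Y (column 1 (s≤s (s≤s z≤n)))) ⟩
        ⁺ (suc (pred (den S)) * x S b)
          ≡⟨ cong (λ e → ⁺ (e * x S b)) (suc-pred (den S) {{>-nonZero (den>0 S)}}) ⟩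
        ⁺ (den S * x S b)                   ≡⟨ solved S b b< ⟩
        coef S b 0 +ᶻ ∑ᶻ K (λ t → coef S b (suc t) *ᶻ ⁺ count t (list τ))
          ≡⟨ cong (coef S b 0 +ᶻ_) (∑ᶻ-cong K λ t _ → cong (λ s → coef S b (suc t) *ᶻ ⁺ s) (count-list τ t)) ⟩
        coef S b 0 +ᶻ ∑ᶻ K (λ t → coef S b (suc t) *ᶻ ⁺ size t) ∎)
      where
      open ≡-Reasoning
      b<Y : b < base k
      b<Y = b<base b b<
      column : ∀ j → j < 4 → j < base k
      column j j<4 = ≤-trans j<4 (4≤base k)

    word≡ : ∀ p → p < n → Alg.word c p ≡ classAt w p
    word≡ p p<n = from (locate (π S) 0 (x S) p (subst (p <_) (sym length-w) p<n))
      where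
      from : (Σ ℕ λ b → b < length (π S) × ∑ b (x S) ≤ p × p < ∑ (suc b) (x S) × classAt w p ≡ blockClass
          (π S) b) →
             Alg.word c p ≡ classAt w p
      from (b , b< , lo , hi , eq) = trans
        (cong (λ i → Alg.entry c i 0)
            (block-correct (x S) b p (b<base b b<) (λ i i≤b → mult≡ i (≤-<-trans i≤b b<)) lo hi))
        (trans (entry≡ b 0 (b<base b b<) (≤-trans (s≤s z≤n) (4≤base k))) (sym eq))

    good : Alg.bad c ≡ 0
    good = Placement.good-intro n cls (Alg.word c) λ v v<n → begin
      ∑ n (λ q → ind (gap (Alg.word c q) (cls v)))
        ≡⟨ ∑-cong n (λ q q<n → cong (λ t → ind (gap t (cls v))) (word≡ q q<n)) ⟩
      ∑ n (λ q → ind (gap (classAt w q) (cls v)))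
        ≡⟨ cong (λ m → ∑ m (λ q → ind (gap (classAt w q) (cls v)))) length-w ⟨
      ∑ (length w) (λ q → ind (gap (classAt w q) (cls v)))    ≡⟨ count-classAt (cls v) w ⟨
      count (cls v) w                                         ≡⟨ counts S (cls v) (cls<K v v<n) ⟩
      count (cls v) (list τ)                                  ≡⟨ count-list τ (cls v) ⟩
      size (cls v)                                            ∎
      where open ≡-Reasoning

  -- Every good code yields an arrangement with its true cost, even if it describes no intended
  -- word. So minimising over all good codes cannot go below the optimum.
  module Decoded (c : ℕ) (good : Alg.bad c ≡ 0) where

    open Placement n cls (Alg.word c) using (pos<n; pos-injective; pos-hit)

    place : Fin n → Fin n
    place u = fromℕ< (pos<n good (toℕ u) (Fin.toℕ<n u))

    toℕ-place : ∀ u → toℕ (place u) ≡ Alg.pos c (toℕ u)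
    toℕ-place u = Fin.toℕ-fromℕ< (pos<n good (toℕ u) (Fin.toℕ<n u))

    σ : Permutation′ n
    σ = injective⇒permutation place λ {u} {v} eq → Fin.toℕ-injective
      (pos-injective good (toℕ u) (toℕ v) (Fin.toℕ<n u) (Fin.toℕ<n v)
        (trans (sym (toℕ-place u)) (trans (cong toℕ eq) (toℕ-place v))))

    value≡ : Alg.value c ≡ 2 * val σ G
    value≡ = begin
      Alg.value c                                ≡⟨ ∑≡∑ᶠ n _ ⟩
      ∑ᶠ {n} (λ u → ∑ n λ v → term (toℕ u) v)
        ≡⟨ sum-cong-≗ {n} (λ u → trans (∑≡∑ᶠ n _) (sum-cong-≗ {n} (λ v → term≡ u v))) ⟩
      distances (adj G) (toℕ ∘ place)            ≡⟨ double-val G σ ⟨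
      2 * val σ G                                ∎
      where
      open ≡-Reasoning
      term : ℕ → ℕ → ℕ
      term u v = ifz (Alg.A u v) 0 (gap (Alg.pos c u) (Alg.pos c v))
      ifz-bit : ∀ b x → ifz (bit b) 0 x ≡ bit b * x
      ifz-bit true  x = sym (+-identityʳ x)
      ifz-bit false x = refl
      term≡ : ∀ u v → term (toℕ u) (toℕ v) ≡ bit (adj G u v) * ∣ toℕ (place u) - toℕ (place v) ∣
      term≡ u v = trans (cong₂ (λ e g → ifz e 0 g) (A-adj u v)
          (gap≡∣-∣ (Alg.pos c (toℕ u)) (Alg.pos c (toℕ v))))
        (trans (ifz-bit (adj G u v) _)
            (cong₂ (λ p q → bit (adj G u v) * ∣ p - q ∣) (sym (toℕ-place u)) (sym (toℕ-place v))))

    class-at : ∀ p → clsᶠ (σ ⟨$⟩ˡ p) ≡ Alg.word c (toℕ p)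
    class-at p = trans (sym (proj₁ (pos-hit (toℕ u) (pos<n good (toℕ u) (Fin.toℕ<n u)))))
      (cong (Alg.word c) (trans (sym (toℕ-place u)) (cong toℕ (inverseʳ σ))))
      where
      u : Fin n
      u = σ ⟨$⟩ˡ p

  module _ (τ : Permutation′ n) (S : Structured K L (list τ)) where

    open Code τ S

    -- The code of the structured word for `τ` decodes to an arrangement with the same class at each
    -- position, though possibly other vertices; twins being interchangeable, the costs agree, and
    -- the structured word costs no more than `τ`.
    value-bound : Alg.value c ≤ 2 * val τ G
    value-bound = begin
      Alg.value c              ≡⟨ value≡ ⟩
      2 * val σ G              ≡⟨ cong (2 *_)
          (trans (sym (cost-list σ))
              (cost-twin (list σ) w (trans (map-tabulate (σ ⟨$⟩ˡ_) clsᶠ) (sym classes≡)))) ⟩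
      2 * wcost w              ≤⟨ *-monoʳ-≤ 2 (cost≤ S) ⟩
      2 * wcost (list τ)       ≡⟨ cong (2 *_) (cost-list τ) ⟩
      2 * val τ G              ∎
      where
      open ≤-Reasoning
      open Decoded c good
      classes≡ : map clsᶠ w ≡ tabulate (clsᶠ ∘ (σ ⟨$⟩ˡ_))
      classes≡ = map-cls w _ length-w (λ p → sym (trans (class-at p) (word≡ (toℕ p) (Fin.toℕ<n p))))

    best-below : Alg.bad Alg.best ≡ 0 × Alg.value Alg.best ≤ Alg.value c
    best-below = select-best Alg.bad Alg.value (codeCount k) c c<V good

  optimal : Σ (Permutation′ n) λ σ → (∀ v → Alg.out (toℕ v) ≡ position σ v) × IsOptimal G σ
  optimal = σ , (λ v → cong suc (sym (toℕ-place v))) , λ τ → *-cancelˡ-≤ 2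
    (≤-trans (≤-reflexive (sym value≡))
        (≤-trans (proj₂ (best-below τ (structured τ))) (value-bound τ (structured τ))))
    -- The identity arrangement serves to show that some good code exists, so that the best one is
    -- good.
    where open Decoded Alg.best (proj₁ (best-below idₚ (structured idₚ)))

-- The program

module _ {m : ℕ} where

  rowBoundP : ∀ {N β B : Vec ℕ m → ℕ} → Pure N → Pure β → Pure B → Pure (λ e → rowBound (N e) (β e) (B e))
  rowBoundP N β B = β +P (litP 1 +P B) +P (N *P (β *P B) +P N *P (β *P B)) +P N *P (B *P (N *P (β *P B)))

  nextBoundP : ∀ {N β B : Vec ℕ m → ℕ} → Pure N → Pure β → Pure B → Pure (λ e → nextBound (N e) (β e) (B e))
  nextBoundP N β B = N *P (rowBoundP N β B *P B) *P B +P B *P (N *P (rowBoundP N β B *P B))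

natrec-bounds : ∀ N β f → natrec f 1 (λ _ B → nextBound N β B) ≡ bounds N β f
natrec-bounds N β zero    = refl
natrec-bounds N β (suc f) = cong (nextBound N β) (natrec-bounds N β f)

boundsP : ∀ {m} {N β f : Vec ℕ m → ℕ} → Pure N → Pure β → Pure f → Pure (λ e → bounds (N e) (β e) (f e))
boundsP {N = N′} {β′} {f′} N β f = congP (λ e → natrec-bounds (N′ e) (β′ e) (f′ e))
  (recP f (litP 1) (nextBoundP (weakenP N) (weakenP β) (varP (suc zero))))

classesP : Pure {1} λ e → classes (lookup e zero)
classesP = litP 1 +P litP 3 ^P varP zero

blocksP : Pure {1} λ e → blocks (lookup e zero)
blocksP = varP zero *P (litP 1 +P classesP) +P classesP

formBoundP : Pure {1} λ e → formBound (blocks (lookup e zero))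
formBoundP = blocksP *P (blocksP *P (blocksP +P blocksP +P litP 1 +P litP 1)) +P litP 2

weightP : Pure {1} λ e → weight (lookup e zero)
weightP = boundsP (blocksP +P (litP 1 +P classesP)) formBoundP blocksP

baseP : Pure {1} λ e → base (lookup e zero)
baseP = congP (λ e → sym (base≡ (lookup e zero))) (litP 4 +P classesP +P blocksP +P (weightP +P weightP))

towerP : Pure {1} λ e → lookup e zero ^ (lookup e zero * lookup e zero)
towerP = varP zero ^P (varP zero *P varP zero)

squareF : Fn {0} λ G _ → ∑ (glob G gN) (λ _ → glob G gN)
squareF = sumF gN (gblF gN)

^-distribʳ-* : ∀ n a b → (a * b) ^ n ≡ a ^ n * b ^ n
^-distribʳ-* zero    a b = refl
^-distribʳ-* (suc n) a b = trans (cong (a * b *_) (^-distribʳ-* n a b)) (arrange a b (a ^ n) (b ^ n))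
  where
  arrange : ∀ a b x y → a * b * (x * y) ≡ a * x * (b * y)
  arrange = solve-∀

module Assemble (yP : Pure {1} λ e → base (lookup e zero))
                (vP : Pure {1} λ e → lookup e zero ^ (lookup e zero * lookup e zero))
                (sqF : Fn {0} λ G _ → ∑ (glob G gN) (λ _ → glob G gN))
                (answer : Globals → ℕ → ℕ) (oF : Fn {1} λ G e → answer G (lookup e zero)) where

  -- Registers 0 to 3 hold n, the number of codes, their base and n².  Positions
  -- are first stored beyond the adjacency matrix, which is needed until the end.
  scratch : Exp
  scratch = lit 1 ⊕ var 3 ⊕ var 4

  computeBody copyBody : Cmd
  computeBody = 4 ≔ var 4 ⊖ lit 1 ⨟ code (Fn.tm oF) (λ _ → 4) 5 ⨟ store scratch (var 5)
  copyBody = 4 ≔ var 4 ⊖ lit 1 ⨟ store (var 4) (load scratch)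

  prepare program : Cmd
  prepare =
    code (Pure.tm yP) (λ _ → 1) 4 ⨟ 2 ≔ var 4 ⨟
    code (Pure.tm vP) (λ _ → 2) 4 ⨟ 1 ≔ var 4 ⨟
    code (Fn.tm sqF) (λ _ → 0) 4 ⨟ 3 ≔ var 4
  program =
    prepare ⨟ 4 ≔ var 0 ⨟ whilenz (var 4) computeBody ⨟ 4 ≔ var 0 ⨟ whilenz (var 4) copyBody

  K₁ E₁ K₂ E₂ E : ℕ
  K₁ = proj₁ (Fn.fast sqF)
  E₁ = proj₁ (proj₂ (Fn.fast sqF))
  K₂ = proj₁ (Fn.fast oF)
  E₂ = proj₁ (proj₂ (Fn.fast oF))
  E = suc (E₁ + E₂)

  prepTime : ℕ → ℕ
  prepTime k = steps tt (Pure.tm yP) (k ∷ []) + steps tt (Pure.tm vP) (base k ∷ [])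

  -- The constant 41 is made of 14 steps outside the loops and 27 steps per vertex for the control
  -- of both loops. The exponent `E` exceeds `E₁ + E₂` by one because the output term runs once for
  -- each vertex.
  bound : ℕ → ℕ
  bound k = (prepTime k + (41 + K₁ + K₂)) * codeCount k ^ E

  bound-computable : Computable bound
  bound-computable = pure⇒computable {λ e → bound (lookup e zero)}
    ((appP (stepsP (Pure.tm yP)) (varP zero) +P appP (stepsP (Pure.tm vP)) yP +P litP (41 + K₁ + K₂)) *P
     (congP (λ e → sym (codeCount≡ (lookup e zero))) (appP vP yP) ^P litP E))

  module Run {n : ℕ} (G : Graph n) (k : ℕ) where

    Γ : Globals
    Γ = globals G k

    out : ℕ → ℕ
    out = answer Γ

    N₁ M : ℕ
    -- A positive bound is needed for the empty graph too. The product below dominates all four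
    -- globals, and its powers split into a factor in k and a power of `N₁`.
    N₁ = 1 ⊔ n
    M = codeCount k * (N₁ * N₁)

    1≤V : 1 ≤ codeCount k
    1≤V = subst (1 ≤_) (sym (codeCount≡ k))
      (m^n>0 (base k) {{>-nonZero (≤-trans (s≤s z≤n) (4≤base k))}} (base k * base k))

    base≤V : base k ≤ codeCount k
    base≤V = subst (base k ≤_) (sym (codeCount≡ k)) (≤-trans (≤-reflexive (sym (^-identityʳ (base k))))
      (^-monoʳ-≤ (base k) {{>-nonZero (≤-trans (s≤s z≤n) (4≤base k))}}
        (*-mono-≤ (≤-trans (s≤s z≤n) (4≤base k)) (≤-trans (s≤s z≤n) (4≤base k)))))

    1≤N₁ : 1 ≤ N₁
    1≤N₁ = m≤m⊔n 1 n

    n≤N₁ : n ≤ N₁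
    n≤N₁ = m≤n⊔m 1 n

    V≤M : codeCount k ≤ M
    V≤M = ≤-trans (≤-reflexive (sym (*-identityʳ (codeCount k))))
        (*-monoʳ-≤ (codeCount k) (*-mono-≤ 1≤N₁ 1≤N₁))

    1≤M : 1 ≤ M
    1≤M = ≤-trans 1≤V V≤M

    nn≤M : n * n ≤ M
    nn≤M = ≤-trans (*-mono-≤ n≤N₁ n≤N₁)
        (≤-trans (≤-reflexive (sym (*-identityˡ _))) (*-monoˡ-≤ (N₁ * N₁) 1≤V))

    n≤M : n ≤ M
    n≤M = ≤-trans n≤N₁ (≤-trans (≤-trans (≤-reflexive (sym (*-identityʳ N₁))) (*-monoʳ-≤ N₁ 1≤N₁))
      (≤-trans (≤-reflexive (sym (*-identityˡ _))) (*-monoˡ-≤ (N₁ * N₁) 1≤V)))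

    Γ≤M : ∀ i → glob Γ i ≤ M
    Γ≤M gN = n≤M
    Γ≤M gV = V≤M
    Γ≤M gY = ≤-trans base≤V V≤M
    Γ≤M gL = nn≤M

    record Prepared (s : State) : Set where
      field
        r₀ : reg s 0 ≡ n
        r₁ : reg s 1 ≡ codeCount k
        r₂ : reg s 2 ≡ base k
        r₃ : reg s 3 ≡ n * n
        ms : mem s ≡ adjacencyMatrix G

    prepared : Σ State λ s → Σ ℕ λ t →
        prepare ⊢ input G k ⇓ s [ t ] × t ≤ prepTime k + 6 + K₁ * M ^ E₁ × Prepared s
    prepared =
      s₆ , _ , seq (exec R₁) (seq assign (seq (exec R₃) (seq assign (seq (exec R₅) assign)))) ,
      (begin
        time R₁ + (2 + (time R₃ + (2 + (time R₅ + 2))))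
          ≤⟨ +-mono-≤ (time≤ R₁) (+-monoʳ-≤ 2
               (+-mono-≤ (time≤ R₃) (+-monoʳ-≤ 2 (+-monoˡ-≤ 2 (≤-trans (time≤ R₅) sq-time))))) ⟩
        a + (2 + (b + (2 + (K₁ * M ^ E₁ + 2))))
          ≡⟨ arrange a b (K₁ * M ^ E₁) ⟩
        a + b + 6 + K₁ * M ^ E₁ ∎) ,
      record
        { r₀ = trans (regs (frame R₅) 0 (s≤s z≤n)) s₄₀
        ; r₁ = trans (regs (frame R₅) 1 (s≤s (s≤s z≤n))) s₄₁
        ; r₂ = trans (regs (frame R₅) 2 (s≤s (s≤s (s≤s z≤n)))) s₄₂
        ; r₃ = trans v₅ (trans (Fn.ok sqF G₄ []) (trans (∑-const (reg s₄ 0) (reg s₄ 0)) (cong₂ _*_ s₄₀ s₄₀)))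
        ; ms = trans (cells (frame R₅)) (trans (cells (frame R₃)) (cells (frame R₁)))
        }
      where
      open ≤-Reasoning
      arrange : ∀ a b c → a + (2 + (b + (2 + (c + 2)))) ≡ a + b + 6 + c
      arrange = solve-∀
      a b : ℕ
      a = steps tt (Pure.tm yP) (k ∷ [])
      b = steps tt (Pure.tm vP) (base k ∷ [])
      res₁ : Result (code (Pure.tm yP) (λ _ → 1) 4) 4 (input G k) a (eval tt (Pure.tm yP) (k ∷ []))
      res₁ = code-correct (Pure.tm yP) tt (λ { zero → s≤s (s≤s z≤n) , refl })
      s₁ s₂ : State
      s₁ = proj₁ res₁
      s₂ = set s₁ 2 (reg s₁ 4)
      R₁ = proj₁ (proj₂ res₁)
      s₁₄ : reg s₁ 4 ≡ base k
      s₁₄ = trans (proj₂ (proj₂ res₁)) (Pure.ok yP (k ∷ []))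
      res₃ : Result (code (Pure.tm vP) (λ _ → 2) 4) 4 s₂ b (eval tt (Pure.tm vP) (base k ∷ []))
      res₃ = code-correct (Pure.tm vP) tt (λ { zero → s≤s (s≤s (s≤s z≤n)) , s₁₄ })
      s₃ s₄ : State
      s₃ = proj₁ res₃
      s₄ = set s₃ 1 (reg s₃ 4)
      R₃ = proj₁ (proj₂ res₃)
      s₄₀ : reg s₄ 0 ≡ n
      s₄₀ = trans (regs (frame R₃) 0 (s≤s z≤n)) (regs (frame R₁) 0 (s≤s z≤n))
      s₄₁ : reg s₄ 1 ≡ codeCount k
      s₄₁ = trans (proj₂ (proj₂ res₃)) (trans (Pure.ok vP (base k ∷ [])) (sym (codeCount≡ k)))
      s₄₂ : reg s₄ 2 ≡ base k
      s₄₂ = trans (regs (frame R₃) 2 (s≤s (s≤s (s≤s z≤n)))) s₁₄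
      s₄₃ : reg s₄ 3 ≡ 0
      s₄₃ = trans (regs (frame R₃) 3 ≤-refl) (regs (frame R₁) 3 ≤-refl)
      -- Register 3 still holds 0 and not the square, so the squaring term runs with globals read
      -- off from the current state.
      G₄ : Globals
      G₄ = record { glob = λ i → reg s₄ (toℕ i) ; cell = mem s₄ }
      res₅ : Result (code (Fn.tm sqF) (λ _ → 0) 4) 4 s₄ (steps G₄ (Fn.tm sqF) []) (eval G₄ (Fn.tm sqF) [])
      res₅ = code-correct (Fn.tm sqF) (≤-refl , (λ _ → refl) , (λ _ _ → refl)) (λ ())
      s₅ s₆ : State
      s₅ = proj₁ res₅
      s₆ = set s₅ 3 (reg s₅ 4)
      R₅ = proj₁ (proj₂ res₅)
      v₅ : reg s₅ 4 ≡ eval G₄ (Fn.tm sqF) []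
      v₅ = proj₂ (proj₂ res₅)
      small : ∀ i → reg s₄ (toℕ i) ≤ M
      small gN = ≤-trans (≤-reflexive s₄₀) n≤M
      small gV = ≤-trans (≤-reflexive s₄₁) V≤M
      small gY = ≤-trans (≤-reflexive s₄₂) (≤-trans base≤V V≤M)
      small gL = ≤-trans (≤-reflexive s₄₃) z≤n
      sq-time : steps G₄ (Fn.tm sqF) [] ≤ K₁ * M ^ E₁
      sq-time = proj₂ (proj₂ (Fn.fast sqF)) G₄ [] M 1≤M small

    -- Cell `n * n` is spared as well, because a clamped address may reach it.
    cellAt : ℕ → ℕ
    cellAt v = 1 + n * n + v

    record Computing (r : ℕ) (s : State) : Set where
      field
        agrees : Agrees true Γ 4 s
        count  : reg s 4 ≡ r
        done   : ∀ v → r ≤ v → v < n → mem s (cellAt v) ≡ out v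

    open Computing

    computing-step : ∀ {r s} → r < n → Computing (suc r) s →
      Σ State λ s′ → Σ ℕ λ t → computeBody ⊢ s ⇓ s′ [ t ] × t ≤ 11 + K₂ * M ^ E₂ × Computing r s′
    computing-step {r} {s} r<n c =
      s₃ , _ , seq assign (seq (exec R) store) ,
      (begin
        4 + (time R + 7)        ≤⟨ +-monoʳ-≤ 4
            (+-monoˡ-≤ 7 (≤-trans (time≤ R) (proj₂ (proj₂ (Fn.fast oF)) Γ (r ∷ []) M 1≤M Γ≤M))) ⟩
        4 + (K₂ * M ^ E₂ + 7)   ≡⟨ arrange (K₂ * M ^ E₂) ⟩
        11 + K₂ * M ^ E₂        ∎) ,
      record
        { agrees = ≤-refl , (λ i → trans (regs (frame R) (toℕ i) (<-trans (Fin.toℕ<n i) (n<1+n 4)))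
            (proj₁ (proj₂ A₁) i)) , low
        ; count  = trans (regs (frame R) 4 ≤-refl) r≡
        ; done   = done′
        }
      where
      open ≤-Reasoning
      arrange : ∀ x → 4 + (x + 7) ≡ 11 + x
      arrange = solve-∀
      s₁ : State
      s₁ = set s 4 (reg s 4 ∸ 1)
      r≡ : reg s₁ 4 ≡ r
      r≡ = cong (_∸ 1) (count c)
      A₁ : Agrees true Γ 5 s₁
      A₁ = n≤1+n 4 , (λ { gN → proj₁ (proj₂ (agrees c)) gN ; gV → proj₁ (proj₂ (agrees c)) gV
                        ; gY → proj₁ (proj₂ (agrees c)) gY ; gL → proj₁ (proj₂ (agrees c)) gL }) , proj₂
                            (proj₂ (agrees c))
      res : Result (code (Fn.tm oF) (λ _ → 4) 5) 5 s₁ (steps Γ (Fn.tm oF) (r ∷ []))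
          (eval Γ (Fn.tm oF) (r ∷ []))
      res = code-correct (Fn.tm oF) A₁ (λ { zero → ≤-refl , r≡ })
      s₂ s₃ : State
      s₂ = proj₁ res
      s₃ = ⟨ reg s₂ , mem s₂ [ 1 + reg s₂ 3 + reg s₂ 4 ↦ reg s₂ 5 ] ⟩
      R = proj₁ (proj₂ res)
      address : 1 + reg s₂ 3 + reg s₂ 4 ≡ cellAt r
      address = cong₂ (λ x y → 1 + x + y)
        (trans (regs (frame R) 3 (s≤s (s≤s (s≤s (s≤s z≤n))))) (proj₁ (proj₂ A₁) gL))
            (trans (regs (frame R) 4 ≤-refl) r≡)
      mem≡ : mem s₂ ≡ mem s
      mem≡ = cells (frame R)
      other : ∀ a → a ≢ cellAt r → mem s₃ a ≡ mem s a
      other a a≢ = trans (upd-other (mem s₂) (reg s₂ 5) (λ eq → a≢ (trans eq address)))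
          (cong (λ f → f a) mem≡)
      low : ∀ a → a ≤ n * n → mem s₃ a ≡ adjacencyMatrix G a
      low a a≤ = trans (other a (<⇒≢ (≤-trans (s≤s a≤) (m≤m+n (1 + n * n) r))))
          (proj₂ (proj₂ (agrees c)) a a≤)
      done′ : ∀ v → r ≤ v → v < n → mem s₃ (cellAt v) ≡ out v
      done′ v r≤v v<n = by (m≤n⇒m<n∨m≡n r≤v)
        where
        by : r < v ⊎ r ≡ v → mem s₃ (cellAt v) ≡ out v
        by (inj₁ r<v)  = trans (other (cellAt v) (≢-sym (<⇒≢ (+-monoʳ-< (1 + n * n) r<v)))) (done c v r<v v<n)
        by (inj₂ refl) = trans (cong (mem s₃) (sym address))
            (trans (upd-same (mem s₂) _ _) (trans (proj₂ (proj₂ res)) (Fn.ok oF Γ (v ∷ []))))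

    computing-loop : ∀ r {s} → r ≤ n → Computing r s →
      Σ State λ s′ → Σ ℕ λ t → whilenz (var 4) computeBody ⊢ s ⇓ s′ [ t ] × t ≤ 2 + r *
          (13 + K₂ * M ^ E₂) × Computing 0 s′
    computing-loop zero    {s} r≤n c = s , _ , while-zero (count c) , ≤-refl , c
    computing-loop (suc r) {s} r<n c =
      let (s₁ , t₁ , D₁ , le₁ , c₁) = computing-step r<n c
          (s₂ , t₂ , D₂ , le₂ , c₂) = computing-loop r (<⇒≤ r<n) c₁
      in s₂ , _ , while-nonzero (λ z → contradiction (trans (sym (count c)) z) λ ()) D₁ D₂ ,
         ≤-trans (+-mono-≤ (+-monoʳ-≤ 2 le₁) le₂)
             (≤-reflexive (arrange (K₂ * M ^ E₂) (r * (13 + K₂ * M ^ E₂)))) , c₂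
      where
      arrange : ∀ x y → 2 + (11 + x) + (2 + y) ≡ 2 + (13 + x + y)
      arrange = solve-∀

    record Copying (r : ℕ) (s : State) : Set where
      field
        square : reg s 3 ≡ n * n
        count′ : reg s 4 ≡ r
        source : ∀ v → v < n → mem s (cellAt v) ≡ out v
        copied : ∀ v → r ≤ v → v < n → mem s v ≡ out v

    open Copying

    -- Makes copying safe: its targets lie below n, hence below the scratch area that starts after
    -- `n * n`.
    n≤nn : ∀ {r} → r < n → n ≤ n * n
    n≤nn r<n = m≤m*n n n {{>-nonZero (≤-trans (s≤s z≤n) r<n)}}

    copying-step : ∀ {r s} → r < n → Copying (suc r) s →
      Σ State λ s′ → copyBody ⊢ s ⇓ s′ [ 12 ] × Copying r s′
    copying-step {r} {s} r<n c = s₂ , seq assign store , record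
      { square = square c
      ; count′ = r≡
      ; source = λ v v<n → trans
          (other (cellAt v) (≢-sym (<⇒≢
              (≤-trans (<-≤-trans r<n (n≤nn r<n)) (≤-trans (n≤1+n (n * n)) (m≤m+n (1 + n * n) v))))))
                  (source c v v<n)
      ; copied = copied′
      }
      where
      s₁ s₂ : State
      s₁ = set s 4 (reg s 4 ∸ 1)
      s₂ = ⟨ reg s₁ , mem s [ reg s₁ 4 ↦ mem s (1 + reg s 3 + reg s₁ 4) ] ⟩
      r≡ : reg s₁ 4 ≡ r
      r≡ = cong (_∸ 1) (count′ c)
      other : ∀ a → a ≢ r → mem s₂ a ≡ mem s a
      other a a≢ = upd-other (mem s) _ (λ eq → a≢ (trans eq r≡))
      copied′ : ∀ v → r ≤ v → v < n → mem s₂ v ≡ out v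
      copied′ v r≤v v<n = by (m≤n⇒m<n∨m≡n r≤v)
        where
        by : r < v ⊎ r ≡ v → mem s₂ v ≡ out v
        by (inj₁ r<v)  = trans (other v (≢-sym (<⇒≢ r<v))) (copied c v r<v v<n)
        by (inj₂ refl) = trans (cong (mem s₂) (sym r≡)) (trans (upd-same (mem s) (reg s₁ 4) _)
          (trans (cong (mem s) (cong₂ (λ x y → 1 + x + y) (square c) r≡)) (source c v v<n)))

    copying-loop : ∀ r {s} → r ≤ n → Copying r s →
      Σ State λ s′ → Σ ℕ λ t → whilenz (var 4) copyBody ⊢ s ⇓ s′ [ t ] × t ≤ 2 + r * 14 × Copying 0 s′
    copying-loop zero    {s} r≤n c = s , _ , while-zero (count′ c) , ≤-refl , c
    copying-loop (suc r) {s} r<n c =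
      let (s₁ , D₁ , c₁) = copying-step r<n c
          (s₂ , t₂ , D₂ , le₂ , c₂) = copying-loop r (<⇒≤ r<n) c₁
      in s₂ , _ , while-nonzero (λ z → contradiction (trans (sym (count′ c)) z) λ ()) D₁ D₂ ,
         ≤-trans (+-monoʳ-≤ 14 le₂) (≤-reflexive (arrange (r * 14))) , c₂
      where
      arrange : ∀ y → 14 + (2 + y) ≡ 2 + (14 + y)
      arrange = solve-∀

    time-bound : prepTime k + 6 + K₁ * M ^ E₁ +
        (2 + (2 + n * (13 + K₂ * M ^ E₂) + (2 + (2 + n * 14)))) ≤ bound k * N₁ ^ (E + E)
    time-bound = begin
      p + 6 + K₁ * M ^ E₁ + (2 + (2 + n * (13 + K₂ * M ^ E₂) + (2 + (2 + n * 14))))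
        ≡⟨ regroup p (K₁ * M ^ E₁) n (K₂ * M ^ E₂) ⟩
      (p + 14) + K₁ * M ^ E₁ + n * (27 + K₂ * M ^ E₂)
        ≤⟨ +-mono-≤ (+-mono-≤ (≤-trans (≤-reflexive (sym (*-identityʳ (p + 14)))) (*-monoʳ-≤ (p + 14) 1≤X))
             (*-monoʳ-≤ K₁ E₁≤))
             (*-mono-≤ n≤M (+-monoˡ-≤ (K₂ * M ^ E₂)
                 (≤-trans (≤-reflexive (sym (*-identityʳ 27))) (*-monoʳ-≤ 27 (m^n>0 M E₂))))) ⟩
      (p + 14) * X + K₁ * X + M * (27 * M ^ E₂ + K₂ * M ^ E₂)
        ≡⟨ cong ((p + 14) * X + K₁ * X +_) (pull M (M ^ E₂) K₂) ⟩
      (p + 14) * X + K₁ * X + (27 + K₂) * M ^ suc E₂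
        ≤⟨ +-monoʳ-≤ ((p + 14) * X + K₁ * X) (*-monoʳ-≤ (27 + K₂) (^-monoʳ-≤ M (s≤s (m≤n+m E₂ E₁)))) ⟩
      (p + 14) * X + K₁ * X + (27 + K₂) * X
        ≡⟨ collect p K₁ K₂ X ⟩
      (p + (41 + K₁ + K₂)) * X
        ≡⟨ cong ((p + (41 + K₁ + K₂)) *_) X≡ ⟩
      (p + (41 + K₁ + K₂)) * (codeCount k ^ E * N₁ ^ (E + E))
        ≡⟨ *-assoc (p + (41 + K₁ + K₂)) (codeCount k ^ E) (N₁ ^ (E + E)) ⟨
      bound k * N₁ ^ (E + E) ∎
      where
      open ≤-Reasoning
      instance
        M≢0 : NonZero M
        M≢0 = >-nonZero 1≤M
      p X : ℕ
      p = prepTime k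
      X = M ^ E
      1≤X : 1 ≤ X
      1≤X = m^n>0 M E
      E₁≤ : M ^ E₁ ≤ X
      E₁≤ = ^-monoʳ-≤ M (m≤n⇒m≤1+n (m≤m+n E₁ E₂))
      X≡ : X ≡ codeCount k ^ E * N₁ ^ (E + E)
      X≡ = trans (^-distribʳ-* E (codeCount k) (N₁ * N₁))
          (cong (codeCount k ^ E *_) (trans (^-distribʳ-* E N₁ N₁) (sym (^-distribˡ-+-* N₁ E E))))
      regroup : ∀ p a n b → p + 6 + a + (2 + (2 + n * (13 + b) + (2 + (2 + n * 14)))) ≡ (p + 14) + a + n *
          (27 + b)
      regroup = solve-∀
      pull : ∀ m x c → m * (27 * x + c * x) ≡ (27 + c) * (m * x)
      pull = solve-∀
      collect : ∀ p a b x → (p + 14) * x + a * x + (27 + b) * x ≡ (p + (41 + a + b)) * x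
      collect = solve-∀

    solves : (Σ (Permutation′ n) λ σ → (∀ v → out (toℕ v) ≡ position σ v) × IsOptimal G σ) →
             SolvesWithin program G k (bound k * N₁ ^ (E + E))
    solves (σ , outs , opt) =
      let (s₁ , t₁ , D₁ , le₁ , P) = prepared
          open Prepared P
          start = record
            { agrees = ≤-refl , (λ { gN → r₀ ; gV → r₁ ; gY → r₂ ; gL → r₃ }) , (λ a _ → cong (λ f → f a) ms)
            ; count = r₀ ; done = λ v n≤v v<n → contradiction v<n (≤⇒≯ n≤v) }
          (s₂ , t₂ , D₂ , le₂ , c₂) = computing-loop n {set s₁ 4 (reg s₁ 0)} ≤-refl start
          start′ = record
            { square = proj₁ (proj₂ (agrees c₂)) gL ; count′ = proj₁ (proj₂ (agrees c₂)) gN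
            ; source = λ v v<n → done c₂ v z≤n v<n ; copied = λ v n≤v v<n → contradiction v<n (≤⇒≯ n≤v) }
          (s₃ , t₃ , D₃ , le₃ , c₃) = copying-loop n {set s₂ 4 (reg s₂ 0)} ≤-refl start′
      in s₃ , _ , seq D₁ (seq assign (seq D₂ (seq assign D₃))) ,
         ≤-trans (+-mono-≤ le₁ (+-monoʳ-≤ 2 (+-mono-≤ le₂ (+-monoʳ-≤ 2 le₃)))) time-bound ,
         σ , (λ v → trans (copied c₃ (toℕ v) z≤n (Fin.toℕ<n v)) (outs v)) , opt

  fpt : (∀ {n} (G : Graph n) k → HasVertexCover≤ G k →
          Σ (Permutation′ n) λ σ → (∀ v → answer (globals G k) (toℕ v) ≡ position σ v) × IsOptimal G σ) →
        Σ Cmd λ p → Σ (ℕ → ℕ) λ f → Σ ℕ λ c → Computable f ×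
          (∀ (n : ℕ) (G : Graph n) (k : ℕ) → HasVertexCover≤ G k → SolvesWithin p G k (f k * (1 ⊔ n) ^ c))
  fpt optimal = program , bound , E + E , bound-computable , λ n G k vc → Run.solves G k (optimal G k vc)

theorem3 : Σ Cmd λ p → Σ (ℕ → ℕ) λ f → Σ ℕ λ c → Computable f ×
    (∀ (n : ℕ) (G : Graph n) (k : ℕ) → HasVertexCover≤ G k →
    SolvesWithin p G k (f k * (1 ⊔ n) ^ c))
theorem3 = Assemble.fpt baseP towerP squareF Algorithm.out outF λ G k (C , cover , ∣C∣≤k) →
    Covered.optimal G k C cover ∣C∣≤k
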